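{- Let $n>1$, $d\ge 2$ and $t$ be integers with $\gcd(t,d)=1$, $n\equiv t\pmod d$ and $n+d-nd\le t\le n$. Then, modulo $[n]_{q^2}\Phi_n(q^2)^2$, \[ \sum_{k=0}^{(n-t)/d}[2dk+t]_{q^2}[2dk+t]^2\frac{(q^{2t};q^{2d})_k^4}{(q^{2d};q^{2d})_k^4}q^{ -4tk}\equiv \frac{ -2[t]^2[n]_{q^2}(q^{4t};q^{2d})_{(n-t)/d}}{(1+q^{2t})(q^{2d};q^{2d})_{(n-t)/d}}q^{t-2t(n-t)/d}, \] and \[ \sum_{k=0}^{n-1}[2dk+t]_{q^2}[2dk+t]^2\frac{(q^{2t};q^{2d})_k^4}{(q^{2d};q^{2d})_k^4}q^{ -4tk}\equiv \frac{ -2[t]^2[n]_{q^2}(q^{4t};q^{2d})_{(n-t)/d}}{(1+q^{2t})(q^{2d};q^{2d})_{(n-t)/d}}q^{t-2t(n-t)/d}. \]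
   Context: For an indeterminate $q$, $(x;q)_k=(1-x)(1-xq)\cdots(1-xq^{k-1})$ (with $(x;q)_0=1$). For any integer $m$, $[m]=(1-q^m)/(1-q)$ and $[m]_{q^2}=(1-q^{2m})/(1-q^2)$. $\Phi_n(x)$ is the $n$-th cyclotomic polynomial, evaluated here at $x=q^2$. A congruence $A\equiv B\pmod{P(q)}$ between rational functions in $q$ means that $A-B$, written as a quotient of polynomials with denominator coprime to $P(q)$, has numerator divisible by $P(q)$. -}

module Defs where

open import Algebra.Bundles.Raw using (RawRing)
import Algebra.Definitions.RawSemiring as RawSemiringDefs
open import Data.Bool.Base using (if_then_else_)
open import Data.Empty using (⊥-elim)
open import Data.Fin.Base as Fin using (Fin; toℕ)
open import Data.Fin.Properties using (toℕ<n)
open import Data.Integer.Base as ℤ using (ℤ; +_; -[1+_])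
open import Data.List.Base using (List; []; _∷_; map)
open import Data.Nat.Base as ℕ using (ℕ; zero; suc)
open import Data.Nat.Divisibility using (_∣?_)
open import Data.Nat.Induction using (<-rec; <-wellFounded)
open import Data.Product.Base using (_×_; _,_; proj₁)
open import Data.Rational.Base as ℚ using (ℚ; 0ℚ; 1ℚ)
import Data.Rational.Properties as ℚ
open import Data.Vec.Functional using (Vector)
open import Function.Base using (_∘_)
open import Induction.WellFounded using (WfRec; module FixPoint)
open import Level using (0ℓ)
open import Relation.Binary.PropositionalEquality
  using (_≡_; refl; sym; trans; cong; cong₂; module ≡-Reasoning)
open import Relation.Nullary using (¬_; Dec; yes; no; does)

------------------------------------------------------------------------
-- The polynomial ring ℚ[q]

-- Coefficients are listed from the constant term upwards. Trailing zeros
-- are allowed, so the equality of polynomials is _≈ₚ_ and not _≡_.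

Poly : Set
Poly = List ℚ

coeff : Poly → ℕ → ℚ
coeff []      _       = 0ℚ
coeff (a ∷ p) zero    = a
coeff (a ∷ p) (suc i) = coeff p i

infix 4 _≈ₚ_

record _≈ₚ_ (p r : Poly) : Set where
  constructor mk≈
  field
    coeff-≡ : ∀ i → coeff p i ≡ coeff r i

open _≈ₚ_ public

infixl 6 _+ₚ_ _-ₚ_
infixl 7 _*ₚ_ _·ₚ_
infix  8 -ₚ_

0ₚ 1ₚ X : Poly
0ₚ = []
1ₚ = 1ℚ ∷ []
X  = 0ℚ ∷ 1ℚ ∷ []

_+ₚ_ : Poly → Poly → Poly
[]      +ₚ r       = r
(a ∷ p) +ₚ []      = a ∷ p
(a ∷ p) +ₚ (b ∷ r) = (a ℚ.+ b) ∷ (p +ₚ r)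

_·ₚ_ : ℚ → Poly → Poly
c ·ₚ p = map (c ℚ.*_) p

-ₚ_ : Poly → Poly
-ₚ p = map ℚ.-_ p

_-ₚ_ : Poly → Poly → Poly
p -ₚ r = p +ₚ (-ₚ r)

_*ₚ_ : Poly → Poly → Poly
[]      *ₚ r = []
(a ∷ p) *ₚ r = (a ·ₚ r) +ₚ (0ℚ ∷ p *ₚ r)

polyRawRing : RawRing 0ℓ 0ℓ
polyRawRing = record
  { Carrier = Poly
  ; _≈_     = _≈ₚ_
  ; _+_     = _+ₚ_
  ; _*_     = _*ₚ_
  ; -_      = -ₚ_
  ; 0#      = 0ₚ
  ; 1#      = 1ₚ
  }

open RawSemiringDefs (RawRing.rawSemiring polyRawRing) public
  using ()
  renaming
  ( _^_ to _^ₚ_; sum to sumₚ; product to productₚ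
  ; _∣_ to _∣ₚ_; Coprime to Coprimeₚ )

infixr 9 _∘ₚ_

_∘ₚ_ : Poly → Poly → Poly
[]      ∘ₚ r = []
(a ∷ p) ∘ₚ r = (a ∷ []) +ₚ r *ₚ (p ∘ₚ r)

≈0? : (p : Poly) → Dec (p ≈ₚ 0ₚ)
≈0? []      = yes (mk≈ λ _ → refl)
≈0? (a ∷ p) with a ℚ.≟ 0ℚ | ≈0? p
... | yes a≡0 | yes p≈0 = yes (mk≈ λ where
                            zero    → a≡0
                            (suc i) → coeff-≡ p≈0 i)
... | no  a≢0 | _       = no λ ap≈0 → a≢0 (coeff-≡ ap≈0 0)
... | _       | no p≉0  = no λ ap≈0 → p≉0 (mk≈ (coeff-≡ ap≈0 ∘ suc))

-- The zero polynomial is given degree 0.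

degree : Poly → ℕ
degree []      = 0
degree (a ∷ p) with ≈0? p
... | yes _ = 0
... | no  _ = suc (degree p)

-- Long division by a monic g of degree m: if p = s g + r with deg r < m,
-- then a + q p = (q s + c) g + ((a + q r) - c g), where c is the
-- coefficient of q^m in a + q r. The result is meaningless when g is not
-- monic.

divMod : Poly → Poly → Poly × Poly
divMod []      g = [] , []
divMod (a ∷ p) g with divMod p g
... | s , r = c ∷ s , (a ∷ r) -ₚ (c ·ₚ g)
  where c = coeff (a ∷ r) (degree g)

_quo_ : Poly → Poly → Poly
p quo g = proj₁ (divMod p g)

------------------------------------------------------------------------
-- Cyclotomic polynomials

-- The index of productₚ below runs over 0 ≤ m < n; for n ≥ 1 the value
-- m = 0 contributes 1, since 0 does not divide n.

ΦStep : ∀ n → WfRec ℕ._<_ (λ _ → Poly) n → Poly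
ΦStep n rec =
  (X ^ₚ n -ₚ 1ₚ) quo
  productₚ {n} (λ m → if does (toℕ m ∣? n) then rec (toℕ<n m) else 1ₚ)

Φ : ℕ → Poly
Φ = <-rec (λ _ → Poly) ΦStep

private

  productₚ-cong : ∀ {n} {f g : Vector Poly n} →
                  (∀ i → f i ≡ g i) → productₚ f ≡ productₚ g
  productₚ-cong {zero}  f≡g = refl
  productₚ-cong {suc n} f≡g =
    cong₂ _*ₚ_ (f≡g Fin.zero) (productₚ-cong (f≡g ∘ Fin.suc))

  ΦStep-ext : ∀ n {rec rec′ : WfRec ℕ._<_ (λ _ → Poly) n} →
              (∀ {m} (m<n : m ℕ.< n) → rec m<n ≡ rec′ m<n) →
              ΦStep n rec ≡ ΦStep n rec′
  ΦStep-ext n rec≡rec′ =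
    cong ((X ^ₚ n -ₚ 1ₚ) quo_) (productₚ-cong λ m →
      cong (if does (toℕ m ∣? n) then_else 1ₚ) (rec≡rec′ (toℕ<n m)))

Φ-unfold : ∀ n → Φ n ≡
  (X ^ₚ n -ₚ 1ₚ) quo
  productₚ {n} (λ m → if does (toℕ m ∣? n) then Φ (toℕ m) else 1ₚ)
Φ-unfold n =
  FixPoint.unfold-wfRec <-wellFounded (λ _ → Poly) ΦStep ΦStep-ext {n}

------------------------------------------------------------------------
-- ℚ[q] has no zero divisors

coeff-+ₚ : ∀ p r i → coeff (p +ₚ r) i ≡ coeff p i ℚ.+ coeff r i
coeff-+ₚ []      r       i       = sym (ℚ.+-identityˡ (coeff r i))
coeff-+ₚ (a ∷ p) []      i       = sym (ℚ.+-identityʳ (coeff (a ∷ p) i))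
coeff-+ₚ (a ∷ p) (b ∷ r) zero    = refl
coeff-+ₚ (a ∷ p) (b ∷ r) (suc i) = coeff-+ₚ p r i

coeff-·ₚ : ∀ c p i → coeff (c ·ₚ p) i ≡ c ℚ.* coeff p i
coeff-·ₚ c []      i       = sym (ℚ.*-zeroʳ c)
coeff-·ₚ c (a ∷ p) zero    = refl
coeff-·ₚ c (a ∷ p) (suc i) = coeff-·ₚ c p i

coeff-∷-*ₚ : ∀ a p r i →
  coeff ((a ∷ p) *ₚ r) i ≡ a ℚ.* coeff r i ℚ.+ coeff (0ℚ ∷ p *ₚ r) i
coeff-∷-*ₚ a p r i =
  trans (coeff-+ₚ (a ·ₚ r) (0ℚ ∷ p *ₚ r) i)
        (cong (ℚ._+ coeff (0ℚ ∷ p *ₚ r) i) (coeff-·ₚ a r i))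

private

  a*b≡0⇒b≡0 : ∀ {a b} → ¬ a ≡ 0ℚ → a ℚ.* b ≡ 0ℚ → b ≡ 0ℚ
  a*b≡0⇒b≡0 {a} {b} a≢0 ab≡0 = begin
    b                        ≡⟨ ℚ.*-identityˡ b ⟨
    1ℚ ℚ.* b                 ≡⟨ cong (ℚ._* b) (ℚ.*-inverseˡ a) ⟨
    (ℚ.1/ a) ℚ.* a ℚ.* b     ≡⟨ ℚ.*-assoc (ℚ.1/ a) a b ⟩
    (ℚ.1/ a) ℚ.* (a ℚ.* b)   ≡⟨ cong ((ℚ.1/ a) ℚ.*_) ab≡0 ⟩
    (ℚ.1/ a) ℚ.* 0ℚ          ≡⟨ ℚ.*-zeroʳ (ℚ.1/ a) ⟩
    0ℚ                       ∎
    where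
    open ≡-Reasoning
    instance
      a-nonZero : ℚ.NonZero a
      a-nonZero = ℚ.≢-nonZero a≢0

  coeff₀-*ₚ : ∀ p b r → coeff (p *ₚ (b ∷ r)) 0 ≡ coeff p 0 ℚ.* b
  coeff₀-*ₚ []      b r = sym (ℚ.*-zeroˡ b)
  coeff₀-*ₚ (a ∷ p) b r = ℚ.+-identityʳ (a ℚ.* b)

  coeff-*ₚ-shift : ∀ p r i → coeff (p *ₚ (0ℚ ∷ r)) (suc i) ≡ coeff (p *ₚ r) i
  coeff-*ₚ-shift []      r i = refl
  coeff-*ₚ-shift (a ∷ p) r i = begin
    coeff ((a ∷ p) *ₚ (0ℚ ∷ r)) (suc i)
      ≡⟨ coeff-∷-*ₚ a p (0ℚ ∷ r) (suc i) ⟩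
    a ℚ.* coeff r i ℚ.+ coeff (p *ₚ (0ℚ ∷ r)) i
      ≡⟨ cong (a ℚ.* coeff r i ℚ.+_) (tail i) ⟩
    a ℚ.* coeff r i ℚ.+ coeff (0ℚ ∷ p *ₚ r) i
      ≡⟨ coeff-∷-*ₚ a p r i ⟨
    coeff ((a ∷ p) *ₚ r) i ∎
    where
    open ≡-Reasoning
    tail : ∀ i → coeff (p *ₚ (0ℚ ∷ r)) i ≡ coeff (0ℚ ∷ p *ₚ r) i
    tail zero    = trans (coeff₀-*ₚ p 0ℚ r) (ℚ.*-zeroʳ (coeff p 0))
    tail (suc i) = coeff-*ₚ-shift p r i

  *ₚ-cancel-∷ : ∀ {a} p r → ¬ a ≡ 0ℚ → (a ∷ p) *ₚ r ≈ₚ 0ₚ → r ≈ₚ 0ₚ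
  *ₚ-cancel-∷     p []      a≢0 pr≈0 = mk≈ λ _ → refl
  *ₚ-cancel-∷ {a} p (b ∷ r) a≢0 pr≈0
    with a*b≡0⇒b≡0 a≢0 (trans (sym (coeff₀-*ₚ (a ∷ p) b r)) (coeff-≡ pr≈0 0))
  ... | refl = mk≈ λ where
      zero    → refl
      (suc i) → coeff-≡ r≈0 i
    where
    r≈0 : r ≈ₚ 0ₚ
    r≈0 = *ₚ-cancel-∷ p r a≢0 (mk≈ λ i →
      trans (sym (coeff-*ₚ-shift (a ∷ p) r i)) (coeff-≡ pr≈0 (suc i)))

*ₚ-cancel-0 : ∀ p r → ¬ p ≈ₚ 0ₚ → p *ₚ r ≈ₚ 0ₚ → r ≈ₚ 0ₚ
*ₚ-cancel-0 []      r p≉0 pr≈0 = ⊥-elim (p≉0 (mk≈ λ _ → refl))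
*ₚ-cancel-0 (a ∷ p) r p≉0 pr≈0 with a ℚ.≟ 0ℚ
... | no  a≢0  = *ₚ-cancel-∷ p r a≢0 pr≈0
... | yes refl = *ₚ-cancel-0 p r p≉0′ (mk≈ λ i → begin
    coeff (p *ₚ r) i                          ≡⟨ ℚ.+-identityˡ _ ⟨
    0ℚ ℚ.+ coeff (p *ₚ r) i
      ≡⟨ cong (ℚ._+ coeff (p *ₚ r) i) (ℚ.*-zeroˡ (coeff r (suc i))) ⟨
    0ℚ ℚ.* coeff r (suc i) ℚ.+ coeff (p *ₚ r) i
      ≡⟨ coeff-∷-*ₚ 0ℚ p r (suc i) ⟨
    coeff ((0ℚ ∷ p) *ₚ r) (suc i)             ≡⟨ coeff-≡ pr≈0 (suc i) ⟩
    0ℚ                                        ∎)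
  where
  open ≡-Reasoning
  p≉0′ : ¬ p ≈ₚ 0ₚ
  p≉0′ p≈0 = p≉0 (mk≈ λ where
    zero    → refl
    (suc i) → coeff-≡ p≈0 i)

*ₚ-≉0 : ∀ p r → ¬ p ≈ₚ 0ₚ → ¬ r ≈ₚ 0ₚ → ¬ p *ₚ r ≈ₚ 0ₚ
*ₚ-≉0 p r p≉0 r≉0 pr≈0 = r≉0 (*ₚ-cancel-0 p r p≉0 pr≈0)

1ₚ≉0 : ¬ 1ₚ ≈ₚ 0ₚ
1ₚ≉0 1≈0 with coeff-≡ 1≈0 0
... | ()

------------------------------------------------------------------------
-- The field ℚ(q)

record RatFun : Set where
  constructor mkRatFun
  field
    num   : Poly
    den   : Poly
    den≉0 : ¬ den ≈ₚ 0ₚ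

open RatFun public

infix  4 _≃_
infixl 6 _+_ _-_
infixl 7 _*_ _/_
infix  8 -_
infixr 8 _^ℤ_
infix  9 _⁻¹

_≃_ : RatFun → RatFun → Set
f ≃ g = num f *ₚ den g ≈ₚ num g *ₚ den f

fromPoly : Poly → RatFun
fromPoly p = mkRatFun p 1ₚ 1ₚ≉0

0# 1# q : RatFun
0# = fromPoly 0ₚ
1# = fromPoly 1ₚ
q  = fromPoly X

_+_ : RatFun → RatFun → RatFun
f + g = mkRatFun (num f *ₚ den g +ₚ num g *ₚ den f) (den f *ₚ den g)
                 (*ₚ-≉0 (den f) (den g) (den≉0 f) (den≉0 g))

_*_ : RatFun → RatFun → RatFun
f * g = mkRatFun (num f *ₚ num g) (den f *ₚ den g)
                 (*ₚ-≉0 (den f) (den g) (den≉0 f) (den≉0 g))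

2# : RatFun
2# = 1# + 1#

-_ : RatFun → RatFun
- f = mkRatFun (-ₚ num f) (den f) (den≉0 f)

_-_ : RatFun → RatFun → RatFun
f - g = f + (- g)

-- Inversion is total, with 0 ⁻¹ = 0.

_⁻¹ : RatFun → RatFun
f ⁻¹ with ≈0? (num f)
... | yes _     = 0#
... | no  num≉0 = mkRatFun (den f) (num f) num≉0

_/_ : RatFun → RatFun → RatFun
f / g = f * g ⁻¹

ratFunRawRing : RawRing 0ℓ 0ℓ
ratFunRawRing = record
  { Carrier = RatFun
  ; _≈_     = _≃_
  ; _+_     = _+_
  ; _*_     = _*_
  ; -_      = -_
  ; 0#      = 0#
  ; 1#      = 1#
  }

open RawSemiringDefs (RawRing.rawSemiring ratFunRawRing) public
  using (_^_; sum; product)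

_^ℤ_ : RatFun → ℤ → RatFun
f ^ℤ (+ n)    = f ^ n
f ^ℤ -[1+ n ] = (f ^ suc n) ⁻¹

-- Σ< n f = f 0 + f 1 + ⋯ + f (n - 1)

Σ< : ℕ → (ℕ → RatFun) → RatFun
Σ< n f = sum {n} (f ∘ toℕ)

------------------------------------------------------------------------
-- q-analogues

[_] : ℤ → RatFun
[ m ] = (1# - q ^ℤ m) / (1# - q)

[_]q² : ℤ → RatFun
[ m ]q² = (1# - q ^ℤ (+ 2 ℤ.* m)) / (1# - q ^ 2)

-- The q-shifted factorial (x;y)_k, with base y.

poch : RatFun → RatFun → ℕ → RatFun
poch x y k = product {k} (λ j → 1# - x * y ^ toℕ j)

-- For n ≥ 0, [ + n ]q² is the polynomial 1 + q² + ⋯ + q^(2(n-1)), which is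
-- the form needed for a modulus.

[_]q²ₚ : ℕ → Poly
[ n ]q²ₚ = sumₚ {n} (λ i → (X ^ₚ 2) ^ₚ toℕ i)

------------------------------------------------------------------------
-- Congruence of rational functions modulo a polynomial

record _≡_[mod_] (A B : RatFun) (P : Poly) : Set where
  field
    quotient    : RatFun
    quotient≃   : A - B ≃ quotient
    den-coprime : Coprimeₚ (den quotient) P
    mod∣num     : P ∣ₚ num quotient

module Submission where

import Algebra.Properties.Semiring.Exp as Exp
import Algebra.Properties.Semiring.Mult as Mult
open import Algebra.Bundles using (CommutativeMonoid; CommutativeRing; Semiring)
open import Data.Bool.Base using (Bool; true; false; if_then_else_)
open import Data.Fin.Base using (toℕ)
open import Data.Integer.Base as ℤ using (ℤ; +_; -[1+_])
open import Data.Integer.Divisibility.Signed as Signed using (divides)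
import Data.Integer.DivMod as ℤ
import Data.Integer.Properties as ℤ
import Data.Integer.Tactic.RingSolver as ℤ-Solver
open import Data.List.Base using ([]; _∷_)
open import Data.Maybe.Base using (nothing)
open import Data.Nat.Base as ℕ using (ℕ; zero; suc; _∸_; NonZero; s≤s; z≤n)
import Data.Nat.Coprimality as ℕ
import Data.Nat.DivMod as ℕ
open import Data.Nat.Divisibility as ℕ using (_∣?_; divides)
open import Data.Nat.GCD as ℕ using (module Bézout)
open import Data.Nat.Induction using (<-rec)
import Data.Nat.Properties as ℕ
open import Data.Product.Base using (∃; ∃₂; _×_; _,_; proj₁; proj₂)
open import Data.Rational.Base as ℚ using (ℚ; 0ℚ; 1ℚ)
import Data.Rational.Properties as ℚ
open import Data.Sum.Base using (inj₁; inj₂)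
open import Data.Vec.Base using (Vec)
open import Function.Base using (_∘_)
open import Level using (0ℓ)
open import Relation.Binary.Definitions using (tri<; tri≈; tri>)
open import Relation.Binary.PropositionalEquality as ≡ using (_≡_; _≢_)
open import Relation.Nullary using (¬_; yes; no; does; contradiction)
open import Tactic.RingSolver.Core.AlmostCommutativeRing using (fromCommutativeRing)
open import Tactic.RingSolver.Core.Expression
open import Tactic.RingSolver.Core.Polynomial.Parameters using (Homomorphism)

-- Put w = q², a = wᵗ, s = qᵗ, p = wᵈ, y = wⁿ = a p^N. Up to a constant the k-th summand is
-- c k = (1 - a p²ᵏ)(1 - s pᵏ)² ((a;p)_k / (p;p)_k)⁴ a⁻²ᵏ.
--
-- At a divisor m > 1 of n everything is integral at the factor Φ_m(w) of the modulus, and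
-- modulo Φ_m(w) the reflection i ↦ V - i (with V the residue of N) negates the summands of
-- each block of length m, whose first V + 1 summands are the only ones that do not vanish.
-- Hence both sides are divisible by Φ_m(w).
--
-- At m = n the cube of Φ_n(w) is needed. Replacing two of the factors (a;p)_k / (p;p)_k by
-- (a y;p)_k / (p / y;p)_k and (a / y;p)_k / (p y;p)_k makes the sum a terminating very-well-poised
-- series with a closed form, which is the right-hand side modulo (1 - y)³. The replacement
-- changes c k by the factor 1 - u ℰ k modulo u², where u = (1 - y)² / y, and c k ℰ k is again
-- antisymmetric under reflection, so that the sum changes by a multiple of (1 - y)³.
--
-- Since the Φ_m(w) are pairwise comaximal, these congruences combine to one modulo the product.

-- The library's ring solver with coefficients in ℤ rather than in the ring
-- itself, so that cancellations such as 1 - 1 are decided in any ring.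

-- The perturbation uses y and 1 / y together because the product of the two perturbed factors is
-- symmetric under y ↦ 1 / y: it depends on y only through u = y + 1 / y - 2, of order two at
-- Φ_n(w), so no term of first order in 1 - y appears. Since a p^N = y, the factor (a / y;p)_k
-- vanishes for k > N, which terminates the series. The weight (1 - s pᵏ)² does not belong to the
-- summable ₆φ₅ series; it is spread over two contiguous series, and the relation between their sums
-- produces the 1 + a of the denominator.
--
-- At proper divisors m of n the obstacle is integrality: the denominators (p;p)_k acquire factors
-- Φ_m(w) at the end of every block of length m. Since m divides n = t + d N and is coprime to d,
-- the numerators vanish at the residue of N, hence no later than the denominators in the same
-- block. To divide, orders must be known exactly and not merely bounded below; this rests on (1 -
-- wᵐᵏ) / (1 - wᵐ) ≡ k, which is invertible in characteristic zero.

module RingSolver (R : CommutativeRing 0ℓ 0ℓ) where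

  open CommutativeRing R hiding (zero)
  open import Algebra.Properties.Ring ring
  open import Algebra.Properties.AbelianGroup +-abelianGroup using (⁻¹-∙-comm)
  open import Algebra.Properties.Semiring.Mult.TCOptimised semiring renaming (_×_ to _×ᵣ_)
  open import Relation.Binary.Reasoning.Setoid setoid

  fromℤ : ℤ → Carrier
  fromℤ (+ n)    = n ×ᵣ 1#
  fromℤ -[1+ n ] = - (suc n ×ᵣ 1#)

  fromℤ-⊖ : ∀ m n → fromℤ (m ℤ.⊖ n) ≈ m ×ᵣ 1# + - (n ×ᵣ 1#)
  fromℤ-⊖ m       zero    = begin
    m ×ᵣ 1#          ≈⟨ +-identityʳ _ ⟨
    m ×ᵣ 1# + 0#     ≈⟨ +-congˡ -0#≈0# ⟨
    m ×ᵣ 1# + - 0#   ∎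
  fromℤ-⊖ zero    (suc n) = sym (+-identityˡ _)
  fromℤ-⊖ (suc m) (suc n) = begin
    fromℤ (suc m ℤ.⊖ suc n)              ≡⟨ ≡.cong fromℤ (ℤ.[1+m]⊖[1+n]≡m⊖n m n) ⟩
    fromℤ (m ℤ.⊖ n)                      ≈⟨ fromℤ-⊖ m n ⟩
    x + - y                              ≈⟨ +-congʳ (+-identityˡ x) ⟨
    0# + x + - y                         ≈⟨ +-congʳ (+-congʳ (-‿inverseʳ 1#)) ⟨
    1# + - 1# + x + - y                  ≈⟨ +-congʳ (+-assoc 1# _ x) ⟩
    1# + (- 1# + x) + - y                ≈⟨ +-congʳ (+-congˡ (+-comm _ x)) ⟩
    1# + (x + - 1#) + - y                ≈⟨ +-congʳ (+-assoc 1# x _) ⟨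
    1# + x + - 1# + - y                  ≈⟨ +-assoc _ _ _ ⟩
    1# + x + (- 1# + - y)                ≈⟨ +-cong (sym (1+× m 1#)) (⁻¹-∙-comm 1# y) ⟩
    suc m ×ᵣ 1# + - (1# + y)              ≈⟨ +-congˡ (-‿cong (1+× n 1#)) ⟨
    suc m ×ᵣ 1# + - (suc n ×ᵣ 1#)          ∎
    where
    x = m ×ᵣ 1#
    y = n ×ᵣ 1#

  fromℤ-neg : ∀ i → fromℤ (ℤ.- i) ≈ - fromℤ i
  fromℤ-neg (+ zero)  = sym -0#≈0#
  fromℤ-neg (+ suc n) = refl
  fromℤ-neg -[1+ n ]  = sym (-‿involutive _)

  fromℤ-+ : ∀ i j → fromℤ (i ℤ.+ j) ≈ fromℤ i + fromℤ j
  fromℤ-+ (+ m)    (+ n)    = ×-homo-+ 1# m n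
  fromℤ-+ (+ m)    -[1+ n ] = fromℤ-⊖ m (suc n)
  fromℤ-+ -[1+ m ] (+ n)    = trans (fromℤ-⊖ n (suc m)) (+-comm _ _)
  fromℤ-+ -[1+ m ] -[1+ n ] = begin
    - (suc (suc (m ℕ.+ n)) ×ᵣ 1#)         ≡⟨ ≡.cong (λ k → - (suc k ×ᵣ 1#)) (≡.sym (ℕ.+-suc m n)) ⟩
    - ((suc m ℕ.+ suc n) ×ᵣ 1#)           ≈⟨ -‿cong (×-homo-+ 1# (suc m) (suc n)) ⟩
    - (suc m ×ᵣ 1# + suc n ×ᵣ 1#)          ≈⟨ ⁻¹-∙-comm _ _ ⟨
    - (suc m ×ᵣ 1#) + - (suc n ×ᵣ 1#)      ∎

  fromℤ-*⁺ : ∀ m j → fromℤ (+ m ℤ.* j) ≈ m ×ᵣ 1# * fromℤ j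
  fromℤ-*⁺ m (+ n)    = begin
    fromℤ (+ m ℤ.* + n)   ≡⟨ ≡.cong fromℤ (ℤ.pos-* m n) ⟨
    (m ℕ.* n) ×ᵣ 1#        ≈⟨ ×1-homo-* m n ⟩
    m ×ᵣ 1# * (n ×ᵣ 1#)     ∎
  fromℤ-*⁺ m -[1+ n ] = begin
    fromℤ (+ m ℤ.* -[1+ n ])          ≡⟨ ≡.cong fromℤ (ℤ.neg-distribʳ-* (+ m) (+ suc n)) ⟨
    fromℤ (ℤ.- (+ m ℤ.* + suc n))     ≈⟨ fromℤ-neg (+ m ℤ.* + suc n) ⟩
    - fromℤ (+ m ℤ.* + suc n)         ≈⟨ -‿cong (fromℤ-*⁺ m (+ suc n)) ⟩
    - (m ×ᵣ 1# * (suc n ×ᵣ 1#))         ≈⟨ -‿distribʳ-* _ _ ⟩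
    m ×ᵣ 1# * - (suc n ×ᵣ 1#)           ∎

  fromℤ-* : ∀ i j → fromℤ (i ℤ.* j) ≈ fromℤ i * fromℤ j
  fromℤ-* (+ m)    j = fromℤ-*⁺ m j
  fromℤ-* -[1+ m ] j = begin
    fromℤ (-[1+ m ] ℤ.* j)            ≡⟨ ≡.cong fromℤ (ℤ.neg-distribˡ-* (+ suc m) j) ⟨
    fromℤ (ℤ.- (+ suc m ℤ.* j))       ≈⟨ fromℤ-neg (+ suc m ℤ.* j) ⟩
    - fromℤ (+ suc m ℤ.* j)           ≈⟨ -‿cong (fromℤ-*⁺ (suc m) j) ⟩
    - (suc m ×ᵣ 1# * fromℤ j)          ≈⟨ -‿distribˡ-* _ _ ⟩
    - (suc m ×ᵣ 1#) * fromℤ j          ∎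

  private
    isZero : ℤ → Bool
    isZero (+ zero) = true
    isZero _        = false

    homomorphism : Homomorphism 0ℓ 0ℓ 0ℓ 0ℓ
    homomorphism = record
      { from     = record { rawRing = ℤ.+-*-rawRing ; isZero = isZero }
      ; to       = fromCommutativeRing R (λ _ → nothing)
      ; morphism = record
        { ⟦_⟧    = fromℤ
        ; +-homo = fromℤ-+
        ; *-homo = fromℤ-*
        ; -‿homo = fromℤ-neg
        ; 0-homo = refl
        ; 1-homo = refl
        }
      ; Zero-C⟶Zero-R = λ { (+ zero) _ → refl }
      }

  open Eval (CommutativeRing.rawRing R) fromℤ
  open import Tactic.RingSolver.Core.Polynomial.Base (Homomorphism.from homomorphism)
  open import Tactic.RingSolver.Core.Polynomial.Semantics homomorphism
    renaming (⟦_⟧ to ⟦_⟧ₚ)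
  open import Tactic.RingSolver.Core.Polynomial.Homomorphism homomorphism
  open import Algebra.Properties.Semiring.Exp.TCOptimised semiring using (^-congˡ)

  private
    norm : ∀ {n} → Expr ℤ n → Poly n
    norm (Κ x)   = κ x
    norm (Ι x)   = ι x
    norm (x ⊕ y) = norm x ⊞ norm y
    norm (x ⊗ y) = norm x ⊠ norm y
    norm (⊝ x)   = ⊟ norm x
    norm (x ⊛ i) = norm x ⊡ i

    ⟦_⇓⟧ : ∀ {n} → Expr ℤ n → Vec Carrier n → Carrier
    ⟦ e ⇓⟧ = ⟦ norm e ⟧ₚ

    correct : ∀ {n} (e : Expr ℤ n) ρ → ⟦ e ⇓⟧ ρ ≈ ⟦ e ⟧ ρ
    correct (Κ x)   ρ = κ-hom x ρ
    correct (Ι x)   ρ = ι-hom x ρ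
    correct (x ⊕ y) ρ = trans (⊞-hom (norm x) (norm y) ρ) (+-cong (correct x ρ) (correct y ρ))
    correct (x ⊗ y) ρ = trans (⊠-hom (norm x) (norm y) ρ) (*-cong (correct x ρ) (correct y ρ))
    correct (⊝ x)   ρ = trans (⊟-hom (norm x) ρ) (-‿cong (correct x ρ))
    correct (x ⊛ i) ρ = trans (⊡-hom (norm x) i ρ) (^-congˡ i (correct x ρ))

  open import Relation.Binary.Reflection setoid Ι ⟦_⟧ ⟦_⇓⟧ correct public

  infixl 6 _:+_ _:-_
  infixl 7 _:*_
  infix  8 :-_

  _:+_ _:*_ _:-_ : ∀ {n} → Expr ℤ n → Expr ℤ n → Expr ℤ n
  _:+_    = _⊕_
  _:*_    = _⊗_
  x :- y  = x ⊕ (⊝ y)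

  :-_ : ∀ {n} → Expr ℤ n → Expr ℤ n
  :-_ = ⊝_

  :0 :1 : ∀ {n} → Expr ℤ n
  :0 = Κ (+ 0)
  :1 = Κ (+ 1)

-- Finite sums and products over initial segments of ℕ.

module Folds (M : CommutativeMonoid 0ℓ 0ℓ) where

  open CommutativeMonoid M
  open import Algebra.Definitions.RawMonoid rawMonoid using (sum) public
  open import Algebra.Properties.CommutativeSemigroup commutativeSemigroup using (interchange)
  open import Relation.Binary.Reasoning.Setoid setoid

  opaque

    fold : ℕ → (ℕ → Carrier) → Carrier
    fold n f = sum {n} (f ∘ toℕ)

    fold≡sum : ∀ n f → fold n f ≡ sum {n} (f ∘ toℕ)
    fold≡sum n f = ≡.refl

    fold-zero : ∀ f → fold 0 f ≈ ε
    fold-zero f = refl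

    fold-suc : ∀ n f → fold (suc n) f ≈ f 0 ∙ fold n (f ∘ suc)
    fold-suc n f = refl

    fold-cong : ∀ n {f g} → (∀ k → k ℕ.< n → f k ≈ g k) → fold n f ≈ fold n g
    fold-cong zero    f≈g = refl
    fold-cong (suc n) f≈g = ∙-cong (f≈g 0 (s≤s z≤n)) (fold-cong n λ k k<n → f≈g (suc k) (s≤s k<n))

    fold-snoc : ∀ n f → fold (suc n) f ≈ fold n f ∙ f n
    fold-snoc zero    f = comm _ _
    fold-snoc (suc n) f = trans (∙-congˡ (fold-snoc n (f ∘ suc))) (sym (assoc _ _ _))

    fold-+ : ∀ m n f → fold (m ℕ.+ n) f ≈ fold m f ∙ fold n (λ k → f (m ℕ.+ k))
    fold-+ zero    n f = sym (identityˡ _)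
    fold-+ (suc m) n f = trans (∙-congˡ (fold-+ m n (f ∘ suc))) (sym (assoc _ _ _))

    fold-∙ : ∀ n f g → fold n (λ k → f k ∙ g k) ≈ fold n f ∙ fold n g
    fold-∙ zero    f g = sym (identityˡ _)
    fold-∙ (suc n) f g = trans (∙-congˡ (fold-∙ n (f ∘ suc) (g ∘ suc))) (interchange _ _ _ _)

    fold-reverse : ∀ n f → fold (suc n) f ≈ fold (suc n) (λ k → f (n ∸ k))
    fold-reverse zero    f = refl
    fold-reverse (suc n) f = begin
      fold (suc (suc n)) f                               ≈⟨ fold-snoc (suc n) f ⟩
      fold (suc n) f ∙ f (suc n)                         ≈⟨ comm _ _ ⟩
      f (suc n) ∙ fold (suc n) f                         ≈⟨ ∙-congˡ (fold-reverse n f) ⟩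
      f (suc n) ∙ fold (suc n) (λ k → f (n ∸ k))         ∎

module RingFolds (R : CommutativeRing 0ℓ 0ℓ) where

  open CommutativeRing R hiding (zero)
  open import Algebra.Properties.Ring ring using (-0#≈0#; -‿+-comm)
  open import Relation.Binary.Reasoning.Setoid setoid
  open Folds +-commutativeMonoid public using ()
    renaming (fold to Σ; fold≡sum to Σ≡sum; fold-zero to Σ-zero; fold-suc to Σ-suc; fold-cong to Σ-cong; fold-snoc to Σ-snoc; fold-+ to Σ-split;
              fold-∙ to Σ-+; fold-reverse to Σ-reverse)
  open Folds *-commutativeMonoid public using ()
    renaming (fold to Π; fold≡sum to Π≡product; fold-zero to Π-zero; fold-suc to Π-suc; fold-cong to Π-cong; fold-snoc to Π-snoc; fold-+ to Π-split;
              fold-∙ to Π-*; fold-reverse to Π-reverse)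

  Σ-*ˡ : ∀ n x f → Σ n (λ k → x * f k) ≈ x * Σ n f
  Σ-*ˡ zero    x f = trans (Σ-zero _) (sym (trans (*-congˡ (Σ-zero f)) (zeroʳ x)))
  Σ-*ˡ (suc n) x f = begin
    Σ (suc n) (λ k → x * f k)                ≈⟨ Σ-suc n _ ⟩
    x * f 0 + Σ n (λ k → x * f (suc k))      ≈⟨ +-congˡ (Σ-*ˡ n x (f ∘ suc)) ⟩
    x * f 0 + x * Σ n (f ∘ suc)              ≈⟨ distribˡ x _ _ ⟨
    x * (f 0 + Σ n (f ∘ suc))                ≈⟨ *-congˡ (Σ-suc n f) ⟨
    x * Σ (suc n) f                          ∎

  Σ-neg : ∀ n f → Σ n (λ k → - f k) ≈ - Σ n f
  Σ-neg zero    f = trans (Σ-zero _) (sym (trans (-‿cong (Σ-zero f)) -0#≈0#))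
  Σ-neg (suc n) f = begin
    Σ (suc n) (λ k → - f k)                  ≈⟨ Σ-suc n _ ⟩
    - f 0 + Σ n (λ k → - f (suc k))          ≈⟨ +-congˡ (Σ-neg n (f ∘ suc)) ⟩
    - f 0 - Σ n (f ∘ suc)                    ≈⟨ -‿+-comm _ _ ⟩
    - (f 0 + Σ n (f ∘ suc))                  ≈⟨ -‿cong (Σ-suc n f) ⟨
    - Σ (suc n) f                            ∎

  Σ-- : ∀ n f g → Σ n (λ k → f k - g k) ≈ Σ n f - Σ n g
  Σ-- n f g = trans (Σ-+ n f (λ k → - g k)) (+-congˡ (Σ-neg n g))

  Σ-telescope : ∀ n (g : ℕ → Carrier) → Σ n (λ k → g (suc k) - g k) ≈ g n - g 0
  Σ-telescope zero    g = trans (Σ-zero _) (sym (-‿inverseʳ _))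
  Σ-telescope (suc n) g = begin
    Σ (suc n) (λ k → g (suc k) - g k)                     ≈⟨ Σ-snoc n _ ⟩
    Σ n (λ k → g (suc k) - g k) + (g (suc n) - g n)       ≈⟨ +-congʳ (Σ-telescope n g) ⟩
    (g n - g 0) + (g (suc n) - g n)                       ≈⟨ +-comm _ _ ⟩
    (g (suc n) - g n) + (g n - g 0)                       ≈⟨ +-assoc _ _ _ ⟩
    g (suc n) + (- g n + (g n - g 0))                     ≈⟨ +-congˡ (+-assoc _ _ _) ⟨
    g (suc n) + ((- g n + g n) - g 0)                     ≈⟨ +-congˡ (+-congʳ (-‿inverseˡ _)) ⟩
    g (suc n) + (0# - g 0)                                ≈⟨ +-congˡ (+-identityˡ _) ⟩
    g (suc n) - g 0                                       ∎

  Π-vanish : ∀ n f k → k ℕ.< n → f k ≈ 0# → Π n f ≈ 0#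
  Π-vanish (suc n) f zero    _         fk≈0 = trans (Π-suc n f) (trans (*-congʳ fk≈0) (zeroˡ _))
  Π-vanish (suc n) f (suc k) (s≤s k<n) fk≈0 =
    trans (Π-suc n f) (trans (*-congˡ (Π-vanish n (f ∘ suc) k k<n fk≈0)) (zeroʳ _))

-- Fields with a total inverse, in which two is invertible.

record Field : Set₁ where
  field
    commutativeRing : CommutativeRing 0ℓ 0ℓ

  open CommutativeRing commutativeRing public hiding (zero)

  infix 9 _⁻¹

  field
    _⁻¹        : Carrier → Carrier
    *-inverseʳ : ∀ {x} → ¬ x ≈ 0# → x * x ⁻¹ ≈ 1#
    1≉0        : ¬ 1# ≈ 0#
    1+1≉0      : ¬ 1# + 1# ≈ 0#

module FieldProperties (K : Field) where

  open Field K
  open import Relation.Binary.Reasoning.Setoid setoid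

  *-cancelˡ : ∀ {x y z} → ¬ x ≈ 0# → x * y ≈ x * z → y ≈ z
  *-cancelˡ {x} {y} {z} x≉0 xy≈xz = begin
    y               ≈⟨ solved y ⟨
    x ⁻¹ * (x * y)  ≈⟨ *-congˡ xy≈xz ⟩
    x ⁻¹ * (x * z)  ≈⟨ solved z ⟩
    z               ∎
    where
    solved : ∀ u → x ⁻¹ * (x * u) ≈ u
    solved u = begin
      x ⁻¹ * (x * u)   ≈⟨ *-assoc _ _ _ ⟨
      x ⁻¹ * x * u     ≈⟨ *-congʳ (trans (*-comm _ _) (*-inverseʳ x≉0)) ⟩
      1# * u           ≈⟨ *-identityˡ u ⟩
      u                ∎

  *-≉0 : ∀ {x y} → ¬ x ≈ 0# → ¬ y ≈ 0# → ¬ x * y ≈ 0#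
  *-≉0 x≉0 y≉0 xy≈0 = y≉0 (*-cancelˡ x≉0 (trans xy≈0 (sym (zeroʳ _))))

  -≉0 : ∀ {x} → ¬ x ≈ 0# → ¬ - x ≈ 0#
  -≉0 {x} x≉0 -x≈0 = x≉0 (begin
    x         ≈⟨ +-identityʳ x ⟨
    x + 0#    ≈⟨ +-congˡ -x≈0 ⟨
    x + - x   ≈⟨ -‿inverseʳ x ⟩
    0#        ∎)

  ⁻¹-unique : ∀ {x y} → ¬ x ≈ 0# → x * y ≈ 1# → x ⁻¹ ≈ y
  ⁻¹-unique x≉0 xy≈1 = *-cancelˡ x≉0 (trans (*-inverseʳ x≉0) (sym xy≈1))

  ≉0-resp : ∀ {x y} → x ≈ y → ¬ x ≈ 0# → ¬ y ≈ 0#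
  ≉0-resp x≈y x≉0 y≈0 = x≉0 (trans x≈y y≈0)

-- The terminating very-well-poised series and its closed form.

module WellPoised (K : Field) where

  open Field K
  open FieldProperties K
  open RingSolver commutativeRing
  open RingFolds commutativeRing
  open import Algebra.Properties.Semiring.Exp semiring using (_^_; ^-homo-*)
  open import Relation.Binary.Reasoning.Setoid setoid

  module Terminating
    (a p e : Carrier)
    (A≉0 : ∀ j → ¬ 1# - a * p ^ j ≈ 0#)
    (B≉0 : ∀ j → ¬ 1# - p ^ suc j ≈ 0#)
    (C≉0 : ∀ j → ¬ 1# - a * e * p ^ suc j ≈ 0#)
    where

    B⁻ C⁻ : ℕ → Carrier
    B⁻ j = (1# - p ^ suc j) ⁻¹
    C⁻ j = (1# - a * e * p ^ suc j) ⁻¹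

    E⁻ : Carrier → ℕ → Carrier
    E⁻ Z j = (1# - a * Z * p ^ suc j) ⁻¹

    δ : Carrier → ℕ → Carrier
    δ Z j = (1# - a * p ^ j) * (1# - a * p ^ j) * (B⁻ j * B⁻ j)
          * ((e - p ^ j) * (Z - p ^ j) * (C⁻ j * E⁻ Z j))

    -- `T Z k` is 1 - a times the general term of the very-well-poised ₆φ₅ series in base p with
    -- parameters a; a, 1 / e, 1 / Z and argument e Z p. Writing e - pʲ and Z - pʲ in place of 1 -
    -- pʲ / e and 1 - pʲ / Z absorbs the powers eᵏ Zᵏ of the argument; the remaining pᵏ is explicit
    -- in `T`.
    D T : Carrier → ℕ → Carrier
    D Z k = Π k (δ Z)
    T Z k = (1# - a * p ^ k * p ^ k) * (p ^ k * D Z k)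

    NonSingular : Carrier → Set
    NonSingular Y = ∀ j → ¬ 1# - a * Y * p ^ suc j ≈ 0#

    nonSingular-p : ∀ {Y} → NonSingular Y → NonSingular (Y * p)
    nonSingular-p {Y} Y-ns j = ≉0-resp
      (solve 4 (λ a Y p P → :1 :- a :* Y :* (p :* (p :* P)) ⊜ :1 :- a :* (Y :* p) :* (p :* P)) refl a Y p (p ^ j))
      (Y-ns (suc j))

    -- Since p (Y - pʲ) = Y p - pʲ⁺¹, passing from Y to Y p shifts the product over Y - pʲ by one
    -- index, and likewise the product of the denominators that contain Y. Only the end factors
    -- survive; they are cross-multiplied to avoid division.
    D-shift : ∀ {Y} → NonSingular Y → ∀ k →
      D Y k * (p ^ k * ((Y * p - 1#) * (1# - a * (Y * p))))
        ≈ (Y * p - p ^ k) * (1# - a * (Y * p) * p ^ k) * D (Y * p) k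
    D-shift {Y} Y-ns zero = begin
      D Y 0 * (1# * ((Z - 1#) * (1# - a * Z)))
        ≈⟨ *-congʳ (trans (Π-zero (δ Y)) (sym (Π-zero (δ Z)))) ⟩
      D Z 0 * (1# * ((Z - 1#) * (1# - a * Z)))
        ≈⟨ solve 3 (λ a Z D → D :* (:1 :* ((Z :- :1) :* (:1 :- a :* Z)))
             ⊜ (Z :- :1) :* (:1 :- a :* Z :* :1) :* D) refl a Z (D Z 0) ⟩
      (Z - 1#) * (1# - a * Z * 1#) * D Z 0 ∎
      where Z = Y * p
    D-shift {Y} Y-ns (suc k) = begin
      D Y (suc k) * (p * P * ((Z - 1#) * (1# - a * Z)))
        ≈⟨ *-congʳ (Π-snoc k (δ Y)) ⟩
      D Y k * (σ * ((e - P) * (Y - P) * (C⁻ k * E⁻ Y k))) * (p * P * ((Z - 1#) * (1# - a * Z)))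
        ≈⟨ solve 11 (λ DY σ f Y P c ε p a z₁ z₂ →
             DY :* (σ :* (f :* (Y :- P) :* (c :* ε))) :* (p :* P :* (z₁ :* z₂))
             ⊜ DY :* (P :* (z₁ :* z₂)) :* (σ :* (f :* (Y :* p :- p :* P) :* (c :* ε))))
             refl (D Y k) σ (e - P) Y P (C⁻ k) (E⁻ Y k) p a (Z - 1#) (1# - a * Z) ⟩
      D Y k * (P * ((Z - 1#) * (1# - a * Z))) * (σ * ((e - P) * (Z - p * P) * (C⁻ k * E⁻ Y k)))
        ≈⟨ *-congʳ (D-shift Y-ns k) ⟩
      (Z - P) * (1# - a * Z * P) * D Z k * (σ * ((e - P) * (Z - p * P) * (C⁻ k * E⁻ Y k)))
        ≈⟨ solve 9 (λ g x DZ σ f h c ε ε′ →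
             g :* x :* DZ :* (σ :* (f :* h :* (c :* ε)))
             ⊜ (x :* ε) :* (g :* DZ :* (σ :* (f :* h :* c))))
             refl (Z - P) (1# - a * Z * P) (D Z k) σ (e - P) (Z - p * P) (C⁻ k) (E⁻ Y k) (E⁻ Z k) ⟩
      (1# - a * Z * P) * E⁻ Y k * ((Z - P) * D Z k * (σ * ((e - P) * (Z - p * P) * C⁻ k)))
        ≈⟨ *-congʳ (trans (*-congʳ E-shift) (*-inverseʳ (Y-ns k))) ⟩
      1# * ((Z - P) * D Z k * (σ * ((e - P) * (Z - p * P) * C⁻ k)))
        ≈⟨ *-congʳ (*-inverseʳ (nonSingular-p Y-ns k)) ⟨
      (1# - a * Z * (p * P)) * E⁻ Z k * ((Z - P) * D Z k * (σ * ((e - P) * (Z - p * P) * C⁻ k)))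
        ≈⟨ solve 8 (λ g x DZ σ f h c ε →
             (x :* ε) :* (g :* DZ :* (σ :* (f :* h :* c)))
             ⊜ h :* x :* (DZ :* (σ :* (f :* g :* (c :* ε)))))
             refl (Z - P) (1# - a * Z * (p * P)) (D Z k) σ (e - P) (Z - p * P) (C⁻ k) (E⁻ Z k) ⟩
      (Z - p * P) * (1# - a * Z * (p * P)) * (D Z k * (σ * ((e - P) * (Z - P) * (C⁻ k * E⁻ Z k))))
        ≈⟨ *-congˡ (Π-snoc k (δ Z)) ⟨
      (Z - p * P) * (1# - a * Z * (p * P)) * D Z (suc k) ∎
      where
      Z = Y * p
      P = p ^ k
      σ = (1# - a * P) * (1# - a * P) * (B⁻ k * B⁻ k)
      E-shift : 1# - a * Z * P ≈ 1# - a * Y * (p * P)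
      E-shift = solve 4 (λ a Y p P → :1 :- a :* (Y :* p) :* P ⊜ :1 :- a :* Y :* (p :* P)) refl a Y p P

    -- The certificate of the telescoping recurrence that takes T Y to T (Y p).
    G : Carrier → ℕ → Carrier
    G Z k = D Z k * ((1# - p ^ k) * (1# - p ^ k) * ((1# - a * e * p ^ k) * (1# - a * Z * p ^ k)))

    G-suc : ∀ {Z} → NonSingular Z → ∀ k →
      G Z (suc k) ≈ D Z k * ((1# - a * p ^ k) * (1# - a * p ^ k) * ((e - p ^ k) * (Z - p ^ k)))
    G-suc {Z} Z-ns k = begin
      D Z (suc k) * (b * b * (c * ε))
        ≈⟨ *-congʳ (Π-snoc k (δ Z)) ⟩
      D Z k * (α * α * (B⁻ k * B⁻ k) * (f * g * (C⁻ k * E⁻ Z k))) * (b * b * (c * ε))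
        ≈⟨ solve 10 (λ DZ α f g b b′ c c′ ε ε′ →
             DZ :* (α :* α :* (b′ :* b′) :* (f :* g :* (c′ :* ε′))) :* (b :* b :* (c :* ε))
             ⊜ (b :* b′) :* ((b :* b′) :* ((c :* c′) :* ((ε :* ε′) :* (DZ :* (α :* α :* (f :* g)))))))
             refl (D Z k) α f g b (B⁻ k) c (C⁻ k) ε (E⁻ Z k) ⟩
      b * B⁻ k * (b * B⁻ k * (c * C⁻ k * (ε * E⁻ Z k * X)))
        ≈⟨ *-cong (*-inverseʳ (B≉0 k)) (*-cong (*-inverseʳ (B≉0 k))
             (*-cong (*-inverseʳ (C≉0 k)) (*-congʳ (*-inverseʳ (Z-ns k))))) ⟩
      1# * (1# * (1# * (1# * X)))
        ≈⟨ solve 1 (λ x → :1 :* (:1 :* (:1 :* (:1 :* x))) ⊜ x) refl X ⟩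
      X ∎
      where
      α = 1# - a * p ^ k
      f = e - p ^ k
      g = Z - p ^ k
      b = 1# - p ^ suc k
      c = 1# - a * e * p ^ suc k
      ε = 1# - a * Z * p ^ suc k
      X = D Z k * (α * α * (f * g))

    -- Creative telescoping: `D-shift` makes every term a polynomial multiple of the same `D Z k`,
    -- and what is left is an identity of polynomials in a, e, Z and pᵏ. The prefactor Z - 1 is the
    -- one that `D-shift` needs.
    recurrence : ∀ {Y} → NonSingular Y → ∀ k → let Z = Y * p in
      (Z - 1#) * ((1# - Z) * (1# - a * e * Z) * T Z k - (1# - a * Z) * (1# - e * Z) * T Y k)
        ≈ Z * (G Z (suc k) - G Z k)
    recurrence {Y} Y-ns k = begin
      (Z - 1#) * ((1# - Z) * (1# - a * e * Z) * T Z k - (1# - a * Z) * (1# - e * Z) * T Y k)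
        ≈⟨ solve 6 (λ a e Z P DY DZ →
            (Z :- :1) :* ((:1 :- Z) :* (:1 :- a :* e :* Z) :* ((:1 :- a :* P :* P) :* (P :* DZ))
              :- (:1 :- a :* Z) :* (:1 :- e :* Z) :* ((:1 :- a :* P :* P) :* (P :* DY)))
            ⊜ (:1 :- a :* P :* P) :* ((Z :- :1) :* (:1 :- Z) :* (:1 :- a :* e :* Z) :* (P :* DZ)
              :- (:1 :- e :* Z) :* (DY :* (P :* ((Z :- :1) :* (:1 :- a :* Z))))))
            refl a e Z P (D Y k) (D Z k) ⟩
      (1# - a * P * P) * ((Z - 1#) * (1# - Z) * (1# - a * e * Z) * (P * D Z k)
        - (1# - e * Z) * (D Y k * (P * ((Z - 1#) * (1# - a * Z)))))
        ≈⟨ *-congˡ (+-congˡ (-‿cong (*-congˡ (D-shift Y-ns k)))) ⟩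
      (1# - a * P * P) * ((Z - 1#) * (1# - Z) * (1# - a * e * Z) * (P * D Z k)
        - (1# - e * Z) * ((Z - P) * (1# - a * Z * P) * D Z k))
        ≈⟨ solve 5 (λ a e Z P DZ →
            (:1 :- a :* P :* P) :* ((Z :- :1) :* (:1 :- Z) :* (:1 :- a :* e :* Z) :* (P :* DZ)
              :- (:1 :- e :* Z) :* ((Z :- P) :* (:1 :- a :* Z :* P) :* DZ))
            ⊜ Z :* (DZ :* ((:1 :- a :* P) :* (:1 :- a :* P) :* ((e :- P) :* (Z :- P)))
              :- DZ :* ((:1 :- P) :* (:1 :- P) :* ((:1 :- a :* e :* P) :* (:1 :- a :* Z :* P)))))
            refl a e Z P (D Z k) ⟩
      Z * (D Z k * ((1# - a * P) * (1# - a * P) * ((e - P) * (Z - P))) - G Z k)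
        ≈⟨ *-congˡ (+-congʳ (G-suc (nonSingular-p Y-ns) k)) ⟨
      Z * (G Z (suc k) - G Z k) ∎
      where
      Z = Y * p
      P = p ^ k

    D-vanish : ∀ {Z} m k → m ℕ.< k → Z ≈ p ^ m → D Z k ≈ 0#
    D-vanish {Z} m k m<k Z≈p^m = Π-vanish k (δ Z) m m<k (begin
      σ * ((e - p ^ m) * (Z - p ^ m) * (C⁻ m * E⁻ Z m))
        ≈⟨ *-congˡ (*-congʳ (*-congˡ (+-congʳ Z≈p^m))) ⟩
      σ * ((e - p ^ m) * (p ^ m - p ^ m) * (C⁻ m * E⁻ Z m))
        ≈⟨ solve 4 (λ σ f P x → σ :* (f :* (P :- P) :* x) ⊜ :0) refl σ (e - p ^ m) (p ^ m) (C⁻ m * E⁻ Z m) ⟩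
      0# ∎)
      where σ = (1# - a * p ^ m) * (1# - a * p ^ m) * (B⁻ m * B⁻ m)

    Σ-recurrence : ∀ {Y} m → NonSingular Y → Y ≈ p ^ m → let Z = Y * p in
      (1# - Z) * (1# - a * e * Z) * Σ (suc (suc m)) (T Z)
        ≈ (1# - a * Z) * (1# - e * Z) * Σ (suc m) (T Y)
    Σ-recurrence {Y} m Y-ns Y≈p^m = begin
      u * Σ (suc (suc m)) (T Z)      ≈⟨ solve 2 (λ x y → x ⊜ x :- y :+ y) refl _ _ ⟩
      u * Σ (suc (suc m)) (T Z) - v * Σ (suc (suc m)) (T Y) + v * Σ (suc (suc m)) (T Y)
        ≈⟨ +-cong difference≈0 (*-congˡ drop-last) ⟩
      0# + v * Σ (suc m) (T Y)       ≈⟨ +-identityˡ _ ⟩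
      v * Σ (suc m) (T Y)            ∎
      where
      Z = Y * p
      K′ = suc (suc m)
      u = (1# - Z) * (1# - a * e * Z)
      v = (1# - a * Z) * (1# - e * Z)
      Z≈p^ : Z ≈ p ^ suc m
      Z≈p^ = trans (*-comm Y p) (*-congˡ Y≈p^m)
      drop-last : Σ K′ (T Y) ≈ Σ (suc m) (T Y)
      drop-last = begin
        Σ K′ (T Y)                      ≈⟨ Σ-snoc (suc m) (T Y) ⟩
        Σ (suc m) (T Y) + T Y (suc m)
          ≈⟨ +-congˡ (*-congˡ (*-congˡ (D-vanish m (suc m) (ℕ.n<1+n m) Y≈p^m))) ⟩
        Σ (suc m) (T Y) + (1# - a * p ^ suc m * p ^ suc m) * (p ^ suc m * 0#)
          ≈⟨ solve 3 (λ s x y → s :+ x :* (y :* :0) ⊜ s) refl _ _ _ ⟩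
        Σ (suc m) (T Y)                 ∎
      Z-1≉0 : ¬ Z - 1# ≈ 0#
      Z-1≉0 = ≉0-resp (solve 1 (λ z → :- (:1 :- z) ⊜ z :- :1) refl Z)
        (-≉0 (≉0-resp (+-congˡ (-‿cong (sym Z≈p^))) (B≉0 m)))
      difference≈0 : u * Σ K′ (T Z) - v * Σ K′ (T Y) ≈ 0#
      difference≈0 = *-cancelˡ Z-1≉0 (begin
        (Z - 1#) * (u * Σ K′ (T Z) - v * Σ K′ (T Y))
          ≈⟨ *-congˡ (+-cong (Σ-*ˡ K′ u (T Z)) (-‿cong (Σ-*ˡ K′ v (T Y)))) ⟨
        (Z - 1#) * (Σ K′ (λ k → u * T Z k) - Σ K′ (λ k → v * T Y k))
          ≈⟨ *-congˡ (Σ-- K′ _ _) ⟨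
        (Z - 1#) * Σ K′ (λ k → u * T Z k - v * T Y k)
          ≈⟨ Σ-*ˡ K′ _ _ ⟨
        Σ K′ (λ k → (Z - 1#) * (u * T Z k - v * T Y k))
          ≈⟨ Σ-cong K′ (λ k _ → recurrence Y-ns k) ⟩
        Σ K′ (λ k → Z * (G Z (suc k) - G Z k))
          ≈⟨ Σ-*ˡ K′ Z _ ⟩
        Z * Σ K′ (λ k → G Z (suc k) - G Z k)
          ≈⟨ *-congˡ (Σ-telescope K′ (G Z)) ⟩
        Z * (G Z K′ - G Z 0)
          ≈⟨ *-congˡ (+-congʳ (*-congʳ (D-vanish (suc m) K′ (ℕ.n<1+n (suc m)) Z≈p^))) ⟩
        Z * (0# * _ - D Z 0 * ((1# - 1#) * (1# - 1#) * _))
          ≈⟨ solve 5 (λ z x d y w → z :* (:0 :* x :- d :* ((:1 :- :1) :* (:1 :- :1) :* y)) ⊜ w :* :0)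
               refl Z _ (D Z 0) _ (Z - 1#) ⟩
        (Z - 1#) * 0# ∎)

    ω : ℕ → Carrier
    ω j = (1# - a * p ^ suc j) * (1# - e * p ^ suc j) * (B⁻ j * C⁻ j)

    W : ℕ → Carrier
    W m = (1# - a) * Π m ω

    nonSingular-^ : ∀ m → NonSingular (p ^ m)
    nonSingular-^ zero    j = ≉0-resp (+-congˡ (-‿cong (*-congʳ (sym (*-identityʳ a))))) (A≉0 (suc j))
    nonSingular-^ (suc m) j = ≉0-resp
      (solve 4 (λ a Y p P → :1 :- a :* (Y :* p) :* P ⊜ :1 :- a :* (p :* Y) :* P) refl a (p ^ m) p (p ^ suc j))
      (nonSingular-p (nonSingular-^ m) j)

    D-cong : ∀ {Y Z} → NonSingular Y → Y ≈ Z → ∀ k → D Y k ≈ D Z k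
    D-cong {Y} {Z} Y-ns Y≈Z k = Π-cong k (λ j _ →
      *-congˡ (*-cong (*-congˡ (+-congʳ Y≈Z)) (*-congˡ (sym
        (⁻¹-unique (≉0-resp (1-cong j) (Y-ns j)) (trans (*-congʳ (sym (1-cong j))) (*-inverseʳ (Y-ns j))))))))
      where
      1-cong : ∀ j → 1# - a * Y * p ^ suc j ≈ 1# - a * Z * p ^ suc j
      1-cong j = +-congˡ (-‿cong (*-congʳ (*-congˡ Y≈Z)))

    -- Rogers' terminating ₆φ₅ summation, with one of its free parameters equal to a. It is the
    -- solution of the first-order recurrence in m, started from the single term 1 - a.
    Σ-T : ∀ m → Σ (suc m) (T (p ^ m)) ≈ W m
    Σ-T zero    = begin
      Σ 1 (T 1#)                     ≈⟨ Σ-snoc 0 (T 1#) ⟩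
      Σ 0 (T 1#) + T 1# 0            ≈⟨ +-cong (Σ-zero (T 1#)) (*-congˡ (*-congˡ (Π-zero (δ 1#)))) ⟩
      0# + (1# - a * 1# * 1#) * (1# * 1#)
                                     ≈⟨ solve 1 (λ a → :0 :+ (:1 :- a :* :1 :* :1) :* (:1 :* :1)
                                          ⊜ (:1 :- a) :* :1) refl a ⟩
      (1# - a) * 1#                  ≈⟨ *-congˡ (Π-zero ω) ⟨
      (1# - a) * Π 0 ω               ∎
    Σ-T (suc m) = begin
      S                              ≈⟨ solve 1 (λ s → s ⊜ :1 :* (:1 :* s)) refl S ⟩
      1# * (1# * S)                  ≈⟨ *-cong (*-inverseʳ (B≉0 m)) (*-congʳ (*-inverseʳ (C≉0 m))) ⟨
      b * B⁻ m * (c * C⁻ m * S)      ≈⟨ solve 5 (λ b b′ c c′ s → b :* b′ :* (c :* c′ :* s)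
                                          ⊜ (b′ :* c′) :* (b :* c :* s)) refl b (B⁻ m) c (C⁻ m) S ⟩
      B⁻ m * C⁻ m * (b * c * S)      ≈⟨ *-congˡ step ⟩
      B⁻ m * C⁻ m * (α * f * Σ (suc m) (T (p ^ m)))
                                     ≈⟨ *-congˡ (*-congˡ (Σ-T m)) ⟩
      B⁻ m * C⁻ m * (α * f * ((1# - a) * Π m ω))
                                     ≈⟨ solve 5 (λ x α f a w → x :* (α :* f :* (a :* w)) ⊜ a :* (w :* (α :* f :* x)))
                                          refl (B⁻ m * C⁻ m) α f (1# - a) (Π m ω) ⟩
      (1# - a) * (Π m ω * (α * f * (B⁻ m * C⁻ m)))
                                     ≈⟨ *-congˡ (Π-snoc m ω) ⟨
      W (suc m)                      ∎
      where
      S = Σ (suc (suc m)) (T (p ^ suc m))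
      b = 1# - p ^ suc m
      c = 1# - a * e * p ^ suc m
      α = 1# - a * p ^ suc m
      f = 1# - e * p ^ suc m
      comm : p ^ m * p ≈ p ^ suc m
      comm = *-comm _ _
      step : b * c * S ≈ α * f * Σ (suc m) (T (p ^ m))
      step = begin
        b * c * S
          ≈⟨ *-cong (*-cong (+-congˡ (-‿cong comm)) (+-congˡ (-‿cong (*-congˡ comm))))
               (Σ-cong (suc (suc m)) (λ k _ → *-congˡ (*-congˡ (D-cong (nonSingular-p (nonSingular-^ m)) comm k)))) ⟨
        (1# - p ^ m * p) * (1# - a * e * (p ^ m * p)) * Σ (suc (suc m)) (T (p ^ m * p))
          ≈⟨ Σ-recurrence m (nonSingular-^ m) refl ⟩
        (1# - a * (p ^ m * p)) * (1# - e * (p ^ m * p)) * Σ (suc m) (T (p ^ m))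
          ≈⟨ *-congʳ (*-cong (+-congˡ (-‿cong (*-congˡ comm))) (+-congˡ (-‿cong (*-congˡ comm)))) ⟩
        α * f * Σ (suc m) (T (p ^ m)) ∎

    -- The condition on e says that a p^N and a e are inverse to each other; they become y and 1 / y
    -- in the application.
    module Closed (s : Carrier) (s²≈a : s * s ≈ a)
                  (N : ℕ) (ea²p^N≈1 : e * (a * a * p ^ N) ≈ 1#) where

      Y : Carrier
      Y = p ^ N

      c : ℕ → Carrier
      c k = (1# - a * p ^ k * p ^ k) * ((1# - s * p ^ k) * (1# - s * p ^ k)) * D Y k

      -- With y = a Y one has (1 + y)² = 4 y + (1 - y)², and 4 y - 2 s Y (1 + a) = -2 s Y (1 - s)²
      -- because s² = a. This is where the constant -2 s (1 - s)² of the right-hand side comes from.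
      value : Carrier
      value = (1# + a * Y) * (1# + a * Y) - (1# + 1#) * s * Y * (1# + a)

      private
        1-a≉0 : ¬ 1# - a ≈ 0#
        1-a≉0 = ≉0-resp (+-congˡ (-‿cong (*-identityʳ a))) (A≉0 0)

        X+ : ∀ Y → Carrier → Carrier
        X+ Y P = Y * ((1# - a * P * P) * ((1# - s * P) * (1# - s * P)))

        -- Expresses the sum of the c k through those of T for p^(N-1) and p^N.
        X+-split : ∀ Y P → X+ Y P
          ≈ (1# - a * P * P) * ((Y - P) * (1# - a * Y * P) + (1# + a * Y * Y - (1# + 1#) * s * Y) * P)
        X+-split Y P = begin
          Y * ((1# - a * P * P) * ((1# - s * P) * (1# - s * P)))
            ≈⟨ solve 4 (λ Y a s P → Y :* ((:1 :- a :* P :* P) :* ((:1 :- s :* P) :* (:1 :- s :* P)))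
                 ⊜ (:1 :- a :* P :* P) :* (Y :* (:1 :- (:1 :+ :1) :* s :* P :+ s :* s :* (P :* P)))) refl Y a s P ⟩
          (1# - a * P * P) * (Y * (1# - (1# + 1#) * s * P + s * s * (P * P)))
            ≈⟨ *-congˡ (*-congˡ (+-congˡ (*-congʳ s²≈a))) ⟩
          (1# - a * P * P) * (Y * (1# - (1# + 1#) * s * P + a * (P * P)))
            ≈⟨ *-congˡ (solve 4 (λ Y a s P → Y :* (:1 :- (:1 :+ :1) :* s :* P :+ a :* (P :* P))
                 ⊜ (Y :- P) :* (:1 :- a :* Y :* P) :+ (:1 :+ a :* Y :* Y :- (:1 :+ :1) :* s :* Y) :* P)
                 refl Y a s P) ⟩
          (1# - a * P * P) * ((Y - P) * (1# - a * Y * P) + (1# + a * Y * Y - (1# + 1#) * s * Y) * P) ∎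

        Y*c : ∀ m → N ≡ suc m → ∀ k →
          Y * c k ≈ (Y - 1#) * (1# - a * Y) * T (p ^ m) k + (1# + a * Y * Y - (1# + 1#) * s * Y) * T Y k
        Y*c m ≡.refl k = begin
          Y * ((1# - a * P * P) * ((1# - s * P) * (1# - s * P)) * D Y k)   ≈⟨ *-assoc _ _ _ ⟨
          X+ Y P * D Y k                                                  ≈⟨ *-congʳ (X+-split Y P) ⟩
          x * ((Y - P) * (1# - a * Y * P) + v * P) * D Y k
            ≈⟨ solve 5 (λ x g v P D → x :* (g :+ v :* P) :* D ⊜ x :* (g :* D) :+ v :* (x :* (P :* D)))
                 refl x ((Y - P) * (1# - a * Y * P)) v P (D Y k) ⟩
          x * ((Y - P) * (1# - a * Y * P) * D Y k) + v * T Y k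
            ≈⟨ +-congʳ (*-congˡ (*-cong (*-cong (+-congʳ (sym Y′p≈Y)) (+-congˡ (-‿cong (*-congʳ (*-congˡ (sym Y′p≈Y))))))
                 (D-cong (nonSingular-^ N) (sym Y′p≈Y) k))) ⟩
          x * ((Y′ * p - P) * (1# - a * (Y′ * p) * P) * D (Y′ * p) k) + v * T Y k
            ≈⟨ +-congʳ (*-congˡ (D-shift (nonSingular-^ m) k)) ⟨
          x * (D Y′ k * (P * ((Y′ * p - 1#) * (1# - a * (Y′ * p))))) + v * T Y k
            ≈⟨ +-congʳ (*-congˡ (*-congˡ (*-congˡ (*-cong (+-congʳ Y′p≈Y) (+-congˡ (-‿cong (*-congˡ Y′p≈Y))))))) ⟩
          x * (D Y′ k * (P * ((Y - 1#) * (1# - a * Y)))) + v * T Y k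
            ≈⟨ +-congʳ (solve 4 (λ x D P g → x :* (D :* (P :* g)) ⊜ g :* (x :* (P :* D))) refl x (D Y′ k) P _) ⟩
          (Y - 1#) * (1# - a * Y) * T Y′ k + v * T Y k ∎
          where
          P = p ^ k
          Y′ = p ^ m
          x = 1# - a * P * P
          v = 1# + a * Y * Y - (1# + 1#) * s * Y
          Y′p≈Y : Y′ * p ≈ Y
          Y′p≈Y = *-comm _ _

        -- Multiplied by a², the last factor of `W` simplifies because e a² Y = 1: a² (1 - a e Y)
        -- becomes -a (1 - a), and a² (1 - e Y) becomes -(1 - a)(1 + a). After cancelling 1 - a, the
        -- factor 1 + a remains.
        contiguous : ∀ m → N ≡ suc m → (1# - Y) * a * W N ≈ (1# - a * Y) * (1# + a) * W m
        contiguous m ≡.refl = *-cancelˡ (-≉0 1-a≉0) (begin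
          - (1# - a) * ((1# - Y) * a * W N)
            ≈⟨ solve 3 (λ a Y W → (:- (:1 :- a)) :* ((:1 :- Y) :* a :* W)
                 ⊜ (:1 :- Y) :* (a :* a :- :1 :* a) :* W) refl a Y (W N) ⟩
          (1# - Y) * (a * a - 1# * a) * W N
            ≈⟨ *-congʳ (*-congˡ (+-congˡ (-‿cong (*-congʳ ea²p^N≈1)))) ⟨
          (1# - Y) * (a * a - e * (a * a * Y) * a) * W N
            ≈⟨ solve 4 (λ a e Y W → (:1 :- Y) :* (a :* a :- e :* (a :* a :* Y) :* a) :* W
                 ⊜ a :* a :* ((:1 :- Y) :* (:1 :- a :* e :* Y) :* W)) refl a e Y (W N) ⟩
          a * a * ((1# - Y) * (1# - a * e * Y) * W N)
            ≈⟨ *-congˡ (*-congˡ W-snoc) ⟩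
          a * a * ((1# - Y) * (1# - a * e * Y) * (W m * ((1# - a * Y) * (1# - e * Y) * (B⁻ m * C⁻ m))))
            ≈⟨ solve 9 (λ a b c w α f Y b′ c′ → a :* a :* (b :* c :* (w :* (α :* f :* (b′ :* c′))))
                 ⊜ (b :* b′) :* ((c :* c′) :* (a :* a :* (w :* (α :* f)))))
                 refl a (1# - Y) (1# - a * e * Y) (W m) (1# - a * Y) (1# - e * Y) Y (B⁻ m) (C⁻ m) ⟩
          (1# - Y) * B⁻ m * ((1# - a * e * Y) * C⁻ m * (a * a * (W m * ((1# - a * Y) * (1# - e * Y)))))
            ≈⟨ *-cong (*-inverseʳ (B≉0 m)) (*-congʳ (*-inverseʳ (C≉0 m))) ⟩
          1# * (1# * (a * a * (W m * ((1# - a * Y) * (1# - e * Y)))))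
            ≈⟨ solve 4 (λ a e Y W → :1 :* (:1 :* (a :* a :* (W :* ((:1 :- a :* Y) :* (:1 :- e :* Y)))))
                 ⊜ (a :* a :- e :* (a :* a :* Y)) :* (W :* (:1 :- a :* Y))) refl a e Y (W m) ⟩
          (a * a - e * (a * a * Y)) * (W m * (1# - a * Y))
            ≈⟨ *-congʳ (+-congˡ (-‿cong ea²p^N≈1)) ⟩
          (a * a - 1#) * (W m * (1# - a * Y))
            ≈⟨ solve 3 (λ a Y W → (a :* a :- :1) :* (W :* (:1 :- a :* Y))
                 ⊜ (:- (:1 :- a)) :* ((:1 :- a :* Y) :* (:1 :+ a) :* W)) refl a Y (W m) ⟩
          - (1# - a) * ((1# - a * Y) * (1# + a) * W m) ∎)
          where
          W-snoc : W N ≈ W m * ((1# - a * Y) * (1# - e * Y) * (B⁻ m * C⁻ m))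
          W-snoc = trans (*-congˡ (Π-snoc m ω)) (sym (*-assoc _ _ _))

      -- The split writes Y times the sum through `W` at N - 1 and at N; the factor 1 + a on the
      -- left lets `contiguous` remove the former.
      Σ-c : (1# + a) * (Y * Σ (suc N) c) ≈ W N * value
      Σ-c = by-cases N ≡.refl
        where
        by-cases : ∀ n → N ≡ n → (1# + a) * (Y * Σ (suc N) c) ≈ W N * value
        -- For N = 0 there is no contiguous series with p^(N-1), so the single summand is evaluated
        -- directly.
        by-cases zero ≡.refl = begin
          (1# + a) * (1# * Σ 1 c)
            ≈⟨ *-congˡ (*-congˡ (trans (Σ-snoc 0 c) (+-cong (Σ-zero c) (*-congˡ (Π-zero (δ 1#)))))) ⟩
          (1# + a) * (1# * (0# + (1# - a * 1# * 1#) * ((1# - s * 1#) * (1# - s * 1#)) * 1#))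
            ≈⟨ solve 2 (λ a s → (:1 :+ a) :* (:1 :* (:0 :+ (:1 :- a :* :1 :* :1) :* ((:1 :- s :* :1) :* (:1 :- s :* :1)) :* :1))
                 ⊜ (:1 :- a) :* (:1 :+ a) :* (:1 :- (:1 :+ :1) :* s :+ s :* s)) refl a s ⟩
          (1# - a) * (1# + a) * (1# - (1# + 1#) * s + s * s)
            ≈⟨ *-congˡ (+-congˡ s²≈a) ⟩
          (1# - a) * (1# + a) * (1# - (1# + 1#) * s + a)
            ≈⟨ solve 2 (λ a s → (:1 :- a) :* (:1 :+ a) :* (:1 :- (:1 :+ :1) :* s :+ a)
                 ⊜ (:1 :- a) :* :1 :* ((:1 :+ a :* :1) :* (:1 :+ a :* :1) :- (:1 :+ :1) :* s :* :1 :* (:1 :+ a))) refl a s ⟩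
          (1# - a) * 1# * value
            ≈⟨ *-congʳ (*-congˡ (Π-zero ω)) ⟨
          W 0 * value ∎
        by-cases (suc m) ≡.refl = begin
          (1# + a) * (Y * Σ (suc N) c)
            ≈⟨ *-congˡ (Σ-*ˡ (suc N) Y c) ⟨
          (1# + a) * Σ (suc N) (λ k → Y * c k)
            ≈⟨ *-congˡ (Σ-cong (suc N) (λ k _ → Y*c m ≡.refl k)) ⟩
          (1# + a) * Σ (suc N) (λ k → u * T (p ^ m) k + v * T Y k)
            ≈⟨ *-congˡ (trans (Σ-+ (suc N) _ _) (+-cong (Σ-*ˡ (suc N) u _) (Σ-*ˡ (suc N) v _))) ⟩
          (1# + a) * (u * Σ (suc N) (T (p ^ m)) + v * Σ (suc N) (T Y))
            ≈⟨ *-congˡ (+-cong (*-congˡ (trans drop-last (Σ-T m))) (*-congˡ (Σ-T N))) ⟩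
          (1# + a) * (u * W m + v * W N)
            ≈⟨ solve 5 (λ a Y w v w′ → (:1 :+ a) :* ((Y :- :1) :* (:1 :- a :* Y) :* w :+ v :* w′)
                 ⊜ (Y :- :1) :* ((:1 :- a :* Y) :* (:1 :+ a) :* w) :+ (:1 :+ a) :* v :* w′)
                 refl a Y (W m) v (W N) ⟩
          (Y - 1#) * ((1# - a * Y) * (1# + a) * W m) + (1# + a) * v * W N
            ≈⟨ +-congʳ (*-congˡ (contiguous m ≡.refl)) ⟨
          (Y - 1#) * ((1# - Y) * a * W N) + (1# + a) * v * W N
            ≈⟨ solve 4 (λ a Y s w → (Y :- :1) :* ((:1 :- Y) :* a :* w)
                 :+ (:1 :+ a) :* (:1 :+ a :* Y :* Y :- (:1 :+ :1) :* s :* Y) :* w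
                 ⊜ w :* ((:1 :+ a :* Y) :* (:1 :+ a :* Y) :- (:1 :+ :1) :* s :* Y :* (:1 :+ a)))
                 refl a Y s (W N) ⟩
          W N * value ∎
          where
          u = (Y - 1#) * (1# - a * Y)
          v = 1# + a * Y * Y - (1# + 1#) * s * Y
          drop-last : Σ (suc N) (T (p ^ m)) ≈ Σ N (T (p ^ m))
          drop-last = begin
            Σ (suc N) (T (p ^ m))           ≈⟨ Σ-snoc N (T (p ^ m)) ⟩
            Σ N (T (p ^ m)) + T (p ^ m) N
              ≈⟨ +-congˡ (*-congˡ (*-congˡ (D-vanish m N (ℕ.n<1+n m) refl))) ⟩
            Σ N (T (p ^ m)) + (1# - a * p ^ N * p ^ N) * (p ^ N * 0#)
              ≈⟨ solve 3 (λ s x y → s :+ x :* (y :* :0) ⊜ s) refl _ (1# - a * p ^ N * p ^ N) (p ^ N) ⟩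
            Σ N (T (p ^ m))                 ∎

      -- Reversing the order of the factors 1 - e pʲ and 1 - a e pʲ turns them
      -- into multiples of 1 - a² pʲ and 1 - a pʲ.
      W-reversed : W N * (a ^ N * Π N (λ j → 1# - p ^ suc j)) ≈ (1# - a * Y) * Π N (λ j → 1# - a * a * p ^ j)
      W-reversed = begin
        (1# - a) * Π N ω * (a ^ N * Π N b)
          ≈⟨ *-congʳ (*-congˡ (trans (Π-* N _ _) (*-cong (Π-* N _ _) (Π-* N B⁻ C⁻)))) ⟩
        (1# - a) * (Π N (λ j → α (suc j)) * Π N f * (Π N B⁻ * Π N C⁻)) * (a ^ N * Π N b)
          ≈⟨ solve 7 (λ a α f b′ c′ aN b → a :* (α :* f :* (b′ :* c′)) :* (aN :* b)
               ⊜ (b :* b′) :* (a :* α :* (aN :* (f :* c′))))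
               refl (1# - a) (Π N (λ j → α (suc j))) (Π N f) (Π N B⁻) (Π N C⁻) (a ^ N) (Π N b) ⟩
        Π N b * Π N B⁻ * ((1# - a) * Π N (λ j → α (suc j)) * (a ^ N * (Π N f * Π N C⁻)))
          ≈⟨ *-cong (trans (sym (Π-* N b B⁻)) (trans (Π-cong N (λ j _ → *-inverseʳ (B≉0 j))) (Π-1 N)))
               (*-cong α-shift (*-cong (sym (Π-const N)) (trans (sym (Π-* N f C⁻)) (Π-rev (λ j → f j * C⁻ j))))) ⟩
        1# * (Π N α * α N * (Π N (λ _ → a) * Π N (λ j → f (N ∸ suc j) * C⁻ (N ∸ suc j))))
          ≈⟨ solve 4 (λ α y a x → :1 :* (α :* y :* (a :* x)) ⊜ y :* (α :* (a :* x)))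
               refl (Π N α) (α N) (Π N (λ _ → a)) _ ⟩
        α N * (Π N α * (Π N (λ _ → a) * Π N (λ j → f (N ∸ suc j) * C⁻ (N ∸ suc j))))
          ≈⟨ *-congˡ (trans (Π-* N _ _) (*-congˡ (Π-* N _ _))) ⟨
        α N * Π N (λ j → α j * (a * (f (N ∸ suc j) * C⁻ (N ∸ suc j))))
          ≈⟨ *-congˡ (Π-cong N factor) ⟩
        α N * Π N (λ j → 1# - a * a * p ^ j) ∎
        where
        b f α : ℕ → Carrier
        b j = 1# - p ^ suc j
        f j = 1# - e * p ^ suc j
        α j = 1# - a * p ^ j
        Π-1 : ∀ n → Π n (λ _ → 1#) ≈ 1#
        Π-1 zero    = Π-zero _
        Π-1 (suc n) = trans (Π-suc n _) (trans (*-identityˡ _) (Π-1 n))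
        Π-const : ∀ n → Π n (λ _ → a) ≈ a ^ n
        Π-const zero    = Π-zero _
        Π-const (suc n) = trans (Π-suc n _) (*-congˡ (Π-const n))
        α-shift : (1# - a) * Π N (λ j → α (suc j)) ≈ Π N α * α N
        α-shift = begin
          (1# - a) * Π N (λ j → α (suc j))   ≈⟨ *-congʳ (+-congˡ (-‿cong (*-identityʳ a))) ⟨
          α 0 * Π N (λ j → α (suc j))        ≈⟨ Π-suc N α ⟨
          Π (suc N) α                        ≈⟨ Π-snoc N α ⟩
          Π N α * α N                        ∎
        Π-rev : ∀ g → Π N g ≈ Π N (λ j → g (N ∸ suc j))
        Π-rev g = by-cases N
          where
          by-cases : ∀ n → Π n g ≈ Π n (λ j → g (n ∸ suc j))
          by-cases zero    = trans (Π-zero _) (sym (Π-zero _))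
          by-cases (suc n) = Π-reverse n g
        -- The indices are paired so that Q P = p^N, hence e a² Q P = 1. Then a (1 - a P) = -a² P (1
        -- - a e Q), which cancels the denominator, and -a² P (1 - e Q) = 1 - a² P.
        factor : ∀ j → j ℕ.< N → α j * (a * (f (N ∸ suc j) * C⁻ (N ∸ suc j))) ≈ 1# - a * a * p ^ j
        factor j j<N = begin
          (1# - a * P) * (a * ((1# - e * Q) * C⁻ i))
            ≈⟨ solve 5 (λ a P e Q c → (:1 :- a :* P) :* (a :* ((:1 :- e :* Q) :* c))
                 ⊜ (:1 :- e :* Q) :* ((a :- a :* a :* P) :* c)) refl a P e Q (C⁻ i) ⟩
          (1# - e * Q) * ((a - a * a * P) * C⁻ i)
            ≈⟨ *-congˡ (*-congʳ (+-congʳ (trans (*-congˡ ea²QP≈1) (*-identityʳ a)))) ⟨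
          (1# - e * Q) * ((a * (e * (a * a * (Q * P))) - a * a * P) * C⁻ i)
            ≈⟨ solve 5 (λ a P e Q c → (:1 :- e :* Q) :* ((a :* (e :* (a :* a :* (Q :* P))) :- a :* a :* P) :* c)
                 ⊜ ((:1 :- a :* e :* Q) :* c) :* (e :* (a :* a :* (Q :* P)) :- a :* a :* P)) refl a P e Q (C⁻ i) ⟩
          (1# - a * e * Q) * C⁻ i * (e * (a * a * (Q * P)) - a * a * P)
            ≈⟨ *-cong (*-inverseʳ (C≉0 i)) (+-congʳ ea²QP≈1) ⟩
          1# * (1# - a * a * P)   ≈⟨ *-identityˡ _ ⟩
          1# - a * a * P          ∎
          where
          i = N ∸ suc j
          P = p ^ j
          Q = p ^ suc i
          QP≈Y : Q * P ≈ p ^ N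
          QP≈Y = trans (sym (^-homo-* p (suc i) j)) (reflexive (≡.cong (p ^_)
            (≡.trans (≡.sym (ℕ.+-suc i j)) (ℕ.m∸n+n≡m j<N))))
          ea²QP≈1 : e * (a * a * (Q * P)) ≈ 1#
          ea²QP≈1 = trans (*-congˡ (*-congˡ QP≈Y)) ea²p^N≈1

-- Integer powers of q, and arithmetic at one cyclotomic factor.

record Exponential (K : Field) : Set where
  open Field K
  field
    E      : ℤ → Carrier
    E-0    : E (+ 0) ≈ 1#
    E-+    : ∀ i j → E (i ℤ.+ j) ≈ E i * E j
    1-E≉0  : ∀ {i} → ¬ i ≡ + 0 → ¬ 1# - E i ≈ 0#

  W : ℤ → Carrier
  W i = E (+ 2 ℤ.* i)

  W-+ : ∀ i j → W (i ℤ.+ j) ≈ W i * W j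
  W-+ i j = trans (reflexive (≡.cong E (ℤ.*-distribˡ-+ (+ 2) i j))) (E-+ _ _)

  1-W≉0 : ∀ {i} → ¬ i ≡ + 0 → ¬ 1# - W i ≈ 0#
  1-W≉0 {i} i≢0 = 1-E≉0 (λ 2i≡0 → i≢0 (ℤ.*-cancelˡ-≡ (+ 2) i (+ 0) 2i≡0))

-- The elements of K that are integral at the m-th cyclotomic polynomial in
-- q², where E i plays the role of qⁱ.

record Place (K : Field) (X : Exponential K) (m : ℕ) : Set₁ where
  open Field K
  open Exponential X
  open Mult semiring using () renaming (_×_ to _×ᴷ_)
  field
    Int      : Carrier → Set
    Int-resp : ∀ {x y} → x ≈ y → Int x → Int y
    Int-+    : ∀ {x y} → Int x → Int y → Int (x + y)
    Int-*    : ∀ {x y} → Int x → Int y → Int (x * y)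
    Int-neg  : ∀ {x} → Int x → Int (- x)
    Int-1    : Int 1#
    Int-E    : ∀ i → Int (E i)
    Int-W⁻¹  : ∀ {i} → ¬ (+ m Signed.∣ i) → Int ((1# - W i) ⁻¹)
    -- Positive integers are invertible modulo the cyclotomic factor, because the coefficients are
    -- rational; hence so is everything congruent to one modulo 1 - wᵐ.
    Int-⁻¹   : ∀ k {x y} → Int y → x ≈ suc k ×ᴷ 1# + (1# - W (+ m)) * y → ¬ x ≈ 0# → Int (x ⁻¹)

module PlaceProperties (K : Field) (X : Exponential K) {m : ℕ} (L : Place K X m) where

  open Field K
  open FieldProperties K
  open Exponential X
  open Place L public
  open RingSolver commutativeRing
  open RingFolds commutativeRing
  open import Algebra.Properties.Semiring.Exp semiring using (_^_; ^-homo-*)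
  open Mult semiring using () renaming (_×_ to _×ᴷ_)
  open import Relation.Binary.Reasoning.Setoid setoid

  E-cong : ∀ {i j} → i ≡ j → E i ≈ E j
  E-cong ≡.refl = refl

  W-cong : ∀ {i j} → i ≡ j → W i ≈ W j
  W-cong ≡.refl = refl

  W-0 : W (+ 0) ≈ 1#
  W-0 = E-0

  E-inverse : ∀ i → E i * E (ℤ.- i) ≈ 1#
  E-inverse i = trans (sym (E-+ i (ℤ.- i))) (trans (E-cong (ℤ.+-inverseʳ i)) E-0)

  W-inverse : ∀ i → W i * W (ℤ.- i) ≈ 1#
  W-inverse i = trans (sym (W-+ i (ℤ.- i))) (trans (W-cong (ℤ.+-inverseʳ i)) W-0)

  E≉0 : ∀ i → ¬ E i ≈ 0#
  E≉0 i Ei≈0 = 1≉0 (trans (sym (E-inverse i)) (trans (*-congʳ Ei≈0) (zeroˡ _)))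

  Int-W : ∀ i → Int (W i)
  Int-W i = Int-E _

  Int-0 : Int 0#
  Int-0 = Int-resp (-‿inverseʳ 1#) (Int-+ Int-1 (Int-neg Int-1))

  Int-- : ∀ {x y} → Int x → Int y → Int (x - y)
  Int-- x y = Int-+ x (Int-neg y)

  Int-^ : ∀ k {x} → Int x → Int (x ^ k)
  Int-^ zero    x = Int-1
  Int-^ (suc k) x = Int-* x (Int-^ k x)

  Int-Π : ∀ n (f : ℕ → Carrier) → (∀ k → k ℕ.< n → Int (f k)) → Int (Π n f)
  Int-Π zero    f Int-f = Int-resp (sym (Π-zero f)) Int-1
  Int-Π (suc n) f Int-f = Int-resp (sym (Π-snoc n f))
    (Int-* (Int-Π n f (λ k k<n → Int-f k (ℕ.m<n⇒m<1+n k<n))) (Int-f n (ℕ.n<1+n n)))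

  record Unit (x : Carrier) : Set where
    constructor mkUnit
    field
      int     : Int x
      nonzero : ¬ x ≈ 0#
      int⁻¹   : Int (x ⁻¹)

  open Unit public

  Unit-* : ∀ {x y} → Unit x → Unit y → Unit (x * y)
  Unit-* {x} {y} (mkUnit x∈ x≉0 x⁻¹∈) (mkUnit y∈ y≉0 y⁻¹∈) = mkUnit (Int-* x∈ y∈) (*-≉0 x≉0 y≉0)
    (Int-resp (sym (⁻¹-unique (*-≉0 x≉0 y≉0) (begin
      x * y * (x ⁻¹ * y ⁻¹)      ≈⟨ solve 4 (λ x y a b → x :* y :* (a :* b) ⊜ (x :* a) :* (y :* b)) refl x y (x ⁻¹) (y ⁻¹) ⟩
      x * x ⁻¹ * (y * y ⁻¹)      ≈⟨ *-cong (*-inverseʳ x≉0) (*-inverseʳ y≉0) ⟩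
      1# * 1#                    ≈⟨ *-identityˡ 1# ⟩
      1#                         ∎))) (Int-* x⁻¹∈ y⁻¹∈))

  Unit-by : ∀ {x y} → Int x → Int y → x * y ≈ 1# → Unit x
  Unit-by {x} {y} x∈ y∈ xy≈1 = mkUnit x∈ x≉0 (Int-resp (sym (⁻¹-unique x≉0 xy≈1)) y∈)
    where
    x≉0 : ¬ x ≈ 0#
    x≉0 x≈0 = 1≉0 (trans (sym xy≈1) (trans (*-congʳ x≈0) (zeroˡ y)))

  Unit-resp : ∀ {x y} → x ≈ y → Unit x → Unit y
  Unit-resp x≈y (mkUnit x∈ x≉0 x⁻¹∈) = Unit-by (Int-resp x≈y x∈) x⁻¹∈ (trans (*-congʳ (sym x≈y)) (*-inverseʳ x≉0))

  Unit-1 : Unit 1#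
  Unit-1 = Unit-by Int-1 Int-1 (*-identityˡ 1#)

  Unit-E : ∀ i → Unit (E i)
  Unit-E i = Unit-by (Int-E i) (Int-E (ℤ.- i)) (E-inverse i)

  Unit-neg : ∀ {x} → Unit x → Unit (- x)
  Unit-neg {x} (mkUnit x∈ x≉0 x⁻¹∈) = Unit-by (Int-neg x∈) (Int-neg x⁻¹∈)
    (trans (solve 2 (λ x y → (:- x) :* (:- y) ⊜ x :* y) refl x (x ⁻¹)) (*-inverseʳ x≉0))

  Unit-W : ∀ {i} → ¬ (+ m Signed.∣ i) → Unit (1# - W i)
  Unit-W {i} m∤i = mkUnit (Int-- Int-1 (Int-W i)) (1-W≉0 λ { ≡.refl → m∤i (divides (+ 0) ≡.refl) }) (Int-W⁻¹ m∤i)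

  Unit-Π : ∀ n (f : ℕ → Carrier) → (∀ k → k ℕ.< n → Unit (f k)) → Unit (Π n f)
  Unit-Π zero    f Unit-f = Unit-resp (sym (Π-zero f)) Unit-1
  Unit-Π (suc n) f Unit-f = Unit-resp (sym (Π-snoc n f))
    (Unit-* (Unit-Π n f (λ k k<n → Unit-f k (ℕ.m<n⇒m<1+n k<n))) (Unit-f n (ℕ.n<1+n n)))

  Unit-∣ : ∀ {x y} → Int x → Int y → Unit (x * y) → Unit x
  Unit-∣ {x} {y} x∈ y∈ u = Unit-by x∈ (Int-* y∈ (int⁻¹ u)) (trans (sym (*-assoc _ _ _)) (*-inverseʳ (nonzero u)))

  z : Carrier
  z = 1# - W (+ m)

  Int-z : Int z
  Int-z = Int-- Int-1 (Int-W (+ m))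

  -- Order at least e. At the places built later z = 1 - wᵐ is Φ_m(w) times a unit, so it can serve
  -- as uniformiser and the cyclotomic polynomial itself need not appear in the axioms of a place.
  record I (e : ℕ) (x : Carrier) : Set where
    constructor mkI
    field
      quot     : Carrier
      int-quot : Int quot
      ≈-quot   : x ≈ z ^ e * quot

  I-resp : ∀ {e x y} → x ≈ y → I e x → I e y
  I-resp x≈y (mkI g g∈ x≈) = mkI g g∈ (trans (sym x≈y) x≈)

  I-+ : ∀ {e x y} → I e x → I e y → I e (x + y)
  I-+ (mkI g g∈ x≈) (mkI h h∈ y≈) = mkI (g + h) (Int-+ g∈ h∈) (trans (+-cong x≈ y≈) (sym (distribˡ _ g h)))

  I-*ʳ : ∀ {e x y} → I e x → Int y → I e (x * y)
  I-*ʳ (mkI g g∈ x≈) y∈ = mkI _ (Int-* g∈ y∈) (trans (*-congʳ x≈) (*-assoc _ _ _))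

  I-*ˡ : ∀ {e x y} → Int x → I e y → I e (x * y)
  I-*ˡ x∈ y∈I = I-resp (*-comm _ _) (I-*ʳ y∈I x∈)

  I-neg : ∀ {e x} → I e x → I e (- x)
  I-neg {e} (mkI g g∈ x≈) = mkI (- g) (Int-neg g∈)
    (trans (-‿cong x≈) (solve 2 (λ z g → :- (z :* g) ⊜ z :* (:- g)) refl (z ^ e) g))

  I-- : ∀ {e x y} → I e x → I e y → I e (x - y)
  I-- x y = I-+ x (I-neg y)

  I-* : ∀ {e f x y} → I e x → I f y → I (e ℕ.+ f) (x * y)
  I-* {e} {f} {x} {y} (mkI g g∈ x≈) (mkI h h∈ y≈) = mkI (g * h) (Int-* g∈ h∈) (begin
    x * y                       ≈⟨ *-cong x≈ y≈ ⟩
    z ^ e * g * (z ^ f * h)     ≈⟨ solve 4 (λ a g b h → a :* g :* (b :* h) ⊜ a :* b :* (g :* h)) refl (z ^ e) g (z ^ f) h ⟩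
    z ^ e * z ^ f * (g * h)     ≈⟨ *-congʳ (^-homo-* z e f) ⟨
    z ^ (e ℕ.+ f) * (g * h)     ∎)

  I⇒Int : ∀ {e x} → I e x → Int x
  I⇒Int {e} (mkI g g∈ x≈) = Int-resp (sym x≈) (Int-* (Int-^ e Int-z) g∈)

  Int⇒I : ∀ {x} → Int x → I 0 x
  Int⇒I x∈ = mkI _ x∈ (sym (*-identityˡ _))

  I-0 : ∀ {e} → I e 0#
  I-0 = mkI 0# Int-0 (sym (zeroʳ _))

  I-weaken : ∀ {e x} → I (suc e) x → I e x
  I-weaken {e} (mkI g g∈ x≈) = mkI (z * g) (Int-* Int-z g∈)
    (trans x≈ (solve 3 (λ z w g → z :* w :* g ⊜ w :* (z :* g)) refl z (z ^ e) g))

  I-z : ∀ {x} → Int x → I 1 (z * x)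
  I-z x∈ = mkI _ x∈ (*-congʳ (sym (*-identityʳ z)))

  I-cancel : ∀ {e x y} → Unit x → I e (x * y) → I e y
  I-cancel {x = x} {y} (mkUnit _ x≉0 x⁻¹∈) xy∈ = I-resp
    (trans (sym (*-assoc _ _ _)) (trans (*-congʳ (trans (*-comm _ _) (*-inverseʳ x≉0))) (*-identityˡ y)))
    (I-*ˡ x⁻¹∈ xy∈)

  I-Σ : ∀ {e} n (f : ℕ → Carrier) → (∀ k → k ℕ.< n → I e (f k)) → I e (Σ n f)
  I-Σ zero    f f∈ = I-resp (sym (Σ-zero f)) I-0
  I-Σ (suc n) f f∈ = I-resp (sym (Σ-snoc n f)) (I-+ (I-Σ n f (λ k k<n → f∈ k (ℕ.m<n⇒m<1+n k<n))) (f∈ n (ℕ.n<1+n n)))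

  ≈⇒I : ∀ {e x y} → x ≈ y → I e (x - y)
  ≈⇒I {x = x} {y} x≈y = I-resp (sym (trans (+-congʳ x≈y) (-‿inverseʳ y))) I-0

  private
    1-W-+ : ∀ i j → 1# - W (i ℤ.+ j) ≈ (1# - W i) + W i * (1# - W j)
    1-W-+ i j = trans (+-congˡ (-‿cong (W-+ i j)))
      (solve 2 (λ x y → :1 :- x :* y ⊜ (:1 :- x) :+ x :* (:1 :- y)) refl (W i) (W j))

  1-W-neg : ∀ i → 1# - W (ℤ.- i) ≈ - W (ℤ.- i) * (1# - W i)
  1-W-neg i = begin
    1# - W (ℤ.- i)                        ≈⟨ +-congʳ (W-inverse i) ⟨
    W i * W (ℤ.- i) - W (ℤ.- i)           ≈⟨ solve 2 (λ x y → x :* y :- y ⊜ (:- y) :* (:1 :- x)) refl (W i) (W (ℤ.- i)) ⟩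
    - W (ℤ.- i) * (1# - W i)              ∎

  geometric : ℕ → Carrier
  geometric zero    = 0#
  geometric (suc k) = 1# + W (+ m) * geometric k

  Int-geometric : ∀ k → Int (geometric k)
  Int-geometric zero    = Int-0
  Int-geometric (suc k) = Int-+ Int-1 (Int-* (Int-W (+ m)) (Int-geometric k))

  z*geometric : ∀ k → 1# - W (+ k ℤ.* + m) ≈ z * geometric k
  z*geometric zero    = trans (+-congˡ (-‿cong W-0)) (trans (-‿inverseʳ 1#) (sym (zeroʳ z)))
  z*geometric (suc k) = begin
    1# - W (+ suc k ℤ.* + m)                         ≈⟨ +-congˡ (-‿cong (W-cong (ℤ.suc-* (+ k) (+ m)))) ⟩
    1# - W (+ m ℤ.+ + k ℤ.* + m)                     ≈⟨ 1-W-+ (+ m) (+ k ℤ.* + m) ⟩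
    z + W (+ m) * (1# - W (+ k ℤ.* + m))             ≈⟨ +-congˡ (*-congˡ (z*geometric k)) ⟩
    z + W (+ m) * (z * geometric k)                  ≈⟨ solve 3 (λ z w g → z :+ w :* (z :* g) ⊜ z :* (:1 :+ w :* g)) refl z (W (+ m)) (geometric k) ⟩
    z * geometric (suc k)                            ∎

  geometric≡k : ∀ k → ∃ λ y → Int y × geometric k ≈ k ×ᴷ 1# + z * y
  geometric≡k zero    = 0# , Int-0 , sym (trans (+-identityˡ _) (zeroʳ z))
  geometric≡k (suc k) with geometric≡k k
  ... | y , y∈ , g≈ = y - geometric k , Int-- y∈ (Int-geometric k) , (begin
    1# + W (+ m) * g                   ≈⟨ solve 2 (λ w g → :1 :+ w :* g ⊜ :1 :+ (g :- (:1 :- w) :* g)) refl (W (+ m)) g ⟩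
    1# + (g - z * g)                   ≈⟨ +-congˡ (+-congʳ g≈) ⟩
    1# + (k ×ᴷ 1# + z * y - z * g)     ≈⟨ solve 4 (λ κ z y g → :1 :+ (κ :+ z :* y :- z :* g) ⊜ (:1 :+ κ) :+ z :* (y :- g)) refl (k ×ᴷ 1#) z y g ⟩
    (1# + k ×ᴷ 1#) + z * (y - g)       ∎)
    where g = geometric k

  I-W : ∀ {i} → + m Signed.∣ i → I 1 (1# - W i)
  I-W (divides (+ k) ≡.refl) = I-resp (sym (z*geometric k)) (I-z (Int-geometric k))
  I-W (divides -[1+ k ] ≡.refl) = I-resp
    (trans (sym (1-W-neg (+ suc k ℤ.* + m))) (+-congˡ (-‿cong (W-cong (ℤ.neg-distribˡ-* (+ suc k) (+ m))))))
    (I-*ˡ (Int-neg (Int-W (ℤ.- (+ suc k ℤ.* + m)))) (I-resp (sym (z*geometric (suc k))) (I-z (Int-geometric (suc k)))))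

  W-≡ : ∀ {i j} → + m Signed.∣ i ℤ.- j → I 1 (W i - W j)
  W-≡ {i} {j} m∣i-j = I-resp (begin
    - W j * (1# - W (i ℤ.- j))         ≈⟨ solve 2 (λ x y → (:- x) :* (:1 :- y) ⊜ x :* y :- x) refl (W j) (W (i ℤ.- j)) ⟩
    W j * W (i ℤ.- j) - W j            ≈⟨ +-congʳ (trans (sym (W-+ j (i ℤ.- j))) (W-cong (lemma i j))) ⟩
    W i - W j                          ∎) (I-*ˡ (Int-neg (Int-W j)) (I-W m∣i-j))
    where
    lemma : ∀ i j → j ℤ.+ (i ℤ.- j) ≡ i
    lemma = ℤ-Solver.solve-∀

  record Simple (x : Carrier) : Set where
    constructor mkSimple
    field
      ε      : Carrier
      ε-unit : Unit ε
      ≈zε    : x ≈ z * ε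

  -- For i = k m with k > 0 the cofactor of z is 1 + wᵐ + ⋯ + w^((k-1) m), which is congruent to k
  -- modulo z and therefore a unit. A negative i only adds the unit -wⁱ. Order exactly one is needed
  -- since these elements occur as denominators.
  Simple-W : ∀ {i} → + m Signed.∣ i → ¬ i ≡ + 0 → Simple (1# - W i)
  Simple-W (divides (+ zero) ≡.refl) i≢0 = contradiction ≡.refl i≢0
  Simple-W (divides (+ suc k) ≡.refl) i≢0 = mkSimple (geometric (suc k))
    (mkUnit (Int-geometric (suc k)) g≉0 (let y , y∈ , g≈ = geometric≡k (suc k) in Int-⁻¹ k y∈ g≈ g≉0))
    (z*geometric (suc k))
    where
    g≉0 : ¬ geometric (suc k) ≈ 0#
    g≉0 g≈0 = 1-W≉0 i≢0 (trans (z*geometric (suc k)) (trans (*-congˡ g≈0) (zeroʳ z)))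
  Simple-W (divides -[1+ k ] ≡.refl) i≢0 with Simple-W (divides (+ suc k) ≡.refl) i′≢0
    where
    i′≢0 : ¬ + suc k ℤ.* + m ≡ + 0
    i′≢0 i′≡0 = i≢0 (≡.trans (≡.sym (ℤ.neg-distribˡ-* (+ suc k) (+ m))) (≡.cong ℤ.-_ i′≡0))
  ... | mkSimple ε ε-unit ≈zε = mkSimple (- W (ℤ.- i′) * ε) (Unit-* (Unit-neg (Unit-E _)) ε-unit) (begin
      1# - W (-[1+ k ] ℤ.* + m)        ≈⟨ +-congˡ (-‿cong (W-cong (ℤ.neg-distribˡ-* (+ suc k) (+ m)))) ⟨
      1# - W (ℤ.- i′)                  ≈⟨ 1-W-neg i′ ⟩
      - W (ℤ.- i′) * (1# - W i′)       ≈⟨ *-congˡ ≈zε ⟩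
      - W (ℤ.- i′) * (z * ε)           ≈⟨ solve 3 (λ w z ε → w :* (z :* ε) ⊜ z :* (w :* ε)) refl (- W (ℤ.- i′)) z ε ⟩
      z * (- W (ℤ.- i′) * ε)           ∎)
    where i′ = + suc k ℤ.* + m

  Unit-2+z : ∀ {x y} → Int y → x ≈ 1# + 1# + z * y → ¬ x ≈ 0# → Unit x
  Unit-2+z y∈ x≈ x≉0 = mkUnit (Int-resp (sym x≈) (Int-+ (Int-+ Int-1 Int-1) (Int-* Int-z y∈))) x≉0
    (Int-⁻¹ 1 y∈ (trans x≈ (+-congʳ (+-congˡ (sym (+-identityʳ 1#))))) x≉0)

  Unit-2 : Unit (1# + 1#)
  Unit-2 = Unit-2+z Int-0 (sym (trans (+-congˡ (zeroʳ z)) (+-identityʳ _))) 1+1≉0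

  I-Π : ∀ n (f : ℕ → Carrier) k → k ℕ.< n → (∀ j → Int (f j)) → I 1 (f k) → I 1 (Π n f)
  I-Π (suc n) f zero    _           f∈ f₀∈I = I-resp (sym (Π-suc n f)) (I-*ʳ f₀∈I (Int-Π n _ (λ j _ → f∈ (suc j))))
  I-Π (suc n) f (suc k) (ℕ.s≤s k<n) f∈ fₖ∈I = I-resp (sym (Π-suc n f))
    (I-*ˡ (f∈ 0) (I-Π n _ k k<n (λ j → f∈ (suc j)) fₖ∈I))

  -- The offset moves in the induction because the blocks to which this is applied start at V and
  -- not at a multiple of m.
  I-Π-blocks : ∀ u (f : ℕ → Carrier) o → (∀ o → I 1 (Π m (λ v → f (o ℕ.+ v)))) → I u (Π (u ℕ.* m) (λ v → f (o ℕ.+ v)))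
  I-Π-blocks zero    f o _     = I-resp (sym (Π-zero _)) (Int⇒I Int-1)
  I-Π-blocks (suc u) f o block = I-resp (sym (Π-split m (u ℕ.* m) _)) (I-* (block o)
    (I-resp (Π-cong (u ℕ.* m) λ v _ → reflexive (≡.cong f (ℕ.+-assoc o m v))) (I-Π-blocks u f (o ℕ.+ m) block)))

  I-Σ-blocks : ∀ u (f : ℕ → Carrier) → (∀ u → I 1 (Σ m (λ v → f (u ℕ.* m ℕ.+ v)))) → I 1 (Σ (u ℕ.* m) f)
  I-Σ-blocks zero    f _     = I-resp (sym (Σ-zero _)) I-0
  I-Σ-blocks (suc u) f block = I-resp (trans (sym (Σ-split (u ℕ.* m) m f)) (reflexive (≡.cong (λ k → Σ k f) (ℕ.+-comm (u ℕ.* m) m))))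
    (I-+ (I-Σ-blocks u f block) (block u))

  -- Adding the reversed sum gives twice the sum, and two is a unit; a middle term need not be
  -- singled out.
  I-Σ-antisymmetric : ∀ {e} n (f : ℕ → Carrier) → (∀ i j → i ℕ.+ j ≡ n → I e (f i + f j)) → I e (Σ (suc n) f)
  I-Σ-antisymmetric n f f+f∈I = I-cancel Unit-2 (I-resp (begin
    Σ (suc n) (λ i → f i + f (n ℕ.∸ i))            ≈⟨ Σ-+ (suc n) f _ ⟩
    Σ (suc n) f + Σ (suc n) (λ i → f (n ℕ.∸ i))    ≈⟨ +-congˡ (Σ-reverse n f) ⟨
    Σ (suc n) f + Σ (suc n) f                      ≈⟨ solve 1 (λ x → x :+ x ⊜ (:1 :+ :1) :* x) refl (Σ (suc n) f) ⟩
    (1# + 1#) * Σ (suc n) f                        ∎)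
    (I-Σ (suc n) _ λ { i (ℕ.s≤s i≤n) → f+f∈I i (n ℕ.∸ i) (ℕ.m+[n∸m]≡n i≤n) }))

  -- Moving one unit at a time from the first argument to the second shows that `Q i j` and `Q j i`
  -- are both congruent to `Q 0 n`.
  I-slide : ∀ {e} n (Q : ℕ → ℕ → Carrier) → (∀ i j → suc (i ℕ.+ j) ≡ n → I e (Q (suc i) j - Q i (suc j))) →
            ∀ i j → i ℕ.+ j ≡ n → I e (Q i j - Q j i)
  I-slide {e} n Q step i j i+j≡n = I-resp (solve 3 (λ x y w → (x :- w) :- (y :- w) ⊜ x :- y) refl (Q i j) (Q j i) (Q 0 n))
    (I-- (to-end i j i+j≡n) (to-end j i (≡.trans (ℕ.+-comm j i) i+j≡n)))
    where
    to-end : ∀ i j → i ℕ.+ j ≡ n → I e (Q i j - Q 0 n)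
    to-end zero    j ≡.refl = ≈⇒I refl
    to-end (suc i) j i+j≡n = I-resp (solve 3 (λ x y w → (x :- y) :+ (y :- w) ⊜ x :- w) refl (Q (suc i) j) (Q i (suc j)) (Q 0 n))
      (I-+ (step i j i+j≡n) (to-end i (suc j) (≡.trans (ℕ.+-suc i j) i+j≡n)))

  record Power (e : ℕ) (x : Carrier) : Set where
    constructor mkPower
    field
      ε      : Carrier
      ε-unit : Unit ε
      ≈zᵉε   : x ≈ z ^ e * ε

  Power-* : ∀ {e f x y} → Power e x → Power f y → Power (e ℕ.+ f) (x * y)
  Power-* {e} {f} {x} {y} (mkPower g g∈ x≈) (mkPower h h∈ y≈) = mkPower (g * h) (Unit-* g∈ h∈) (begin
    x * y                       ≈⟨ *-cong x≈ y≈ ⟩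
    z ^ e * g * (z ^ f * h)     ≈⟨ solve 4 (λ a g b h → a :* g :* (b :* h) ⊜ a :* b :* (g :* h)) refl (z ^ e) g (z ^ f) h ⟩
    z ^ e * z ^ f * (g * h)     ≈⟨ *-congʳ (^-homo-* z e f) ⟨
    z ^ (e ℕ.+ f) * (g * h)     ∎)

  Power-resp : ∀ {e x y} → x ≈ y → Power e x → Power e y
  Power-resp x≈y (mkPower g g∈ x≈) = mkPower g g∈ (trans (sym x≈y) x≈)

  Unit⇒Power : ∀ {x} → Unit x → Power 0 x
  Unit⇒Power x∈ = mkPower _ x∈ (sym (*-identityˡ _))

  Simple⇒Power : ∀ {x} → Simple x → Power 1 x
  Simple⇒Power (mkSimple ε ε∈ x≈) = mkPower ε ε∈ (trans x≈ (*-congʳ (sym (*-identityʳ z))))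

  Power-Π-blocks : ∀ u (f : ℕ → Carrier) → (∀ u → Power 1 (Π m (λ v → f (u ℕ.* m ℕ.+ v)))) → Power u (Π (u ℕ.* m) f)
  Power-Π-blocks zero    f _     = Power-resp (sym (Π-zero _)) (Unit⇒Power Unit-1)
  Power-Π-blocks (suc u) f block = Power-resp
    (trans (*-comm _ _) (trans (sym (Π-split (u ℕ.* m) m f)) (reflexive (≡.cong (λ k → Π k f) (ℕ.+-comm (u ℕ.* m) m)))))
    (Power-* (block u) (Power-Π-blocks u f block))

  -- The lower bound on the order of the numerator meets the exact order of the denominator, so the
  -- powers of z cancel and only a unit is divided by.
  I/Power : ∀ {e x y} → I e x → Power e y → ¬ y ≈ 0# → Int (x * y ⁻¹)
  I/Power {e} {x} {y} (mkI g g∈ x≈) (mkPower ε ε-unit y≈) y≉0 = Int-resp (*-cancelˡ y≉0 (begin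
    y * (g * ε ⁻¹)                ≈⟨ *-congʳ y≈ ⟩
    z ^ e * ε * (g * ε ⁻¹)        ≈⟨ solve 4 (λ z ε g ε′ → z :* ε :* (g :* ε′) ⊜ (ε :* ε′) :* (z :* g)) refl (z ^ e) ε g (ε ⁻¹) ⟩
    ε * ε ⁻¹ * (z ^ e * g)        ≈⟨ *-cong (*-inverseʳ (nonzero ε-unit)) (sym x≈) ⟩
    1# * x                        ≈⟨ *-congʳ (*-inverseʳ y≉0) ⟨
    y * y ⁻¹ * x                  ≈⟨ solve 3 (λ y y′ x → y :* y′ :* x ⊜ y :* (x :* y′)) refl y (y ⁻¹) x ⟩
    y * (x * y ⁻¹)                ∎)) (Int-* g∈ (int⁻¹ ε-unit))

-- The two sides of the congruence, freed of their constant factor.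

module Series (K : Field) (X : Exponential K) (d : ℕ) (t : ℤ) where

  open Field K
  open Exponential X
  open RingFolds commutativeRing
  open import Algebra.Properties.Semiring.Exp semiring using (_^_)

  s a p : Carrier
  s = E t
  a = W t
  p = W (+ d)

  A B C : ℕ → Carrier
  A j = 1# - a * p ^ j
  B j = 1# - p ^ suc j
  C j = 1# - a * a * p ^ j

  r : ℕ → Carrier
  r k = Π k (λ j → A j * B j ⁻¹)

  L : ℕ → Carrier
  L k = r k * r k * (r k * r k) * W (ℤ.- (+ 2 ℤ.* t ℤ.* + k))

  c : ℕ → Carrier
  c k = (1# - a * p ^ k * p ^ k) * ((1# - s * p ^ k) * (1# - s * p ^ k)) * L k

  ρ : ℕ → Carrier
  ρ N = Π N C * ((1# + a) * Π N B) ⁻¹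

  -- Both `c` and `R` omit (1 - q²)⁻¹ (1 - q)⁻², the denominators of the q-integers; the factor is
  -- restored when the stated terms are compared with these.
  R : ℕ → ℕ → Carrier
  R n N = - (1# + 1#) * s * ((1# - s) * (1# - s)) * ((1# - W (+ n)) * W (ℤ.- (t ℤ.* + N)) * ρ N)

module Progression
  (K : Field) (X : Exponential K) (n d N : ℕ) .{{_ : ℕ.NonZero d}} (t : ℤ)
  (n≡t+dN : + n ≡ t ℤ.+ + d ℤ.* + N)
  (t+dj≢0 : ∀ j → ¬ t ℤ.+ + d ℤ.* + j ≡ + 0)
  where

  open Field K
  open FieldProperties K
  open Exponential X
  open Series K X d t public
  open RingSolver commutativeRing
  open RingFolds commutativeRing
  open import Algebra.Properties.Semiring.Exp semiring using (_^_; ^-homo-*)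
  open import Relation.Binary.Reasoning.Setoid setoid

  τ : ℕ → ℤ
  τ j = t ℤ.+ + d ℤ.* + j

  d[1+j]≢0 : ∀ j → ¬ + d ℤ.* + suc j ≡ + 0
  d[1+j]≢0 j eq with ℤ.i*j≡0⇒i≡0∨j≡0 (+ d) eq
  ... | inj₁ +d≡0 = ℕ.≢-nonZero⁻¹ d (ℤ.+-injective +d≡0)

  t≢0 : ¬ t ≡ + 0
  t≢0 ≡.refl = t+dj≢0 0 (≡.cong (λ x → + 0 ℤ.+ x) (ℤ.*-zeroʳ (+ d)))

  s²≈a : s * s ≈ a
  s²≈a = trans (sym (E-+ t t)) (reflexive (≡.cong E (lemma t)))
    where
    lemma : ∀ t → t ℤ.+ t ≡ + 2 ℤ.* t
    lemma = ℤ-Solver.solve-∀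

  p^ : ∀ j → p ^ j ≈ W (+ d ℤ.* + j)
  p^ zero    = sym (trans (reflexive (≡.cong W (ℤ.*-zeroʳ (+ d)))) E-0)
  p^ (suc j) = begin
    p * p ^ j                       ≈⟨ *-congˡ (p^ j) ⟩
    W (+ d) * W (+ d ℤ.* + j)       ≈⟨ W-+ _ _ ⟨
    W (+ d ℤ.+ + d ℤ.* + j)         ≡⟨ ≡.cong W (ℤ.*-suc (+ d) (+ j)) ⟨
    W (+ d ℤ.* + suc j)             ∎

  A≈ : ∀ j → A j ≈ 1# - W (τ j)
  A≈ j = +-congˡ (-‿cong (trans (*-congˡ (p^ j)) (sym (W-+ t _))))

  B≈ : ∀ j → B j ≈ 1# - W (+ d ℤ.* + suc j)
  B≈ j = +-congˡ (-‿cong (p^ (suc j)))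

  A≉0 : ∀ j → ¬ A j ≈ 0#
  A≉0 j = ≉0-resp (sym (A≈ j)) (1-W≉0 (t+dj≢0 j))

  B≉0 : ∀ j → ¬ B j ≈ 0#
  B≉0 j = ≉0-resp (sym (B≈ j)) (1-W≉0 (d[1+j]≢0 j))

  ΠB≉0 : ∀ k → ¬ Π k B ≈ 0#
  ΠB≉0 zero    = ≉0-resp (sym (Π-zero B)) 1≉0
  ΠB≉0 (suc k) = ≉0-resp (sym (Π-snoc k B)) (*-≉0 (ΠB≉0 k) (B≉0 k))

  1-a² : 1# - a * a ≈ (1# - a) * (1# + a)
  1-a² = solve 1 (λ a → :1 :- a :* a ⊜ (:1 :- a) :* (:1 :+ a)) refl a

  1+a≉0 : ¬ 1# + a ≈ 0#
  1+a≉0 1+a≈0 = 1-W≉0 t+t≢0 (begin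
    1# - W (t ℤ.+ t)         ≈⟨ +-congˡ (-‿cong (W-+ t t)) ⟩
    1# - a * a               ≈⟨ 1-a² ⟩
    (1# - a) * (1# + a)      ≈⟨ *-congˡ 1+a≈0 ⟩
    (1# - a) * 0#            ≈⟨ zeroʳ _ ⟩
    0#                       ∎)
    where
    t+t≢0 : ¬ t ℤ.+ t ≡ + 0
    t+t≢0 eq = t≢0 (ℤ.*-cancelˡ-≡ (+ 2) t (+ 0) (≡.trans (lemma t) eq))
      where
      lemma : ∀ t → + 2 ℤ.* t ≡ t ℤ.+ t
      lemma = ℤ-Solver.solve-∀

  r-suc : ∀ k → r (suc k) ≈ r k * (A k * B k ⁻¹)
  r-suc k = Π-snoc k _

  -- Divisibility of both sides by Φ_m(w) for a divisor m of n.

  module AtPlace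
    {m : ℕ} .{{_ : ℕ.NonZero m}} (𝓛 : Place K X m) (m∣n : m ℕ.∣ n)
    (cancel-d : ∀ i → + m Signed.∣ + d ℤ.* i → + m Signed.∣ i)
    where

    open PlaceProperties K X 𝓛

    V U : ℕ
    V = N ℕ.% m
    U = N ℕ./ m

    V<m : V ℕ.< m
    V<m = ℕ.m%n<n N m

    N≡V+Um : N ≡ V ℕ.+ U ℕ.* m
    N≡V+Um = ℕ.m≡m%n+[m/n]*n N m

    m∣+n : + m Signed.∣ + n
    m∣+n = Signed.∣ᵤ⇒∣ m∣n

    pos-index : ∀ u v → + (u ℕ.* m ℕ.+ v) ≡ + u ℤ.* + m ℤ.+ + v
    pos-index u v = ≡.cong (λ x → x ℤ.+ + v) (ℤ.pos-* u m)

    +N≡ : + N ≡ + V ℤ.+ + U ℤ.* + m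
    +N≡ = ≡.trans (≡.cong +_ N≡V+Um) (≡.cong (λ x → + V ℤ.+ x) (ℤ.pos-* U m))

    -- Indices are measured from N, where τ N = n is a multiple of m. With d cancellable modulo m,
    -- this places the zeros of `A` exactly at the residue V.
    τ≡ : ∀ u v → τ (u ℕ.* m ℕ.+ v) ≡ + n ℤ.+ (+ d ℤ.* ((+ u ℤ.- + U) ℤ.* + m) ℤ.+ + d ℤ.* (+ v ℤ.- + V))
    τ≡ u v = ≡.trans (≡.cong (λ x → t ℤ.+ + d ℤ.* x) (pos-index u v))
      (≡.trans (lemma t (+ d) (+ u) (+ v) (+ U) (+ V) (+ m))
        (≡.cong (λ x → x ℤ.+ (+ d ℤ.* ((+ u ℤ.- + U) ℤ.* + m) ℤ.+ + d ℤ.* (+ v ℤ.- + V))) (≡.sym (≡.trans n≡t+dN (≡.cong (λ x → t ℤ.+ + d ℤ.* x) +N≡)))))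
      where
      lemma : ∀ t d u v U V m → t ℤ.+ d ℤ.* (u ℤ.* m ℤ.+ v)
        ≡ t ℤ.+ d ℤ.* (V ℤ.+ U ℤ.* m) ℤ.+ (d ℤ.* ((u ℤ.- U) ℤ.* m) ℤ.+ d ℤ.* (v ℤ.- V))
      lemma = ℤ-Solver.solve-∀

    m∣[u-U]m : ∀ u → + m Signed.∣ + d ℤ.* ((+ u ℤ.- + U) ℤ.* + m)
    m∣[u-U]m u = Signed.∣n⇒∣m*n (+ d) (divides (+ u ℤ.- + U) ≡.refl)

    m∣τ : ∀ u → + m Signed.∣ τ (u ℕ.* m ℕ.+ V)
    m∣τ u = ≡.subst (λ x → + m Signed.∣ x) (≡.sym (τ≡ u V)) (Signed.∣m∣n⇒∣m+n m∣+n
      (Signed.∣m∣n⇒∣m+n (m∣[u-U]m u) (Signed.∣n⇒∣m*n (+ d) (divides (+ 0) (ℤ.+-inverseʳ (+ V))))))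

    small-≡ : ∀ {v w} → v ℕ.< m → w ℕ.< m → + m Signed.∣ + v ℤ.- + w → v ≡ w
    small-≡ {v} {w} v<m w<m m∣v-w = ℤ.+-injective (ℤ.i-j≡0⇒i≡j (+ v) (+ w) (ℤ.∣i∣≡0⇒i≡0
      (is-zero _ bound (Signed.∣⇒∣ᵤ m∣v-w))))
      where
      bound : ℤ.∣ + v ℤ.- + w ∣ ℕ.< m
      bound = ≡.subst (λ x → ℤ.∣ x ∣ ℕ.< m) (≡.sym (ℤ.[+m]-[+n]≡m⊖n v w))
        (ℕ.≤-<-trans (ℤ.∣m⊝n∣≤m⊔n v w) (ℕ.⊔-lub v<m w<m))
      is-zero : ∀ x → x ℕ.< m → m ℕ.∣ x → x ≡ 0
      is-zero zero    _   _   = ≡.refl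
      is-zero (suc x) x<m m∣x = contradiction (ℕ.∣⇒≤ m∣x) (ℕ.<⇒≱ x<m)

    m∤τ : ∀ u {v} → v ℕ.< m → ¬ v ≡ V → ¬ + m Signed.∣ τ (u ℕ.* m ℕ.+ v)
    m∤τ u {v} v<m v≢V m∣τ = v≢V (small-≡ v<m V<m (cancel-d _
      (Signed.∣m+n∣m⇒∣n (Signed.∣m+n∣m⇒∣n (≡.subst (λ x → + m Signed.∣ x) (τ≡ u v) m∣τ) m∣+n) (m∣[u-U]m u))))

    B-index : ∀ u v → + suc (u ℕ.* m ℕ.+ v) ≡ + u ℤ.* + m ℤ.+ + suc v
    B-index u v = ≡.trans (≡.cong +_ (≡.sym (ℕ.+-suc (u ℕ.* m) v))) (pos-index u (suc v))

    m∤B : ∀ u {v} → suc v ℕ.< m → ¬ + m Signed.∣ + d ℤ.* + suc (u ℕ.* m ℕ.+ v)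
    m∤B u {v} 1+v<m m∣ = contradiction
      (small-≡ 1+v<m (ℕ.<-trans (ℕ.s≤s ℕ.z≤n) 1+v<m) (≡.subst (λ x → + m Signed.∣ x) (≡.sym (ℤ.+-identityʳ _)) m∣1+v)) λ ()
      where
      m∣1+v : + m Signed.∣ + suc v
      m∣1+v = Signed.∣m+n∣m⇒∣n {m = + u ℤ.* + m} (≡.subst (λ x → + m Signed.∣ x) (B-index u v) (cancel-d _ m∣)) (divides (+ u) ≡.refl)

    m∣B : ∀ u {v} → suc v ≡ m → + m Signed.∣ + d ℤ.* + suc (u ℕ.* m ℕ.+ v)
    m∣B u {v} 1+v≡m = Signed.∣n⇒∣m*n (+ d) (divides (+ u ℤ.+ + 1) (≡.trans (B-index u v)
      (≡.trans (≡.cong (λ x → + u ℤ.* + m ℤ.+ + x) 1+v≡m) (lemma (+ u) (+ m)))))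
      where
      lemma : ∀ u m → u ℤ.* m ℤ.+ m ≡ (u ℤ.+ + 1) ℤ.* m
      lemma = ℤ-Solver.solve-∀

    Int-p^ : ∀ k → Int (p ^ k)
    Int-p^ k = Int-^ k (Int-W (+ d))

    Int-A : ∀ j → Int (A j)
    Int-A j = Int-- Int-1 (Int-* (Int-W t) (Int-p^ j))

    Int-B : ∀ j → Int (B j)
    Int-B j = Int-- Int-1 (Int-p^ (suc j))

    Int-C : ∀ j → Int (C j)
    Int-C j = Int-- Int-1 (Int-* (Int-* (Int-W t) (Int-W t)) (Int-p^ j))

    I-A : ∀ u → I 1 (A (u ℕ.* m ℕ.+ V))
    I-A u = I-resp (sym (A≈ _)) (I-W (m∣τ u))

    Unit-A : ∀ u {v} → v ℕ.< m → ¬ v ≡ V → Unit (A (u ℕ.* m ℕ.+ v))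
    Unit-A u v<m v≢V = Unit-resp (sym (A≈ _)) (Unit-W (m∤τ u v<m v≢V))

    Unit-B : ∀ u {v} → suc v ℕ.< m → Unit (B (u ℕ.* m ℕ.+ v))
    Unit-B u 1+v<m = Unit-resp (sym (B≈ _)) (Unit-W (m∤B u 1+v<m))

    Power-B : ∀ u {v} → suc v ≡ m → Power 1 (B (u ℕ.* m ℕ.+ v))
    Power-B u 1+v≡m = Power-resp (sym (B≈ _)) (Simple⇒Power (Simple-W (m∣B u 1+v≡m) (d[1+j]≢0 _)))

    Valuation : ℕ → ℕ → Set
    Valuation u v = Int (r (u ℕ.* m ℕ.+ v)) × (V ℕ.< v → I 1 (r (u ℕ.* m ℕ.+ v)))

    private
      at : ∀ (P : Carrier → Set) {k l} → k ≡ l → P (r l) → P (r k)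
      at P ≡.refl x = x

    -- The product with `A` is needed for the case V = m - 1, in which numerator and denominator
    -- vanish at the same index.
    I-rA : ∀ u {v} → V ℕ.≤ v → Valuation u v → I 1 (r (u ℕ.* m ℕ.+ v) * A (u ℕ.* m ℕ.+ v))
    I-rA u {v} V≤v (r∈ , r∈I) with ℕ.m≤n⇒m<n∨m≡n V≤v
    ... | inj₁ V<v    = I-*ʳ (r∈I V<v) (Int-A (u ℕ.* m ℕ.+ v))
    ... | inj₂ ≡.refl = I-*ˡ r∈ (I-A u)

    -- In every block the numerator picks up a zero at v = V and the denominator one at v = m - 1,
    -- which is not earlier. Thus `r` has a zero between these indices and is integral again when
    -- the next block starts, the denominator having order exactly one.
    valuation : ∀ u v → v ℕ.< m → Valuation u v
    valuation zero    zero    _     = Int-resp (sym (Π-zero _)) Int-1 , λ ()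
    valuation (suc u) zero    _     = at Int index
      (Int-resp (trans (*-assoc _ _ _) (sym (r-suc k)))
        (I/Power (I-rA u (ℕ.<⇒≤pred V<m) (valuation u v v<m)) (Power-B u 1+v≡m) (B≉0 k))) , λ ()
      where
      v = ℕ.pred m
      1+v≡m : suc v ≡ m
      1+v≡m = ℕ.suc-pred m
      v<m : v ℕ.< m
      v<m = ℕ.≤-reflexive 1+v≡m
      k = u ℕ.* m ℕ.+ v
      index : suc u ℕ.* m ℕ.+ 0 ≡ suc k
      index = ≡.trans (ℕ.+-identityʳ _) (≡.trans (ℕ.+-comm m (u ℕ.* m))
        (≡.trans (≡.cong (λ x → u ℕ.* m ℕ.+ x) (≡.sym 1+v≡m)) (ℕ.+-suc _ _)))
    valuation u       (suc v) 1+v<m = step (valuation u v (ℕ.<⇒≤ 1+v<m))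
      where
      k = u ℕ.* m ℕ.+ v
      B⁻∈ : Int (B k ⁻¹)
      B⁻∈ = int⁻¹ (Unit-B u 1+v<m)
      step : Valuation u v → Valuation u (suc v)
      step val =
        at Int (ℕ.+-suc _ _) (Int-resp (sym (r-suc k)) (Int-* (proj₁ val) (Int-* (Int-A k) B⁻∈))) ,
        λ V<1+v → at (I 1) (ℕ.+-suc _ _) (I-resp (trans (*-assoc _ _ _) (sym (r-suc k)))
          (I-*ʳ (I-rA u (ℕ.≤-pred V<1+v) val) B⁻∈))

    Int-r : ∀ k → Int (r k)
    Int-r k = at Int (≡.trans (ℕ.m≡m%n+[m/n]*n k m) (ℕ.+-comm (k ℕ.% m) _)) (proj₁ (valuation (k ℕ./ m) (k ℕ.% m) (ℕ.m%n<n k m)))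

    Int-L : ∀ k → Int (L k)
    Int-L k = Int-* (Int-* (Int-* (Int-r k) (Int-r k)) (Int-* (Int-r k) (Int-r k))) (Int-E _)

    Int-weight : ∀ k → Int ((1# - a * p ^ k * p ^ k) * ((1# - s * p ^ k) * (1# - s * p ^ k)))
    Int-weight k = Int-* (Int-- Int-1 (Int-* (Int-* (Int-W t) (Int-p^ k)) (Int-p^ k)))
      (Int-* 1-sP (1-sP))
      where 1-sP = Int-- Int-1 (Int-* (Int-E t) (Int-p^ k))

    -- Each of the four Pochhammer ratios contributes a zero. The order four also suffices for the
    -- cube at m = n.
    I-c-large : ∀ u {v} → V ℕ.< v → v ℕ.< m → I 4 (c (u ℕ.* m ℕ.+ v))
    I-c-large u {v} V<v v<m = I-*ˡ (Int-weight (u ℕ.* m ℕ.+ v)) (I-*ʳ (I-* (I-* r∈ r∈) (I-* r∈ r∈)) (Int-E _))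
      where r∈ = proj₂ (valuation u v v<m) V<v

    -- A square root of p²ᵏ L k. The factor p²ᵏ is what `odd` and `even` below take out of the
    -- polynomial weight, and including it makes `h` invariant under reflection modulo z.
    h : ℕ → Carrier
    h k = r k * r k * W ((+ d ℤ.- t) ℤ.* + k)

    Int-h : ∀ k → Int (h k)
    Int-h k = Int-* (Int-* (Int-r k) (Int-r k)) (Int-E _)

    h-suc : ∀ k → h (suc k) ≈ h k * (A k * A k * (B k ⁻¹ * B k ⁻¹)) * W (+ d ℤ.- t)
    h-suc k = begin
      r (suc k) * r (suc k) * W ((+ d ℤ.- t) ℤ.* + suc k)
        ≈⟨ *-cong (*-cong (r-suc k) (r-suc k)) (trans (W-cong (ℤ.*-suc (+ d ℤ.- t) (+ k))) (W-+ _ _)) ⟩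
      r k * (A k * B k ⁻¹) * (r k * (A k * B k ⁻¹)) * (W (+ d ℤ.- t) * W ((+ d ℤ.- t) ℤ.* + k))
        ≈⟨ solve 5 (λ r α b x y → r :* (α :* b) :* (r :* (α :* b)) :* (x :* y)
             ⊜ r :* r :* y :* (α :* α :* (b :* b)) :* x) refl (r k) (A k) (B k ⁻¹) _ _ ⟩
      h k * (A k * A k * (B k ⁻¹ * B k ⁻¹)) * W (+ d ℤ.- t) ∎

    module Reflect (u : ℕ) where

      o : ℕ
      o = u ℕ.* m

      m∣o : + m Signed.∣ + o
      m∣o = divides (+ u) (ℤ.pos-* u m)

      -- Modulo z, the relation A_{o+i} = - w^{τ (o+i)} B_{o+j} holds for i + j + 1 = V;
      -- hence Q below slides and h is symmetric.
      G : ℕ → Carrier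
      G i = Π i (λ l → B (o ℕ.+ l))

      Q : ℕ → ℕ → Carrier
      Q i j = h (o ℕ.+ i) * (G i * G i * (G j * G j) * W (+ d ℤ.* (+ i ℤ.* + j)))

      -- The sum depends on i + j = V only: it equals τ (o + V) + d o, and m divides both parts.
      m∣center : ∀ i j → i ℕ.+ j ≡ V → + m Signed.∣ τ (o ℕ.+ i) ℤ.+ + d ℤ.* + (o ℕ.+ j)
      m∣center i j i+j≡V = ≡.subst (λ x → + m Signed.∣ x)
        (≡.trans (≡.cong (λ v → τ (o ℕ.+ v) ℤ.+ + d ℤ.* + o) (≡.sym i+j≡V)) (lemma t (+ d) (+ o) (+ i) (+ j)))
        (Signed.∣m∣n⇒∣m+n (m∣τ u) (Signed.∣n⇒∣m*n (+ d) m∣o))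
        where
        lemma : ∀ t d o i j → (t ℤ.+ d ℤ.* (o ℤ.+ (i ℤ.+ j))) ℤ.+ d ℤ.* o ≡ t ℤ.+ d ℤ.* (o ℤ.+ i) ℤ.+ d ℤ.* (o ℤ.+ j)
        lemma = ℤ-Solver.solve-∀

      -- Raising i multiplies `h` by a quotient of squares whose denominator is absorbed by the new
      -- factors of `G`; raising j only adds squares of `B`. The sign in α ≡ -ξ β disappears in the
      -- squares, and what remains is a comparison of powers of w.
      Q-slide : ∀ i j → suc (i ℕ.+ j) ≡ V → I 1 (Q (suc i) j - Q i (suc j))
      Q-slide i j 1+i+j≡V = I-resp (sym (begin
        Q (suc i) j - Q i (suc j)
          ≈⟨ +-cong left (-‿cong right) ⟩
        H * (α * α * x * M′) - H * (β * β * M″)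
          ≈⟨ solve 7 (λ H α β x ξ m′ m″ →
               H :* (α :* α :* x :* m′) :- H :* (β :* β :* m″)
               ⊜ H :* ((α :* α :- ξ :* β :* (ξ :* β)) :* (x :* m′) :+ β :* β :* (ξ :* ξ :* x :* m′ :- m″)))
               refl H α β x ξ M′ M″ ⟩
        H * ((α * α - ξ * β * (ξ * β)) * (x * M′) + β * β * (ξ * ξ * x * M′ - M″)) ∎))
        (I-*ˡ H∈ (I-+ (I-*ʳ squares (Int-* (Int-E _) (Int-E _))) (I-*ˡ (Int-* (Int-B (o ℕ.+ j)) (Int-B (o ℕ.+ j))) exponents)))
        where
        k = o ℕ.+ i
        α = A k
        β = B (o ℕ.+ j)
        ξ = W (τ k)
        x = W (+ d ℤ.- t)
        M′ = W (+ d ℤ.* (+ suc i ℤ.* + j))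
        M″ = W (+ d ℤ.* (+ i ℤ.* + suc j))
        H = h k * (G i * G i * (G j * G j))
        Int-G : ∀ i → Int (G i)
        Int-G i = Int-Π i _ (λ l _ → Int-B (o ℕ.+ l))
        H∈ : Int H
        H∈ = Int-* (Int-h k) (Int-* (Int-* (Int-G i) (Int-G i)) (Int-* (Int-G j) (Int-G j)))
        left : Q (suc i) j ≈ H * (α * α * x * M′)
        left = begin
          h (o ℕ.+ suc i) * (G (suc i) * G (suc i) * (G j * G j) * M′)
            ≈⟨ *-cong (trans (reflexive (≡.cong h (ℕ.+-suc o i))) (h-suc k))
                 (*-congʳ (*-congʳ (*-cong (Π-snoc i _) (Π-snoc i _)))) ⟩
          h k * (α * α * (b⁻ * b⁻)) * x * (G i * b * (G i * b) * (G j * G j) * M′)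
            ≈⟨ solve 8 (λ h α b⁻ b x g g′ M → h :* (α :* α :* (b⁻ :* b⁻)) :* x :* (g :* b :* (g :* b) :* (g′ :* g′) :* M)
                 ⊜ (b :* b⁻) :* ((b :* b⁻) :* (h :* (g :* g :* (g′ :* g′)) :* (α :* α :* x :* M))))
                 refl (h k) α b⁻ b x (G i) (G j) M′ ⟩
          b * b⁻ * (b * b⁻ * (H * (α * α * x * M′)))
            ≈⟨ *-cong (*-inverseʳ (B≉0 k)) (*-congʳ (*-inverseʳ (B≉0 k))) ⟩
          1# * (1# * (H * (α * α * x * M′)))
            ≈⟨ trans (*-identityˡ _) (*-identityˡ _) ⟩
          H * (α * α * x * M′) ∎
          where
          b = B k
          b⁻ = B k ⁻¹
        right : Q i (suc j) ≈ H * (β * β * M″)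
        right = trans (*-congˡ (*-congʳ (*-congˡ (*-cong (Π-snoc j _) (Π-snoc j _)))))
          (solve 5 (λ h g g′ β M → h :* (g :* (g′ :* β :* (g′ :* β)) :* M) ⊜ h :* (g :* (g′ :* g′)) :* (β :* β :* M))
             refl (h k) (G i * G i) (G j) β M″)
        center : + m Signed.∣ τ k ℤ.+ + d ℤ.* + suc (o ℕ.+ j)
        center = ≡.subst (λ l → + m Signed.∣ τ k ℤ.+ + d ℤ.* + l) (ℕ.+-suc o j)
          (m∣center i (suc j) (≡.trans (ℕ.+-suc i j) 1+i+j≡V))
        sum : I 1 (α + ξ * β)
        sum = I-resp (begin
          1# - W (τ k ℤ.+ + d ℤ.* + suc (o ℕ.+ j))
            ≈⟨ +-congˡ (-‿cong (W-+ _ _)) ⟩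
          1# - ξ * η
            ≈⟨ solve 2 (λ ξ η → :1 :- ξ :* η ⊜ (:1 :- ξ) :+ ξ :* (:1 :- η)) refl ξ η ⟩
          (1# - ξ) + ξ * (1# - η)
            ≈⟨ +-cong (A≈ k) (*-congˡ (B≈ (o ℕ.+ j))) ⟨
          α + ξ * β ∎) (I-W center)
          where η = W (+ d ℤ.* + suc (o ℕ.+ j))
        squares : I 1 (α * α - ξ * β * (ξ * β))
        squares = I-resp (solve 2 (λ x y → (x :+ y) :* (x :- y) ⊜ x :* x :- y :* y) refl α (ξ * β))
          (I-*ʳ sum (Int-- (Int-A k) (Int-* (Int-E _) (Int-B (o ℕ.+ j)))))
        -- The power w^(d i j) in `Q` is chosen for this step: the two exponents then differ exactly
        -- by the number of `center`, which m divides.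
        exponents : I 1 (ξ * ξ * x * M′ - M″)
        exponents = I-resp (+-congʳ (begin
          W (τ k ℤ.+ τ k ℤ.+ (+ d ℤ.- t) ℤ.+ + d ℤ.* (+ suc i ℤ.* + j))
            ≈⟨ W-+ _ _ ⟩
          W (τ k ℤ.+ τ k ℤ.+ (+ d ℤ.- t)) * M′
            ≈⟨ *-congʳ (trans (W-+ _ _) (*-congʳ (W-+ _ _))) ⟩
          ξ * ξ * x * M′ ∎))
          (W-≡ (≡.subst (λ x → + m Signed.∣ x) (lemma t (+ d) (+ o) (+ i) (+ j)) center))
          where
          lemma : ∀ t d o i j → t ℤ.+ d ℤ.* (o ℤ.+ i) ℤ.+ d ℤ.* (+ 1 ℤ.+ (o ℤ.+ j))
            ≡ (t ℤ.+ d ℤ.* (o ℤ.+ i)) ℤ.+ (t ℤ.+ d ℤ.* (o ℤ.+ i)) ℤ.+ (d ℤ.- t) ℤ.+ d ℤ.* ((+ 1 ℤ.+ i) ℤ.* j)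
              ℤ.- d ℤ.* (i ℤ.* (+ 1 ℤ.+ j))
          lemma = ℤ-Solver.solve-∀

      h-symmetric : ∀ i j → i ℕ.+ j ≡ V → I 1 (h (o ℕ.+ i) - h (o ℕ.+ j))
      h-symmetric i j i+j≡V = I-cancel weight-unit (I-resp
        (trans (+-congˡ (-‿cong (*-congˡ (*-cong (*-comm _ _) (W-cong (≡.cong (λ x → + d ℤ.* x) (ℤ.*-comm (+ j) (+ i))))))))
          (solve 3 (λ h h′ w → h :* w :- h′ :* w ⊜ w :* (h :- h′)) refl _ _ weight))
        (I-slide V Q Q-slide i j i+j≡V))
        where
        weight = G i * G i * (G j * G j) * W (+ d ℤ.* (+ i ℤ.* + j))
        Unit-G : ∀ {i} → i ℕ.≤ V → Unit (G i)
        Unit-G {i} i≤V = Unit-Π i _ (λ l l<i → Unit-B u (ℕ.≤-<-trans (ℕ.≤-trans l<i i≤V) V<m))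
        Gᵢ = Unit-G {i} (≡.subst (i ℕ.≤_) i+j≡V (ℕ.m≤m+n i j))
        Gⱼ = Unit-G {j} (≡.subst (j ℕ.≤_) i+j≡V (ℕ.m≤n+m j i))
        weight-unit : Unit weight
        weight-unit = Unit-* (Unit-* (Unit-* Gᵢ Gᵢ) (Unit-* Gⱼ Gⱼ)) (Unit-E _)

      -- With P = pᵏ these are P⁻¹ (1 - s P)² and P⁻¹ (1 - a P²), expanded by means of s² = a so
      -- that only w^(-dk) and w^(τ k), the two powers which the reflection exchanges, occur besides
      -- s.
      even odd : ℕ → Carrier
      odd k  = W (ℤ.- (+ d ℤ.* + k)) - W (τ k)
      even k = W (ℤ.- (+ d ℤ.* + k)) + W (τ k) - (1# + 1#) * s

      c≈ : ∀ k → c k ≈ odd k * even k * (h k * h k)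
      c≈ k = begin
        (1# - a * P * P) * ((1# - s * P) * (1# - s * P)) * (R⁴ * W (ℤ.- (+ 2 ℤ.* t ℤ.* + k)))
          ≈⟨ *-cong (*-congˡ (solve 2 (λ s P → (:1 :- s :* P) :* (:1 :- s :* P)
               ⊜ :1 :- (:1 :+ :1) :* s :* P :+ s :* s :* P :* P) refl s P)) (*-congˡ exponent) ⟩
        (1# - a * P * P) * (1# - (1# + 1#) * s * P + s * s * P * P) * (R⁴ * (P⁻ * P⁻ * (x * x)))
          ≈⟨ *-congʳ (*-congˡ (+-congˡ (*-congʳ (*-congʳ s²≈a)))) ⟩
        (1# - a * P * P) * (1# - (1# + 1#) * s * P + a * P * P) * (R⁴ * (P⁻ * P⁻ * (x * x)))
          ≈⟨ solve 6 (λ a s P P⁻ r x →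
               (:1 :- a :* P :* P) :* (:1 :- (:1 :+ :1) :* s :* P :+ a :* P :* P) :* (r :* r :* (r :* r) :* (P⁻ :* P⁻ :* (x :* x)))
               ⊜ (P⁻ :- P :* P⁻ :* (a :* P)) :* (P⁻ :+ P :* P⁻ :* (a :* P) :- (:1 :+ :1) :* s :* (P :* P⁻)) :* (r :* r :* x :* (r :* r :* x)))
               refl a s P P⁻ (r k) x ⟩
        (P⁻ - P * P⁻ * (a * P)) * (P⁻ + P * P⁻ * (a * P) - (1# + 1#) * s * (P * P⁻)) * (h k * h k)
          ≈⟨ *-congʳ (*-cong (+-congˡ (-‿cong simplify)) (+-cong (+-congˡ simplify) (-‿cong (trans (*-congˡ PP⁻≈1) (*-identityʳ _))))) ⟩
        odd k * even k * (h k * h k) ∎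
        where
        P = p ^ k
        P⁻ = W (ℤ.- (+ d ℤ.* + k))
        x = W ((+ d ℤ.- t) ℤ.* + k)
        R⁴ = r k * r k * (r k * r k)
        PP⁻≈1 : P * P⁻ ≈ 1#
        PP⁻≈1 = trans (*-congʳ (p^ k)) (W-inverse _)
        simplify : P * P⁻ * (a * P) ≈ W (τ k)
        simplify = trans (*-congʳ PP⁻≈1) (trans (*-identityˡ _) (trans (*-congˡ (p^ k)) (sym (W-+ _ _))))
        exponent : W (ℤ.- (+ 2 ℤ.* t ℤ.* + k)) ≈ P⁻ * P⁻ * (x * x)
        exponent = trans (W-cong (lemma t (+ d) (+ k))) (trans (W-+ _ _) (*-cong (W-+ _ _) (W-+ _ _)))
          where
          lemma : ∀ t d k → ℤ.- (+ 2 ℤ.* t ℤ.* k)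
            ≡ (ℤ.- (d ℤ.* k) ℤ.+ ℤ.- (d ℤ.* k)) ℤ.+ ((d ℤ.- t) ℤ.* k ℤ.+ (d ℤ.- t) ℤ.* k)
          lemma = ℤ-Solver.solve-∀

      -- By `m∣center`, w^(τ k) ≡ w^(-dl) and w^(τ l) ≡ w^(-dk). So reflection changes the sign of
      -- `odd` and preserves `even`, while h² is preserved by `h-symmetric`.
      c-antisymmetric : ∀ i j → i ℕ.+ j ≡ V → I 1 (c (o ℕ.+ i) + c (o ℕ.+ j))
      c-antisymmetric i j i+j≡V = I-resp (sym (trans (+-cong (c≈ k) (c≈ l))
        (solve 6 (λ α α′ β β′ h h′ → α :* β :* (h :* h) :+ α′ :* β′ :* (h′ :* h′)
           ⊜ (α :+ α′) :* (β :* (h :* h)) :- α′ :* ((β :- β′) :* (h :* h) :+ β′ :* ((h :- h′) :* (h :+ h′))))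
           refl (odd k) (odd l) (even k) (even l) (h k) (h l))))
        (I-- (I-*ʳ odd-sum (Int-* (Int-even k) (Int-* (Int-h k) (Int-h k))))
          (I-*ˡ (Int-odd l) (I-+ (I-*ʳ even-difference (Int-* (Int-h k) (Int-h k)))
            (I-*ˡ (Int-even l) (I-*ʳ (h-symmetric i j i+j≡V) (Int-+ (Int-h k) (Int-h l)))))))
        where
        k = o ℕ.+ i
        l = o ℕ.+ j
        Int-odd : ∀ k → Int (odd k)
        Int-odd k = Int-- (Int-E _) (Int-E _)
        Int-even : ∀ k → Int (even k)
        Int-even k = Int-- (Int-+ (Int-E _) (Int-E _)) (Int-* (Int-+ Int-1 Int-1) (Int-E t))
        mirror : ∀ i j → i ℕ.+ j ≡ V → I 1 (W (τ (o ℕ.+ i)) - W (ℤ.- (+ d ℤ.* + (o ℕ.+ j))))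
        mirror i j i+j≡V = W-≡ (≡.subst (λ x → + m Signed.∣ x) (≡.cong (λ x → τ (o ℕ.+ i) ℤ.+ x) (≡.sym (ℤ.neg-involutive _))) (m∣center i j i+j≡V))
        kl = mirror i j i+j≡V
        lk = mirror j i (≡.trans (ℕ.+-comm j i) i+j≡V)
        odd-sum : I 1 (odd k + odd l)
        odd-sum = I-resp (solve 4 (λ x y x′ y′ → (:- (y :- x′)) :- (y′ :- x) ⊜ (x :- y) :+ (x′ :- y′)) refl
          (W (ℤ.- (+ d ℤ.* + k))) (W (τ k)) (W (ℤ.- (+ d ℤ.* + l))) (W (τ l))) (I-- (I-neg kl) lk)
        even-difference : I 1 (even k - even l)
        even-difference = I-resp (solve 5 (λ x y x′ y′ s → (y :- x′) :- (y′ :- x) ⊜ (x :+ y :- s) :- (x′ :+ y′ :- s)) refl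
          (W (ℤ.- (+ d ℤ.* + k))) (W (τ k)) (W (ℤ.- (+ d ℤ.* + l))) (W (τ l)) ((1# + 1#) * s)) (I-- kl lk)

    I-block : ∀ u → I 1 (Σ (suc V) (λ v → c (u ℕ.* m ℕ.+ v)))
    I-block u = I-Σ-antisymmetric V _ (Reflect.c-antisymmetric u)

    I-full-block : ∀ u → I 1 (Σ m (λ v → c (u ℕ.* m ℕ.+ v)))
    I-full-block u = I-resp (trans (sym (Σ-split (suc V) (m ℕ.∸ suc V) _)) (reflexive (≡.cong (λ l → Σ l (λ v → c (u ℕ.* m ℕ.+ v))) (ℕ.m+[n∸m]≡n V<m))))
      (I-+ (I-block u) (I-Σ (m ℕ.∸ suc V) (λ k → c (u ℕ.* m ℕ.+ (suc V ℕ.+ k))) (λ k k<m∸V →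
        I-weaken (I-weaken (I-weaken (I-c-large u (ℕ.s≤s (ℕ.m≤m+n V k))
          (≡.subst (suc V ℕ.+ k ℕ.<_) (ℕ.m+[n∸m]≡n V<m) (ℕ.+-monoʳ-< (suc V) k<m∸V))))))))

    -- The N + 1 indices form U full blocks followed by V + 1 indices, which are precisely the range
    -- of one reflection.
    I-Σc-N : I 1 (Σ (suc N) c)
    I-Σc-N = I-resp (trans (sym (Σ-split (U ℕ.* m) (suc V) c)) (reflexive (≡.cong (λ l → Σ l c) index)))
      (I-+ (I-Σ-blocks U c I-full-block) (I-block U))
      where
      index : U ℕ.* m ℕ.+ suc V ≡ suc N
      index = ≡.trans (ℕ.+-comm (U ℕ.* m) (suc V)) (≡.cong suc (≡.sym N≡V+Um))

    I-Σc-n : I 1 (Σ n c)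
    I-Σc-n = I-resp (reflexive (≡.cong (λ l → Σ l c) (≡.sym (ℕ._∣_.equality m∣n)))) (I-Σ-blocks (ℕ._∣_.quotient m∣n) c I-full-block)

    Power-B-block : ∀ u → Power 1 (Π m (λ v → B (u ℕ.* m ℕ.+ v)))
    Power-B-block u = ≡.subst (λ l → Power 1 (Π l (λ v → B (u ℕ.* m ℕ.+ v)))) (ℕ.suc-pred m)
      (Power-resp (sym (Π-snoc (ℕ.pred m) _)) (Power-* (Unit⇒Power (Unit-Π (ℕ.pred m) _
        λ v v<m-1 → Unit-B u (≡.subst (suc v ℕ.<_) (ℕ.suc-pred m) (ℕ.s≤s v<m-1))))
        (Power-B u (ℕ.suc-pred m))))

    -- Every full block contains one zero of `B`, at its last index, and the V indices left over
    -- stop before the next one.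
    Power-ΠB : Power U (Π N B)
    Power-ΠB = Power-resp (trans (*-comm _ _) (trans (sym (Π-split (U ℕ.* m) V B))
      (reflexive (≡.cong (λ l → Π l B) (≡.trans (ℕ.+-comm (U ℕ.* m) V) (≡.sym N≡V+Um))))))
      (Power-* (Unit⇒Power (Unit-Π V _ λ v v<V → Unit-B U (ℕ.≤-<-trans v<V V<m)))
        (Power-Π-blocks U B Power-B-block))

    C≈ : ∀ j → C j ≈ 1# - W (t ℤ.+ t ℤ.+ + d ℤ.* + j)
    C≈ j = +-congˡ (-‿cong (trans (*-cong (sym (W-+ t t)) (p^ j)) (sym (W-+ _ _))))

    -- The number 2 n = 2 t + 2 d N is a multiple of m, so `C` vanishes modulo z at every index
    -- congruent to 2 N. Any m consecutive indices contain one; here it is o + v with v the residue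
    -- of 2 N - o.
    I-C-block : ∀ o → I 1 (Π m (λ v → C (o ℕ.+ v)))
    I-C-block o = I-Π m _ v (ℤ.n%ℕd<d i m) (λ j → Int-C (o ℕ.+ j)) (I-resp (sym (C≈ (o ℕ.+ v))) (I-W
      (≡.subst (λ x → + m Signed.∣ x) (≡.trans (≡.cong (λ x → x ℤ.+ x ℤ.+ + d ℤ.* (ℤ.- ((i ℤ./ℕ m) ℤ.* + m))) n≡t+dN) index)
        (Signed.∣m∣n⇒∣m+n (Signed.∣m∣n⇒∣m+n m∣+n m∣+n)
          (Signed.∣n⇒∣m*n (+ d) (Signed.∣m⇒∣-m (divides (i ℤ./ℕ m) ≡.refl)))))))
      where
      i : ℤ
      i = + N ℤ.+ + N ℤ.- + o
      v : ℕ
      v = i ℤ.%ℕ m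
      lemma₁ : ∀ v x → ℤ.- x ≡ v ℤ.- (v ℤ.+ x)
      lemma₁ = ℤ-Solver.solve-∀
      lemma₂ : ∀ t d N o v → (t ℤ.+ d ℤ.* N) ℤ.+ (t ℤ.+ d ℤ.* N) ℤ.+ d ℤ.* (v ℤ.- (N ℤ.+ N ℤ.- o)) ≡ t ℤ.+ t ℤ.+ d ℤ.* (o ℤ.+ v)
      lemma₂ = ℤ-Solver.solve-∀
      index : (t ℤ.+ + d ℤ.* + N) ℤ.+ (t ℤ.+ + d ℤ.* + N) ℤ.+ + d ℤ.* (ℤ.- ((i ℤ./ℕ m) ℤ.* + m)) ≡ t ℤ.+ t ℤ.+ + d ℤ.* + (o ℕ.+ v)
      index = ≡.trans (≡.cong (λ x → (t ℤ.+ + d ℤ.* + N) ℤ.+ (t ℤ.+ + d ℤ.* + N) ℤ.+ + d ℤ.* x)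
        (≡.trans (lemma₁ (+ v) _) (≡.cong (λ x → + v ℤ.- x) (≡.sym (ℤ.a≡a%ℕn+[a/ℕn]*n i m)))))
        (lemma₂ t (+ d) (+ N) (+ o) (+ v))

    -- The factor 1 + a of the denominator of ρ need not be a unit. It is one if
    -- V = 0, because then a ≡ 1; otherwise it divides C 0 = 1 - a².
    Int-ΠC/[1+a] : Int (Π V C * (1# + a) ⁻¹)
    Int-ΠC/[1+a] = by-cases V ≡.refl
      where
      by-cases : ∀ v → V ≡ v → Int (Π v C * (1# + a) ⁻¹)
      by-cases zero V≡0 = Int-* (Int-resp (sym (Π-zero C)) Int-1) (int⁻¹ 1+a-unit)
        where
        m∣t : + m Signed.∣ t
        m∣t = ≡.subst (λ x → + m Signed.∣ x) (≡.trans (≡.cong (λ x → t ℤ.+ + d ℤ.* + x) V≡0)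
          (≡.trans (≡.cong (λ x → t ℤ.+ x) (ℤ.*-zeroʳ (+ d))) (ℤ.+-identityʳ t))) (m∣τ 0)
        1+a-unit : Unit (1# + a)
        1+a-unit with I-W m∣t
        ... | mkI g g∈ 1-a≈ = Unit-2+z (Int-neg g∈) (begin
          1# + a                          ≈⟨ solve 1 (λ a → :1 :+ a ⊜ :1 :+ :1 :- (:1 :- a)) refl a ⟩
          1# + 1# - (1# - a)              ≈⟨ +-congˡ (-‿cong 1-a≈) ⟩
          1# + 1# - z * 1# * g            ≈⟨ solve 2 (λ z g → :1 :+ :1 :- z :* :1 :* g ⊜ :1 :+ :1 :+ z :* (:- g)) refl z g ⟩
          1# + 1# + z * - g               ∎) 1+a≉0
      by-cases (suc v) _ = Int-resp (begin
        (1# - a) * Π v (λ j → C (suc j))                               ≈⟨ *-identityˡ _ ⟨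
        1# * ((1# - a) * Π v (λ j → C (suc j)))                        ≈⟨ *-congʳ (*-inverseʳ 1+a≉0) ⟨
        (1# + a) * (1# + a) ⁻¹ * ((1# - a) * Π v (λ j → C (suc j)))
          ≈⟨ solve 3 (λ a x y → (:1 :+ a) :* x :* ((:1 :- a) :* y) ⊜ (:1 :- a :* a :* :1) :* y :* x) refl a _ _ ⟩
        C 0 * Π v (λ j → C (suc j)) * (1# + a) ⁻¹                      ≈⟨ *-congʳ (Π-suc v C) ⟨
        Π (suc v) C * (1# + a) ⁻¹                                      ∎)
        (Int-* (Int-- Int-1 (Int-W t)) (Int-Π v _ λ j _ → Int-C (suc j)))

    -- The U zeros of the denominator are matched by one zero in each of U blocks of `C` that start
    -- at index V. The first V factors of `C` are set aside to absorb 1 + a.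
    Int-ρ : Int (ρ N)
    Int-ρ = Int-resp (begin
      Π V C * (1# + a) ⁻¹ * (Π (U ℕ.* m) (λ v → C (V ℕ.+ v)) * Π N B ⁻¹)
        ≈⟨ solve 4 (λ x y w v → x :* y :* (w :* v) ⊜ x :* w :* (y :* v)) refl _ _ _ _ ⟩
      Π V C * Π (U ℕ.* m) (λ v → C (V ℕ.+ v)) * ((1# + a) ⁻¹ * Π N B ⁻¹)
        ≈⟨ *-cong (trans (sym (Π-split V (U ℕ.* m) C)) (reflexive (≡.cong (λ l → Π l C) (≡.sym N≡V+Um)))) inverse ⟩
      Π N C * ((1# + a) * Π N B) ⁻¹ ∎)
      (Int-* Int-ΠC/[1+a] (I/Power (I-Π-blocks U C V I-C-block) Power-ΠB (ΠB≉0 N)))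
      where
      inverse : (1# + a) ⁻¹ * Π N B ⁻¹ ≈ ((1# + a) * Π N B) ⁻¹
      inverse = sym (⁻¹-unique (*-≉0 1+a≉0 (ΠB≉0 N)) (trans
        (solve 4 (λ x y x′ y′ → x :* y :* (x′ :* y′) ⊜ (x :* x′) :* (y :* y′)) refl _ _ _ _)
        (trans (*-cong (*-inverseʳ 1+a≉0) (*-inverseʳ (ΠB≉0 N))) (*-identityˡ 1#))))

    I-R : I 1 (R n N)
    I-R = I-*ˡ (Int-* (Int-* (Int-neg (Int-+ Int-1 Int-1)) (Int-E t)) (Int-* 1-s 1-s))
      (I-*ʳ (I-*ʳ (I-W m∣+n) (Int-E _)) Int-ρ)
      where 1-s = Int-- Int-1 (Int-E t)

  -- The congruence modulo the cube of Φ_n(w).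

  module AtTop
    .{{_ : ℕ.NonZero n}} (𝓛 : Place K X n)
    (cancel-d : ∀ i → + n Signed.∣ + d ℤ.* i → + n Signed.∣ i)
    (N<n : N ℕ.< n)
    (d[1+j]≢n : ∀ j → ¬ + d ℤ.* + suc j ℤ.- + n ≡ + 0)
    where

    open PlaceProperties K X 𝓛
    open AtPlace 𝓛 ℕ.∣-refl cancel-d

    V≡N : V ≡ N
    V≡N = ℕ.m<n⇒m%n≡m N<n

    y y⁻ e a⁻ Y : Carrier
    y  = W (+ n)
    y⁻ = W (ℤ.- + n)
    a⁻ = W (ℤ.- t)
    -- That is, e = 1 / (a y), while Y = p^N = y / a. Hence the denominators of the terminating
    -- series are 1 - pʲ⁺¹ / y and 1 - y pʲ⁺¹.
    e  = W (ℤ.- t ℤ.+ ℤ.- + n)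
    Y  = p ^ N

    aY≈y : a * Y ≈ y
    aY≈y = trans (*-congˡ (p^ N)) (trans (sym (W-+ _ _)) (W-cong (≡.sym n≡t+dN)))

    yy⁻≈1 : y * y⁻ ≈ 1#
    yy⁻≈1 = W-inverse (+ n)

    ae≈y⁻ : a * e ≈ y⁻
    ae≈y⁻ = trans (sym (W-+ _ _)) (W-cong (lemma t (+ n)))
      where
      lemma : ∀ t n → t ℤ.+ (ℤ.- t ℤ.+ ℤ.- n) ≡ ℤ.- n
      lemma = ℤ-Solver.solve-∀

    1-aep≈ : ∀ j → 1# - a * e * p ^ suc j ≈ 1# - W (+ d ℤ.* + suc j ℤ.- + n)
    1-aep≈ j = +-congˡ (-‿cong (trans (*-cong ae≈y⁻ (p^ (suc j))) (trans (*-comm _ _) (sym (W-+ _ _)))))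

    1-aep≉0 : ∀ j → ¬ 1# - a * e * p ^ suc j ≈ 0#
    1-aep≉0 j = ≉0-resp (sym (1-aep≈ j)) (1-W≉0 (d[1+j]≢n j))

    module 𝓔 = WellPoised.Terminating K a p e A≉0 B≉0 1-aep≉0
    open 𝓔 using (D; δ; B⁻; C⁻; E⁻)

    ea²Y≈1 : e * (a * a * Y) ≈ 1#
    ea²Y≈1 = begin
      e * (a * a * Y)      ≈⟨ solve 3 (λ e a Y → e :* (a :* a :* Y) ⊜ (a :* Y) :* (a :* e)) refl e a Y ⟩
      a * Y * (a * e)      ≈⟨ *-cong aY≈y ae≈y⁻ ⟩
      y * y⁻               ≈⟨ yy⁻≈1 ⟩
      1#                   ∎

    module Closed = 𝓔.Closed s s²≈a N ea²Y≈1

    I-1-y : I 1 (1# - y)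
    I-1-y = I-W m∣+n

    -- Not the power q²: this is the factor shared by the right-hand side, `R n N` = -2 s (1 - s)²
    -- w, and the closed form, which is (1 + a) w by `W≈`.
    w : Carrier
    w = (1# - y) * W (ℤ.- (t ℤ.* + N)) * ρ N

    a^ : ∀ k → a ^ k ≈ W (t ℤ.* + k)
    a^ zero    = sym (trans (W-cong (ℤ.*-zeroʳ t)) W-0)
    a^ (suc k) = trans (*-congˡ (a^ k)) (trans (sym (W-+ _ _)) (W-cong (≡.sym (ℤ.*-suc t (+ k)))))

    W≈ : 𝓔.W N ≈ (1# + a) * w
    W≈ = *-cancelˡ (*-≉0 a^N≉0 (ΠB≉0 N)) (begin
      a ^ N * Π N B * 𝓔.W N               ≈⟨ *-comm _ _ ⟩
      𝓔.W N * (a ^ N * Π N B)             ≈⟨ Closed.W-reversed ⟩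
      (1# - a * Y) * Π N C                    ≈⟨ *-congʳ (+-congˡ (-‿cong aY≈y)) ⟩
      (1# - y) * Π N C                        ≈⟨ solve 2 (λ y c → (:1 :- y) :* c ⊜ :1 :* (:1 :* ((:1 :- y) :* c))) refl y (Π N C) ⟩
      1# * (1# * ((1# - y) * Π N C))          ≈⟨ *-cong (trans (*-congʳ (a^ N)) (W-inverse _)) (*-congʳ (*-inverseʳ (*-≉0 1+a≉0 (ΠB≉0 N)))) ⟨
      a ^ N * x * ((1# + a) * Π N B * ((1# + a) * Π N B) ⁻¹ * ((1# - y) * Π N C))
        ≈⟨ solve 7 (λ α x a b i y c → α :* x :* ((:1 :+ a) :* b :* i :* ((:1 :- y) :* c))
             ⊜ α :* b :* ((:1 :+ a) :* ((:1 :- y) :* x :* (c :* i)))) refl (a ^ N) x a (Π N B) _ y (Π N C) ⟩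
      a ^ N * Π N B * ((1# + a) * w)          ∎)
      where
      x = W (ℤ.- (t ℤ.* + N))
      a^N≉0 : ¬ a ^ N ≈ 0#
      a^N≉0 = ≉0-resp (sym (a^ N)) (E≉0 _)

    -- The exact value differs from R by Y⁻¹ w (1 - y)², and w is a multiple of 1 - y.
    exact-≡ : I 3 (Σ (suc N) Closed.c - R n N)
    exact-≡ = I-cancel (Unit-resp (sym (p^ N)) (Unit-E _)) (I-resp (sym (begin
      Y * (S - R n N)                 ≈⟨ solve 3 (λ Y S R → Y :* (S :- R) ⊜ Y :* S :- Y :* R) refl Y S (R n N) ⟩
      Y * S - Y * R n N               ≈⟨ +-congʳ YS≈ ⟩
      w * Closed.value - Y * R n N
        ≈⟨ solve 4 (λ w a Y s → w :* ((:1 :+ a :* Y) :* (:1 :+ a :* Y) :- (:1 :+ :1) :* s :* Y :* (:1 :+ a))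
             :- Y :* ((:- (:1 :+ :1)) :* s :* ((:1 :- s) :* (:1 :- s)) :* w)
             ⊜ w :* ((:1 :+ a :* Y) :* (:1 :+ a :* Y) :- (:1 :+ :1) :* s :* Y :* (:1 :+ a)
                  :+ (:1 :+ :1) :* s :* Y :* (:1 :+ s :* s) :- (:1 :+ :1 :+ :1 :+ :1) :* (s :* s) :* Y))
             refl w a Y s ⟩
      w * ((1# + a * Y) * (1# + a * Y) - (1# + 1#) * s * Y * (1# + a)
        + (1# + 1#) * s * Y * (1# + s * s) - (1# + 1# + 1# + 1#) * (s * s) * Y)
        ≈⟨ *-congˡ (+-cong (+-congˡ (*-congˡ (+-congˡ s²≈a))) (-‿cong (*-congʳ (*-congˡ s²≈a)))) ⟩
      w * ((1# + a * Y) * (1# + a * Y) - (1# + 1#) * s * Y * (1# + a)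
        + (1# + 1#) * s * Y * (1# + a) - (1# + 1# + 1# + 1#) * a * Y)
        ≈⟨ solve 4 (λ w a Y s → w :* ((:1 :+ a :* Y) :* (:1 :+ a :* Y) :- (:1 :+ :1) :* s :* Y :* (:1 :+ a)
             :+ (:1 :+ :1) :* s :* Y :* (:1 :+ a) :- (:1 :+ :1 :+ :1 :+ :1) :* a :* Y)
             ⊜ w :* ((:1 :- a :* Y) :* (:1 :- a :* Y))) refl w a Y s ⟩
      w * ((1# - a * Y) * (1# - a * Y))
        ≈⟨ *-congˡ (*-cong (+-congˡ (-‿cong aY≈y)) (+-congˡ (-‿cong aY≈y))) ⟩
      w * ((1# - y) * (1# - y)) ∎))
      (I-* (I-*ʳ (I-*ʳ I-1-y (Int-E _)) Int-ρ) (I-* I-1-y I-1-y)))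
      where
      S = Σ (suc N) Closed.c
      YS≈ : Y * S ≈ w * Closed.value
      YS≈ = *-cancelˡ 1+a≉0 (trans Closed.Σ-c (trans (*-congʳ W≈) (*-assoc _ _ _)))

    u : Carrier
    u = (1# - y) * (1# - y) * y⁻

    I-u : I 2 u
    I-u = I-*ʳ (I-* I-1-y I-1-y) (Int-E _)

    u≈ : u ≈ y + y⁻ - (1# + 1#)
    u≈ = begin
      (1# - y) * (1# - y) * y⁻
        ≈⟨ solve 2 (λ y y⁻ → (:1 :- y) :* (:1 :- y) :* y⁻ ⊜ y :* (y :* y⁻) :+ y⁻ :- (:1 :+ :1) :* (y :* y⁻)) refl y y⁻ ⟩
      y * (y * y⁻) + y⁻ - (1# + 1#) * (y * y⁻)
        ≈⟨ +-cong (+-congʳ (trans (*-congˡ yy⁻≈1) (*-identityʳ y))) (-‿cong (trans (*-congˡ yy⁻≈1) (*-identityʳ _))) ⟩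
      y + y⁻ - (1# + 1#) ∎

    -- `λ′` is the ratio of consecutive `L`. The perturbed ratio `δ` is `λ′` times (1 - fA u) / (1 -
    -- fB u), and `F` is the inverse of the last denominator, written so that its integrality can be
    -- read off.
    α β λ′ F fA fB : ℕ → Carrier
    α j  = A j ⁻¹
    β j  = B j ⁻¹
    λ′ j = A j * β j * (A j * β j) * (A j * β j * (A j * β j)) * (a⁻ * a⁻)
    F j  = B j * B j * (C⁻ j * E⁻ Y j)
    fA j = a * p ^ j * (α j * α j)
    fB j = p ^ suc j * (β j * β j)

    ℰ : ℕ → Carrier
    ℰ k = Σ k (λ j → fA j - fB j)

    1-apY≉0 : ∀ j → ¬ 1# - a * Y * p ^ suc j ≈ 0#
    1-apY≉0 = 𝓔.nonSingular-^ N

    A²-fA : ∀ j → A j * A j * (1# - fA j * u) ≈ A j * A j - a * p ^ j * u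
    A²-fA j = begin
      A j * A j * (1# - fA j * u)
        ≈⟨ solve 4 (λ A α x u → A :* A :* (:1 :- x :* (α :* α) :* u) ⊜ A :* A :- (A :* α) :* (A :* α) :* (x :* u)) refl (A j) (α j) (a * p ^ j) u ⟩
      A j * A j - A j * α j * (A j * α j) * (a * p ^ j * u)
        ≈⟨ +-congˡ (-‿cong (trans (*-congʳ (trans (*-cong (*-inverseʳ (A≉0 j)) (*-inverseʳ (A≉0 j))) (*-identityˡ 1#))) (*-identityˡ _))) ⟩
      A j * A j - a * p ^ j * u ∎

    -- The left side depends on y only through y + 1 / y = u + 2, so the unperturbed square is
    -- corrected by a multiple of u and nothing of lower order.
    quadratic : ∀ x → (1# - y * x) * (1# - y⁻ * x) ≈ (1# - x) * (1# - x) - x * u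
    quadratic x = begin
      (1# - y * x) * (1# - y⁻ * x)
        ≈⟨ solve 3 (λ y y⁻ x → (:1 :- y :* x) :* (:1 :- y⁻ :* x) ⊜ :1 :- (y :+ y⁻) :* x :+ (y :* y⁻) :* x :* x) refl y y⁻ x ⟩
      1# - (y + y⁻) * x + y * y⁻ * x * x
        ≈⟨ +-congˡ (*-congʳ (*-congʳ yy⁻≈1)) ⟩
      1# - (y + y⁻) * x + 1# * x * x
        ≈⟨ solve 3 (λ y y⁻ x → :1 :- (y :+ y⁻) :* x :+ :1 :* x :* x ⊜ (:1 :- x) :* (:1 :- x) :- x :* (y :+ y⁻ :- (:1 :+ :1))) refl y y⁻ x ⟩
      (1# - x) * (1# - x) - x * (y + y⁻ - (1# + 1#))
        ≈⟨ +-congˡ (-‿cong (*-congˡ u≈)) ⟨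
      (1# - x) * (1# - x) - x * u ∎

    -- Here e = a⁻¹ y⁻¹ and Y = a⁻¹ y. The factor a⁻² taken out for each j accounts for the power
    -- a⁻²ᵏ of the original summand.
    [e-P][Y-P] : ∀ j → (e - p ^ j) * (Y - p ^ j) ≈ a⁻ * a⁻ * (A j * A j - a * p ^ j * u)
    [e-P][Y-P] j = begin
      (e - P) * (Y - P)
        ≈⟨ *-cong (+-cong e≈ (-‿cong P≈)) (+-cong Y≈ (-‿cong P≈)) ⟩
      (a⁻ * y⁻ - a⁻ * (a * P)) * (a⁻ * y - a⁻ * (a * P))
        ≈⟨ solve 4 (λ a⁻ y y⁻ x → (a⁻ :* y⁻ :- a⁻ :* x) :* (a⁻ :* y :- a⁻ :* x)
             ⊜ a⁻ :* a⁻ :* (y :* y⁻ :- (y :+ y⁻) :* x :+ x :* x)) refl a⁻ y y⁻ (a * P) ⟩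
      a⁻ * a⁻ * (y * y⁻ - (y + y⁻) * (a * P) + a * P * (a * P))
        ≈⟨ *-congˡ (+-congʳ (+-congʳ yy⁻≈1)) ⟩
      a⁻ * a⁻ * (1# - (y + y⁻) * (a * P) + a * P * (a * P))
        ≈⟨ *-congˡ (solve 3 (λ y y⁻ x → :1 :- (y :+ y⁻) :* x :+ x :* x
             ⊜ (:1 :- x) :* (:1 :- x) :- x :* (y :+ y⁻ :- (:1 :+ :1))) refl y y⁻ (a * P)) ⟩
      a⁻ * a⁻ * (A j * A j - a * P * (y + y⁻ - (1# + 1#)))
        ≈⟨ *-congˡ (+-congˡ (-‿cong (*-congˡ u≈))) ⟨
      a⁻ * a⁻ * (A j * A j - a * P * u) ∎
      where
      P = p ^ j
      a⁻a≈1 : a⁻ * a ≈ 1#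
      a⁻a≈1 = trans (*-comm _ _) (W-inverse t)
      e≈ : e ≈ a⁻ * y⁻
      e≈ = W-+ _ _
      P≈ : P ≈ a⁻ * (a * P)
      P≈ = sym (trans (sym (*-assoc _ _ _)) (trans (*-congʳ a⁻a≈1) (*-identityˡ P)))
      Y≈ : Y ≈ a⁻ * y
      Y≈ = sym (trans (*-congˡ (sym aY≈y)) (trans (sym (*-assoc _ _ _)) (trans (*-congʳ a⁻a≈1) (*-identityˡ Y))))

    δ≈ : ∀ j → δ Y j ≈ λ′ j * (1# - fA j * u) * F j
    δ≈ j = begin
      A j * A j * (β j * β j) * ((e - p ^ j) * (Y - p ^ j) * (C⁻ j * E⁻ Y j))
        ≈⟨ *-congˡ (*-congʳ (trans ([e-P][Y-P] j) (*-congˡ (sym (A²-fA j))))) ⟩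
      A j * A j * (β j * β j) * (a⁻ * a⁻ * (A j * A j * (1# - fA j * u)) * (C⁻ j * E⁻ Y j))
        ≈⟨ trans (sym (*-identityˡ _)) (*-cong (sym (trans (*-cong (*-inverseʳ (B≉0 j)) (*-inverseʳ (B≉0 j))) (*-identityˡ 1#))) refl) ⟩
      B j * β j * (B j * β j) * (A j * A j * (β j * β j) * (a⁻ * a⁻ * (A j * A j * (1# - fA j * u)) * (C⁻ j * E⁻ Y j)))
        ≈⟨ solve 6 (λ A B β a⁻ f x → B :* β :* (B :* β) :* (A :* A :* (β :* β) :* (a⁻ :* a⁻ :* (A :* A :* f) :* x))
             ⊜ A :* β :* (A :* β) :* (A :* β :* (A :* β)) :* (a⁻ :* a⁻) :* f :* (B :* B :* x))
             refl (A j) (B j) (β j) a⁻ (1# - fA j * u) (C⁻ j * E⁻ Y j) ⟩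
      λ′ j * (1# - fA j * u) * F j ∎

    F-inverse : ∀ j → (1# - fB j * u) * F j ≈ 1#
    F-inverse j = begin
      (1# - b * (β j * β j) * u) * (B j * B j * (C⁻ j * E⁻ Y j))
        ≈⟨ solve 5 (λ b β u B x → (:1 :- b :* (β :* β) :* u) :* (B :* B :* x)
             ⊜ (B :* B :- (B :* β) :* (B :* β) :* (b :* u)) :* x) refl b (β j) u (B j) (C⁻ j * E⁻ Y j) ⟩
      (B j * B j - B j * β j * (B j * β j) * (b * u)) * (C⁻ j * E⁻ Y j)
        ≈⟨ *-congʳ (+-congˡ (-‿cong (trans (*-congʳ (trans (*-cong (*-inverseʳ (B≉0 j)) (*-inverseʳ (B≉0 j))) (*-identityˡ 1#))) (*-identityˡ _)))) ⟩
      (B j * B j - b * u) * (C⁻ j * E⁻ Y j)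
        ≈⟨ *-congʳ (quadratic b) ⟨
      (1# - y * b) * (1# - y⁻ * b) * (C⁻ j * E⁻ Y j)
        ≈⟨ *-congʳ (*-cong (+-congˡ (-‿cong (*-congʳ aY≈y))) (+-congˡ (-‿cong (*-congʳ ae≈y⁻)))) ⟨
      (1# - a * Y * b) * (1# - a * e * b) * (C⁻ j * E⁻ Y j)
        ≈⟨ solve 4 (λ x y x′ y′ → x :* y :* (y′ :* x′) ⊜ (x :* x′) :* (y :* y′)) refl (1# - a * Y * b) (1# - a * e * b) (E⁻ Y j) (C⁻ j) ⟩
      (1# - a * Y * b) * E⁻ Y j * ((1# - a * e * b) * C⁻ j)
        ≈⟨ *-cong (*-inverseʳ (1-apY≉0 j)) (*-inverseʳ (1-aep≉0 j)) ⟩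
      1# * 1# ≈⟨ *-identityˡ 1# ⟩
      1# ∎
      where b = p ^ suc j

    L-suc : ∀ k → L (suc k) ≈ L k * λ′ k
    L-suc k = begin
      r (suc k) * r (suc k) * (r (suc k) * r (suc k)) * W (ℤ.- (+ 2 ℤ.* t ℤ.* + suc k))
        ≈⟨ *-cong (*-cong (*-cong (r-suc k) (r-suc k)) (*-cong (r-suc k) (r-suc k)))
             (trans (W-cong (lemma t (+ k))) (trans (W-+ _ _) (*-congˡ (W-+ _ _)))) ⟩
      r k * x * (r k * x) * (r k * x * (r k * x)) * (W (ℤ.- (+ 2 ℤ.* t ℤ.* + k)) * (a⁻ * a⁻))
        ≈⟨ solve 4 (λ r x v a⁻ → r :* x :* (r :* x) :* (r :* x :* (r :* x)) :* (v :* (a⁻ :* a⁻))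
             ⊜ r :* r :* (r :* r) :* v :* (x :* x :* (x :* x) :* (a⁻ :* a⁻))) refl (r k) x _ a⁻ ⟩
      L k * λ′ k ∎
      where
      x = A k * β k
      lemma : ∀ t k → ℤ.- (+ 2 ℤ.* t ℤ.* (+ 1 ℤ.+ k)) ≡ ℤ.- (+ 2 ℤ.* t ℤ.* k) ℤ.+ (ℤ.- t ℤ.+ ℤ.- t)
      lemma = ℤ-Solver.solve-∀

    -- The bound is sharp for `fA`: `A N` equals 1 - y, whose inverse is not integral. Terms up to
    -- index N involve only the factors with j < N.
    module _ {j : ℕ} (j<N : j ℕ.< N) where

      1+j<n : suc j ℕ.< n
      1+j<n = ℕ.≤-<-trans j<N N<n

      Unit-Aⱼ : Unit (A j)
      Unit-Aⱼ = Unit-A 0 (ℕ.<-trans j<N N<n) (λ j≡V → ℕ.<⇒≢ j<N (≡.trans j≡V V≡N))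

      Unit-Bⱼ : Unit (B j)
      Unit-Bⱼ = Unit-B 0 1+j<n

      n∤ : ¬ + n Signed.∣ + d ℤ.* + suc j
      n∤ = m∤B 0 1+j<n

      Int-fA : Int (fA j)
      Int-fA = Int-* (Int-* (Int-W t) (Int-p^ j)) (Int-* (int⁻¹ Unit-Aⱼ) (int⁻¹ Unit-Aⱼ))

      Int-fB : Int (fB j)
      Int-fB = Int-* (Int-p^ (suc j)) (Int-* (int⁻¹ Unit-Bⱼ) (int⁻¹ Unit-Bⱼ))

      Int-F : Int (F j)
      Int-F = Int-* (Int-* (Int-B j) (Int-B j)) (Int-* (int⁻¹ C-unit) (int⁻¹ E-unit))
        where
        C-unit : Unit (1# - a * e * p ^ suc j)
        C-unit = Unit-resp (sym (1-aep≈ j)) (Unit-W (λ n∣ → n∤ (≡.subst (λ x → + n Signed.∣ x) (lemma (+ d ℤ.* + suc j) (+ n)) (Signed.∣m∣n⇒∣m+n n∣ m∣+n))))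
          where
          lemma : ∀ x n → x ℤ.- n ℤ.+ n ≡ x
          lemma = ℤ-Solver.solve-∀
        E-unit : Unit (1# - a * Y * p ^ suc j)
        E-unit = Unit-resp (+-congˡ (-‿cong (trans (W-+ _ _) (*-cong (sym aY≈y) (sym (p^ (suc j)))))))
          (Unit-W (λ n∣ → n∤ (Signed.∣m+n∣m⇒∣n n∣ m∣+n)))

      Int-λ : Int (λ′ j)
      Int-λ = Int-* (Int-* x² x²) (Int-* (Int-E _) (Int-E _))
        where
        x = Int-* (Int-A j) (int⁻¹ Unit-Bⱼ)
        x² = Int-* x x

    Int-u : Int u
    Int-u = I⇒Int I-u

    Int-ℰ : ∀ k → k ℕ.≤ N → Int (ℰ k)
    Int-ℰ k k≤N = I⇒Int (I-Σ {e = 0} k _ λ j j<k → Int⇒I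
      (Int-- (Int-fA (ℕ.<-≤-trans j<k k≤N)) (Int-fB (ℕ.<-≤-trans j<k k≤N))))

    -- The logarithmic derivative of the perturbed terms at y = 1 is - u ℰ.
    D-expansion : ∀ k → k ℕ.≤ N → I 4 (D Y k - L k * (1# - u * ℰ k))
    D-expansion zero    _     = ≈⇒I (begin
      D Y 0                                                  ≈⟨ Π-zero (δ Y) ⟩
      1#                                                     ≈⟨ solve 1 (λ u → :1 ⊜ :1 :* :1 :* (:1 :* :1) :* :1 :* (:1 :- u :* :0)) refl u ⟩
      1# * 1# * (1# * 1#) * 1# * (1# - u * 0#)
        ≈⟨ *-cong (*-cong (*-cong (*-cong r₀ r₀) (*-cong r₀ r₀)) W₀) (+-congˡ (-‿cong (*-congˡ (Σ-zero _)))) ⟨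
      L 0 * (1# - u * ℰ 0)                                   ∎)
      where
      r₀ = Π-zero (λ j → A j * B j ⁻¹)
      W₀ : W (ℤ.- (+ 2 ℤ.* t ℤ.* + 0)) ≈ 1#
      W₀ = trans (W-cong (≡.cong ℤ.-_ (ℤ.*-zeroʳ (+ 2 ℤ.* t)))) W-0
    D-expansion (suc k) k<N = I-resp (sym (begin
      D Y (suc k) - L (suc k) * (1# - u * ℰ (suc k))
        -- The unperturbed side is multiplied by (1 - fB u) F = 1, so that F is common to both
        -- sides. The new error is then the old one times an integral factor, plus a multiple of u².
        ≈⟨ +-cong (trans (Π-snoc k (δ Y)) (*-congˡ (δ≈ k))) (-‿cong (*-cong (trans (L-suc k) (trans (sym (*-identityʳ _)) (*-congˡ (sym (F-inverse k)))))
             (+-congˡ (-‿cong (*-congˡ (Σ-snoc k _)))))) ⟩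
      D Y k * (λₖ * (1# - f * u) * Fₖ) - L k * λₖ * ((1# - g * u) * Fₖ) * (1# - u * (ε + (f - g)))
        ≈⟨ solve 8 (λ D L λₖ Fₖ f g u ε →
             D :* (λₖ :* (:1 :- f :* u) :* Fₖ) :- L :* λₖ :* ((:1 :- g :* u) :* Fₖ) :* (:1 :- u :* (ε :+ (f :- g)))
             ⊜ (D :- L :* (:1 :- u :* ε)) :* (λₖ :* (:1 :- f :* u) :* Fₖ)
               :+ (u :* u) :* (L :* λₖ :* Fₖ :* (f :* ε :- g :* (ε :+ (f :- g)))))
             refl (D Y k) (L k) λₖ Fₖ f g u ε ⟩
      (D Y k - L k * (1# - u * ε)) * (λₖ * (1# - f * u) * Fₖ)
        + u * u * (L k * λₖ * Fₖ * (f * ε - g * (ε + (f - g)))) ∎))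
      (I-+ (I-*ʳ (D-expansion k (ℕ.<⇒≤ k<N)) (Int-* (Int-* λ∈ (Int-- Int-1 (Int-* f∈ Int-u))) F∈))
           (I-*ʳ (I-* I-u I-u) (Int-* (Int-* (Int-* (Int-L k) λ∈) F∈)
             (Int-- (Int-* f∈ ε∈) (Int-* g∈ (Int-+ ε∈ (Int-- f∈ g∈)))))))
      where
      λₖ = λ′ k
      Fₖ = F k
      f = fA k
      g = fB k
      ε = ℰ k
      λ∈ = Int-λ k<N
      F∈ = Int-F k<N
      f∈ = Int-fA k<N
      g∈ = Int-fB k<N
      ε∈ = Int-ℰ k (ℕ.<⇒≤ k<N)

    -- Both are values of x / (1 - x)², which is invariant under x ↦ 1 / x, and the two arguments
    -- have product a p^N = y ≡ 1.
    fA-fB : ∀ i j → suc (i ℕ.+ j) ≡ N → I 1 (fA i - fB j)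
    fA-fB i j 1+i+j≡N = I-resp (sym (begin
      x * (α i * α i) - b * (β j * β j)
        ≈⟨ +-cong (trans (sym (*-identityˡ _)) (*-congʳ (sym (trans (*-cong (*-inverseʳ (B≉0 j)) (*-inverseʳ (B≉0 j))) (*-identityˡ 1#)))))
             (-‿cong (trans (sym (*-identityˡ _)) (*-congʳ (sym (trans (*-cong (*-inverseʳ (A≉0 i)) (*-inverseʳ (A≉0 i))) (*-identityˡ 1#)))))) ⟩
      B j * β j * (B j * β j) * (x * (α i * α i)) - A i * α i * (A i * α i) * (b * (β j * β j))
        ≈⟨ solve 4 (λ x b α β → (:1 :- b) :* β :* ((:1 :- b) :* β) :* (x :* (α :* α)) :- (:1 :- x) :* α :* ((:1 :- x) :* α) :* (b :* (β :* β))
             ⊜ (:1 :- x :* b) :* ((x :- b) :* (α :* α :* (β :* β)))) refl x b (α i) (β j) ⟩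
      (1# - x * b) * ((x - b) * (α i * α i * (β j * β j)))
        ≈⟨ *-congʳ (+-congˡ (-‿cong xb≈y)) ⟩
      (1# - y) * ((x - b) * (α i * α i * (β j * β j))) ∎))
      (I-*ʳ I-1-y (Int-* (Int-- (Int-* (Int-W t) (Int-p^ i)) (Int-p^ (suc j))) (Int-* (Int-* α∈ α∈) (Int-* β∈ β∈))))
      where
      x = a * p ^ i
      b = p ^ suc j
      i<N : i ℕ.< N
      i<N = ≡.subst (i ℕ.<_) 1+i+j≡N (ℕ.s≤s (ℕ.m≤m+n i j))
      j<N : j ℕ.< N
      j<N = ≡.subst (j ℕ.<_) 1+i+j≡N (ℕ.s≤s (ℕ.m≤n+m j i))
      α∈ = int⁻¹ (Unit-Aⱼ i<N)
      β∈ = int⁻¹ (Unit-Bⱼ j<N)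
      xb≈y : x * b ≈ y
      xb≈y = begin
        a * p ^ i * p ^ suc j            ≈⟨ *-assoc _ _ _ ⟩
        a * (p ^ i * p ^ suc j)          ≈⟨ *-congˡ (^-homo-* p i (suc j)) ⟨
        a * p ^ (i ℕ.+ suc j)            ≈⟨ *-congˡ (reflexive (≡.cong (p ^_) (≡.trans (ℕ.+-suc i j) 1+i+j≡N))) ⟩
        a * Y                            ≈⟨ aY≈y ⟩
        y                                ∎

    ℰ-symmetric : ∀ i j → i ℕ.+ j ≡ N → I 1 (ℰ i - ℰ j)
    ℰ-symmetric i j i+j≡N = I-cancel Unit-2 (I-resp
      (solve 2 (λ x y → (x :- y) :- (y :- x) ⊜ (:1 :+ :1) :* (x :- y)) refl (ℰ i) (ℰ j))
      -- Sliding compares ℰ i - ℰ j with its negative, whence the division by two. One step changes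
      -- it by (fA i - fB j) + (fA j - fB i).
      (I-slide N (λ i j → ℰ i - ℰ j) slide i j i+j≡N))
      where
      slide : ∀ i j → suc (i ℕ.+ j) ≡ N → I 1 ((ℰ (suc i) - ℰ j) - (ℰ i - ℰ (suc j)))
      slide i j 1+i+j≡N = I-resp (sym (trans
        (+-cong (+-congʳ (Σ-snoc i _)) (-‿cong (+-congˡ (-‿cong (Σ-snoc j _)))))
        (solve 6 (λ x f g y f′ g′ → (x :+ (f :- g) :- y) :- (x :- (y :+ (f′ :- g′))) ⊜ (f :- g′) :+ (f′ :- g))
          refl (ℰ i) (fA i) (fB i) (ℰ j) (fA j) (fB j))))
        (I-+ (fA-fB i j 1+i+j≡N) (fA-fB j i (≡.trans (≡.cong suc (ℕ.+-comm j i)) 1+i+j≡N)))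

    cℰ-antisymmetric : ∀ i j → i ℕ.+ j ≡ N → I 1 (c i * ℰ i + c j * ℰ j)
    cℰ-antisymmetric i j i+j≡N = I-resp
      (solve 4 (λ x y e f → (x :+ y) :* e :- y :* (e :- f) ⊜ x :* e :+ y :* f) refl (c i) (c j) (ℰ i) (ℰ j))
      (I-- (I-*ʳ (Reflect.c-antisymmetric 0 i j (≡.trans i+j≡N (≡.sym V≡N)))
                 (Int-ℰ i (≡.subst (i ℕ.≤_) i+j≡N (ℕ.m≤m+n i j))))
           (I-*ˡ (Int-* (Int-weight j) (Int-L j)) (ℰ-symmetric i j i+j≡N)))

    perturbation-≡ : I 3 (Σ (suc N) c - Σ (suc N) Closed.c)
    perturbation-≡ = I-resp (sym (begin
      Σ (suc N) c - Σ (suc N) Closed.c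
        ≈⟨ Σ-- (suc N) c Closed.c ⟨
      Σ (suc N) (λ k → c k - Closed.c k)
        ≈⟨ Σ-cong (suc N) (λ k _ → solve 5 (λ ω L D u ε → ω :* L :- ω :* D
             ⊜ u :* (ω :* L :* ε) :- ω :* (D :- L :* (:1 :- u :* ε))) refl (ω k) (L k) (D Y k) u (ℰ k)) ⟩
      Σ (suc N) (λ k → u * (c k * ℰ k) - ω k * (D Y k - L k * (1# - u * ℰ k)))
        ≈⟨ trans (Σ-- (suc N) _ _) (+-congʳ (Σ-*ˡ (suc N) u _)) ⟩
      u * Σ (suc N) (λ k → c k * ℰ k) - Σ (suc N) (λ k → ω k * (D Y k - L k * (1# - u * ℰ k))) ∎))
      (I-- (I-* I-u (I-Σ-antisymmetric N _ cℰ-antisymmetric))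
           (I-Σ (suc N) _ λ { k (ℕ.s≤s k≤N) → I-*ˡ (Int-weight k) (I-weaken (D-expansion k k≤N)) }))
      where
      ω : ℕ → Carrier
      ω k = (1# - a * p ^ k * p ^ k) * ((1# - s * p ^ k) * (1# - s * p ^ k))

    cube-N : I 3 (Σ (suc N) c - R n N)
    cube-N = I-resp (solve 3 (λ x y w → (x :- y) :+ (y :- w) ⊜ x :- w) refl _ (Σ (suc N) Closed.c) _)
      (I-+ perturbation-≡ exact-≡)

    -- The summands with N < k < n lie behind the zero of the numerator in the only block and have
    -- order four.
    cube-n : I 3 (Σ n c - R n N)
    cube-n = I-resp (begin
      Σ (suc N) c - R n N + Σ (n ℕ.∸ suc N) (λ k → c (suc N ℕ.+ k))
        ≈⟨ solve 3 (λ x y w → x :- y :+ w ⊜ x :+ w :- y) refl (Σ (suc N) c) (R n N) _ ⟩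
      Σ (suc N) c + Σ (n ℕ.∸ suc N) (λ k → c (suc N ℕ.+ k)) - R n N
        ≈⟨ +-congʳ (Σ-split (suc N) (n ℕ.∸ suc N) c) ⟨
      Σ (suc N ℕ.+ (n ℕ.∸ suc N)) c - R n N
        ≈⟨ +-congʳ (reflexive (≡.cong (λ l → Σ l c) (ℕ.m+[n∸m]≡n N<n))) ⟩
      Σ n c - R n N ∎)
      (I-+ cube-N (I-Σ (n ℕ.∸ suc N) _ λ k k<n∸N → I-weaken (I-c-large 0
        (≡.subst (ℕ._< suc N ℕ.+ k) (≡.sym V≡N) (ℕ.s≤s (ℕ.m≤m+n N k)))
        (≡.subst (suc N ℕ.+ k ℕ.<_) (ℕ.m+[n∸m]≡n N<n) (ℕ.+-monoʳ-< (suc N) k<n∸N)))))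

-- Comaximal elements and cyclotomic factorisations in a commutative ring.

module Ideals (R : CommutativeRing 0ℓ 0ℓ) where

  open CommutativeRing R hiding (zero)
  open RingSolver R
  open RingFolds R
  open import Algebra.Properties.Semiring.Divisibility semiring public
  open import Algebra.Properties.Semiring.Exp semiring using (_^_; ^-homo-*; ^-assocʳ)
  open import Algebra.Properties.Semiring.Mult semiring using () renaming (_×_ to _×ᴿ_)
  open import Relation.Binary.Reasoning.Setoid setoid

  ∣-*ʳ : ∀ {x y} w → x ∣ y → x ∣ y * w
  ∣-*ʳ {x} w (q , qx≈y) = q * w , trans (solve 3 (λ q w x → q :* w :* x ⊜ q :* x :* w) refl q w x) (*-congʳ qx≈y)

  *-∣-* : ∀ {x y x′ y′} → x ∣ y → x′ ∣ y′ → x * x′ ∣ y * y′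
  *-∣-* {x} {y} {x′} {y′} (q , qx≈y) (q′ , q′x′≈y′) = q * q′ ,
    trans (solve 4 (λ q q′ x x′ → q :* q′ :* (x :* x′) ⊜ q :* x :* (q′ :* x′)) refl q q′ x x′) (*-cong qx≈y q′x′≈y′)

  ∣-- : ∀ {x y w} → x ∣ y → x ∣ w → x ∣ y - w
  ∣-- {x} (q , qx≈y) (q′ , q′x≈w) = q - q′ ,
    trans (solve 3 (λ q q′ x → (q :- q′) :* x ⊜ q :* x :- q′ :* x) refl q q′ x) (+-cong qx≈y (-‿cong q′x≈w))

  record Comaximal (x y : Carrier) : Set where
    constructor mkComaximal
    field
      λ₁ λ₂ : Carrier
      bezout : λ₁ * x + λ₂ * y ≈ 1#

  Comaximal-sym : ∀ {x y} → Comaximal x y → Comaximal y x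
  Comaximal-sym (mkComaximal a b e) = mkComaximal b a (trans (+-comm _ _) e)

  Comaximal-∣ : ∀ {x y w} → w ∣ y → Comaximal x y → Comaximal x w
  Comaximal-∣ {x} {y} {w} (q , qw≈y) (mkComaximal a b e) = mkComaximal a (b * q)
    (trans (+-congˡ (trans (*-assoc b q w) (*-congˡ qw≈y))) e)

  Comaximal-resp : ∀ {x y w} → y ≈ w → Comaximal x y → Comaximal x w
  Comaximal-resp y≈w (mkComaximal a b e) = mkComaximal a b (trans (+-congˡ (*-congˡ (sym y≈w))) e)

  Comaximal-1 : ∀ x → Comaximal x 1#
  Comaximal-1 x = mkComaximal 0# 1# (solve 1 (λ x → :0 :* x :+ :1 :* :1 ⊜ :1) refl x)

  Comaximal-* : ∀ {x y w} → Comaximal x y → Comaximal x w → Comaximal x (y * w)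
  Comaximal-* {x} {y} {w} (mkComaximal a b e) (mkComaximal a′ b′ e′) = mkComaximal (a + b * y * a′) (b * b′) (begin
    (a + b * y * a′) * x + b * b′ * (y * w)
      ≈⟨ solve 7 (λ a b a′ b′ x y w → (a :+ b :* y :* a′) :* x :+ b :* b′ :* (y :* w)
           ⊜ a :* x :+ b :* y :* (a′ :* x :+ b′ :* w)) refl a b a′ b′ x y w ⟩
    a * x + b * y * (a′ * x + b′ * w)
      ≈⟨ +-congˡ (trans (*-congˡ e′) (*-identityʳ _)) ⟩
    a * x + b * y ≈⟨ e ⟩
    1# ∎)

  Comaximal-^ : ∀ {x y} k → Comaximal x y → Comaximal x (y ^ k)
  Comaximal-^ zero    xy = Comaximal-1 _
  Comaximal-^ (suc k) xy = Comaximal-* xy (Comaximal-^ k xy)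

  Comaximal-Π : ∀ {x} n (f : ℕ → Carrier) → (∀ k → k ℕ.< n → Comaximal x (f k)) → Comaximal x (Π n f)
  Comaximal-Π zero    f c = Comaximal-resp (sym (Π-zero f)) (Comaximal-1 _)
  Comaximal-Π (suc n) f c = Comaximal-resp (sym (Π-snoc n f))
    (Comaximal-* (Comaximal-Π n f (λ k k<n → c k (ℕ.m<n⇒m<1+n k<n))) (c n (ℕ.n<1+n n)))

  Comaximal-+ : ∀ {x y w} → x ∣ w → Comaximal x y → Comaximal x (y + w)
  Comaximal-+ {x} {y} {w} (q , qx≈w) (mkComaximal a b e) = mkComaximal (a - b * q) b (begin
    (a - b * q) * x + b * (y + w)
      ≈⟨ solve 6 (λ a b q x y w → (a :- b :* q) :* x :+ b :* (y :+ w) ⊜ a :* x :+ b :* y :+ b :* (w :- q :* x)) refl a b q x y w ⟩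
    a * x + b * y + b * (w - q * x)
      ≈⟨ +-cong e (*-congˡ (trans (+-congˡ (-‿cong qx≈w)) (-‿inverseʳ w))) ⟩
    1# + b * 0# ≈⟨ trans (+-congˡ (zeroʳ b)) (+-identityʳ 1#) ⟩
    1# ∎)

  Comaximal-unit : ∀ x {y y′} → y * y′ ≈ 1# → Comaximal x y
  Comaximal-unit x {y} {y′} yy′≈1 = mkComaximal 0# y′ (trans (solve 3 (λ x y y′ → :0 :* x :+ y′ :* y ⊜ y :* y′) refl x y y′) yy′≈1)

  Comaximal⇒*-∣ : ∀ {x y w} → Comaximal x y → x ∣ w → y ∣ w → x * y ∣ w
  Comaximal⇒*-∣ {x} {y} {w} (mkComaximal a b e) (q , qx≈w) (q′ , q′y≈w) = a * q′ + b * q , (begin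
    (a * q′ + b * q) * (x * y)
      ≈⟨ solve 6 (λ a b q q′ x y → (a :* q′ :+ b :* q) :* (x :* y) ⊜ a :* x :* (q′ :* y) :+ b :* y :* (q :* x)) refl a b q q′ x y ⟩
    a * x * (q′ * y) + b * y * (q * x)
      ≈⟨ +-cong (*-congˡ q′y≈w) (*-congˡ qx≈w) ⟩
    a * x * w + b * y * w
      ≈⟨ trans (sym (distribʳ w _ _)) (trans (*-congʳ e) (*-identityˡ w)) ⟩
    w ∎)

  Π-∣-Π : ∀ n (f g : ℕ → Carrier) → (∀ k → f k ∣ g k) → Π n f ∣ Π n g
  Π-∣-Π zero    f g f∣g = ∣-respʳ (sym (Π-zero g)) (∣-respˡ (sym (Π-zero f)) ∣-refl)
  Π-∣-Π (suc n) f g f∣g = ∣-respʳ (sym (Π-snoc n g)) (∣-respˡ (sym (Π-snoc n f)) (*-∣-* (Π-∣-Π n f g f∣g) (f∣g n)))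

  Comaximal⇒Π-∣ : ∀ {w} n (f : ℕ → Carrier) → (∀ i j → i ℕ.< j → j ℕ.< n → Comaximal (f j) (f i)) →
                  (∀ k → k ℕ.< n → f k ∣ w) → Π n f ∣ w
  Comaximal⇒Π-∣ {w} zero    f c f∣w = ∣-respˡ (sym (Π-zero f)) (w , *-identityʳ w)
  Comaximal⇒Π-∣     (suc n) f c f∣w = ∣-respˡ (sym (Π-snoc n f)) (Comaximal⇒*-∣
    (Comaximal-sym (Comaximal-Π n f (λ k k<n → c k n k<n (ℕ.n<1+n n))))
    (Comaximal⇒Π-∣ n f (λ i j i<j j<n → c i j i<j (ℕ.m<n⇒m<1+n j<n)) (λ k k<n → f∣w k (ℕ.m<n⇒m<1+n k<n)))
    (f∣w n (ℕ.n<1+n n)))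

  Σ-geometric : ∀ x k → Σ k (λ i → x ^ i) * (x - 1#) ≈ x ^ k - 1#
  Σ-geometric x zero    = trans (*-congʳ (Σ-zero _)) (solve 1 (λ x → :0 :* (x :- :1) ⊜ :1 :- :1) refl x)
  Σ-geometric x (suc k) = begin
    Σ (suc k) (λ i → x ^ i) * (x - 1#)                ≈⟨ *-congʳ (Σ-snoc k _) ⟩
    (Σ k (λ i → x ^ i) + x ^ k) * (x - 1#)            ≈⟨ distribʳ _ _ _ ⟩
    Σ k (λ i → x ^ i) * (x - 1#) + x ^ k * (x - 1#)   ≈⟨ +-congʳ (Σ-geometric x k) ⟩
    x ^ k - 1# + x ^ k * (x - 1#)              ≈⟨ solve 2 (λ x y → y :- :1 :+ y :* (x :- :1) ⊜ x :* y :- :1) refl x (x ^ k) ⟩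
    x ^ suc k - 1#                             ∎

  x-1∣x^k-1 : ∀ x k → x - 1# ∣ x ^ k - 1#
  x-1∣x^k-1 x k = Σ k (λ i → x ^ i) , Σ-geometric x k

  x-1∣Σ-k : ∀ x k → x - 1# ∣ Σ k (λ i → x ^ i) - k ×ᴿ 1#
  x-1∣Σ-k x zero    = 0# , trans (zeroˡ _) (sym (trans (+-congʳ (Σ-zero _)) (-‿inverseʳ 0#)))
  x-1∣Σ-k x (suc k) with x-1∣Σ-k x k | x-1∣x^k-1 x k
  ... | q , e | q′ , e′ = q + q′ , (begin
    (q + q′) * (x - 1#)                          ≈⟨ distribʳ _ q q′ ⟩
    q * (x - 1#) + q′ * (x - 1#)                 ≈⟨ +-cong e e′ ⟩
    Σ k (λ i → x ^ i) - k ×ᴿ 1# + (x ^ k - 1#)          ≈⟨ solve 3 (λ s κ p → s :- κ :+ (p :- :1) ⊜ s :+ p :- (:1 :+ κ)) refl _ _ _ ⟩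
    Σ k (λ i → x ^ i) + x ^ k - (1# + k ×ᴿ 1#)          ≈⟨ +-congʳ (Σ-snoc k _) ⟨
    Σ (suc k) (λ i → x ^ i) - suc k ×ᴿ 1#               ∎)

  x^m-1∣x^n-1 : ∀ x {m n} → m ℕ.∣ n → x ^ m - 1# ∣ x ^ n - 1#
  x^m-1∣x^n-1 x {m} (divides k ≡.refl) = ∣-respʳ
    (+-congʳ (trans (^-assocʳ x m k) (reflexive (≡.cong (x ^_) (ℕ.*-comm m k))))) (x-1∣x^k-1 (x ^ m) k)

  -- Because xᵘᵐ = xᵈ xᵛⁿ, one has xᵈ - 1 = (xᵘᵐ - 1) - xᵈ (xᵛⁿ - 1), and the two differences are
  -- multiples of xᵐ - 1 and xⁿ - 1.
  combination : ∀ x m n u v {d} → d ℕ.+ v ℕ.* n ≡ u ℕ.* m → ∃₂ λ a b → a * (x ^ m - 1#) + b * (x ^ n - 1#) ≈ x ^ d - 1#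
  combination x m n u v {d} eq with x^m-1∣x^n-1 x {m} {u ℕ.* m} (divides u ≡.refl) | x^m-1∣x^n-1 x {n} {v ℕ.* n} (divides v ≡.refl)
  ... | q , e | q′ , e′ = q , - (x ^ d * q′) , (begin
    q * (x ^ m - 1#) + - (x ^ d * q′) * (x ^ n - 1#)
      ≈⟨ solve 4 (λ s p q y → s :+ (:- (p :* q)) :* y ⊜ s :- p :* (q :* y)) refl _ (x ^ d) q′ _ ⟩
    q * (x ^ m - 1#) - x ^ d * (q′ * (x ^ n - 1#))
      ≈⟨ +-cong e (-‿cong (*-congˡ e′)) ⟩
    x ^ (u ℕ.* m) - 1# - x ^ d * (x ^ (v ℕ.* n) - 1#)
      ≈⟨ +-congʳ (+-congʳ (trans (reflexive (≡.cong (x ^_) (≡.sym eq))) (^-homo-* x d (v ℕ.* n)))) ⟩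
    x ^ d * x ^ (v ℕ.* n) - 1# - x ^ d * (x ^ (v ℕ.* n) - 1#)
      ≈⟨ solve 2 (λ p q → p :* q :- :1 :- p :* (q :- :1) ⊜ p :- :1) refl (x ^ d) (x ^ (v ℕ.* n)) ⟩
    x ^ d - 1# ∎)

  gcd-combination : ∀ x m n → ∃₂ λ a b → a * (x ^ m - 1#) + b * (x ^ n - 1#) ≈ x ^ ℕ.gcd m n - 1#
  gcd-combination x m n with Bézout.identity (ℕ.gcd-GCD m n)
  ... | Bézout.+- u v eq = combination x m n u v eq
  ... | Bézout.-+ u v eq with combination x n m v u eq
  ...   | a , b , e = b , a , trans (+-comm _ _) e

  -- Abstract in x and Φ so as to serve twice: for x = q, where the factorisation is still to be
  -- proved by induction, and for x = q² with the substituted polynomials. The lemmas therefore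
  -- assume factorisations only up to the index at hand.
  module Cyclotomic
    (x : Carrier) (Φ : ℕ → Carrier)
    (cancel : ∀ n {y w} .{{_ : NonZero n}} → (x ^ n - 1#) * y ≈ (x ^ n - 1#) * w → y ≈ w)
    (×-inverse : ∀ k .{{_ : NonZero k}} → ∃ λ k⁻¹ → k ×ᴿ 1# * k⁻¹ ≈ 1#)
    where

    -- Has the form of the conditional in the recursive definition of the cyclotomic polynomials, so
    -- that products over `ψ` are the divisors used there.
    ψ : ℕ → ℕ → Carrier
    ψ n m = if does (m ∣? n) then Φ m else 1#

    Factors : ℕ → Set
    Factors n = x ^ n - 1# ≈ Φ n * Π n (ψ n)

    ψ-∣ : ∀ {m n} → m ℕ.∣ n → ψ n m ≈ Φ m
    ψ-∣ {m} {n} m∣n with m ∣? n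
    ... | yes _   = refl
    ... | no  m∤n = contradiction m∣n m∤n

    ψ-∤ : ∀ {m n} → ¬ m ℕ.∣ n → ψ n m ≈ 1#
    ψ-∤ {m} {n} m∤n with m ∣? n
    ... | yes m∣n = contradiction m∣n m∤n
    ... | no  _   = refl

    ψ-elim : ∀ (P : Carrier → Set) n m → (m ℕ.∣ n → P (Φ m)) → P 1# → P (ψ n m)
    ψ-elim P n m PΦ P1 with m ∣? n
    ... | yes m∣n = PΦ m∣n
    ... | no  _   = P1

    Φ∣x^n-1 : ∀ {n} → Factors n → Φ n ∣ x ^ n - 1#
    Φ∣x^n-1 {n} factors = Π n (ψ n) , trans (*-comm _ _) (sym factors)

    -- As Φ a (x^g - 1) divides x^a - 1, Φ a divides 1 + x^g + x^2g + ⋯, which is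
    -- the unit a / g modulo x^g - 1.
    comaximal-proper : ∀ {g a} .{{_ : NonZero g}} .{{_ : NonZero a}} → g ℕ.∣ a → g ℕ.< a → Factors g → Factors a →
                       Comaximal (Φ a) (x ^ g - 1#)
    comaximal-proper {g} {a} g∣a g<a fg fa = mkComaximal (w * k⁻¹) (- (v * k⁻¹)) (begin
      w * k⁻¹ * Φ a + - (v * k⁻¹) * (x ^ g - 1#)
        ≈⟨ solve 5 (λ w k⁻¹ φ v y → w :* k⁻¹ :* φ :+ (:- (v :* k⁻¹)) :* y ⊜ (φ :* w :- v :* y) :* k⁻¹) refl w k⁻¹ (Φ a) v (x ^ g - 1#) ⟩
      (Φ a * w - v * (x ^ g - 1#)) * k⁻¹
        ≈⟨ *-congʳ (+-cong Φw≈geo (-‿cong v*≈)) ⟩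
      (geo - (geo - k ×ᴿ 1#)) * k⁻¹
        ≈⟨ *-congʳ (solve 2 (λ s κ → s :- (s :- κ) ⊜ κ) refl geo (k ×ᴿ 1#)) ⟩
      k ×ᴿ 1# * k⁻¹ ≈⟨ kk⁻¹≈1 ⟩
      1# ∎)
      where
      k = ℕ._∣_.quotient g∣a
      a≡kg : a ≡ k ℕ.* g
      a≡kg = ℕ._∣_.equality g∣a
      ψ-∣-ψ : ∀ m → ψ g m ∣ ψ a m
      ψ-∣-ψ m with m ∣? g
      ... | no  m∤g = ψ a m , *-identityʳ _
      ... | yes m∣g = ∣-respʳ (sym (ψ-∣ (ℕ.∣-trans m∣g g∣a))) ∣-refl
      x^g-1∣Π : x ^ g - 1# ∣ Π a (ψ a)
      -- With index g included the product of the `ψ g` is x^g - 1 itself, and as g < a this range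
      -- is still part of the product over indices below a.
      x^g-1∣Π = ∣-trans (∣-respˡ (begin
        Π (suc g) (ψ g)         ≈⟨ Π-snoc g (ψ g) ⟩
        Π g (ψ g) * ψ g g       ≈⟨ *-congˡ (ψ-∣ ℕ.∣-refl) ⟩
        Π g (ψ g) * Φ g         ≈⟨ trans (*-comm _ _) (sym fg) ⟩
        x ^ g - 1#              ∎)
        (Π-∣-Π (suc g) (ψ g) (ψ a) ψ-∣-ψ))
        (∣-respʳ (trans (sym (Π-split (suc g) (a ℕ.∸ suc g) (ψ a))) (reflexive (≡.cong (λ l → Π l (ψ a)) (ℕ.m+[n∸m]≡n g<a))))
          (∣-*ʳ (Π (a ℕ.∸ suc g) (λ m → ψ a (suc g ℕ.+ m))) ∣-refl))
      w = _∣ʳ_.quotient x^g-1∣Π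
      w*≈Π : w * (x ^ g - 1#) ≈ Π a (ψ a)
      w*≈Π = _∣ʳ_.equality x^g-1∣Π
      k≢0 : NonZero k
      k≢0 = ℕ.≢-nonZero λ k≡0 → ℕ.≢-nonZero⁻¹ a (≡.trans a≡kg (≡.cong (ℕ._* g) k≡0))
      k⁻¹ = proj₁ (×-inverse k {{k≢0}})
      kk⁻¹≈1 : k ×ᴿ 1# * k⁻¹ ≈ 1#
      kk⁻¹≈1 = proj₂ (×-inverse k {{k≢0}})
      geo = Σ k (λ i → (x ^ g) ^ i)
      v = _∣ʳ_.quotient (x-1∣Σ-k (x ^ g) k)
      v*≈ : v * (x ^ g - 1#) ≈ geo - k ×ᴿ 1#
      v*≈ = _∣ʳ_.equality (x-1∣Σ-k (x ^ g) k)
      Φw≈geo : Φ a * w ≈ geo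
      Φw≈geo = cancel g (begin
        (x ^ g - 1#) * (Φ a * w)       ≈⟨ solve 3 (λ y φ w → y :* (φ :* w) ⊜ φ :* (w :* y)) refl (x ^ g - 1#) (Φ a) w ⟩
        Φ a * (w * (x ^ g - 1#))       ≈⟨ *-congˡ w*≈Π ⟩
        Φ a * Π a (ψ a)                ≈⟨ fa ⟨
        x ^ a - 1#                     ≈⟨ +-congʳ (trans (^-assocʳ x g k) (reflexive (≡.cong (x ^_) (≡.trans (ℕ.*-comm g k) (≡.sym a≡kg))))) ⟨
        (x ^ g) ^ k - 1#               ≈⟨ Σ-geometric (x ^ g) k ⟨
        geo * (x ^ g - 1#)             ≈⟨ *-comm _ _ ⟩
        (x ^ g - 1#) * geo             ∎)

    -- Φ m divides xᵐ - 1, so the ideal generated by Φ m and xᵏ - 1 contains x^g - 1 for g = gcd m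
    -- k. As m does not divide k, g is a proper divisor of m and `comaximal-proper` applies.
    comaximal-^-1 : ∀ {m k} .{{_ : NonZero m}} → ¬ m ℕ.∣ k → (∀ j → j ℕ.≤ m → .{{_ : NonZero j}} → Factors j) →
                    Comaximal (Φ m) (x ^ k - 1#)
    comaximal-^-1 {m} {k} m∤k factors = mkComaximal (u + v * a * q) (v * b) (begin
      (u + v * a * q) * Φ m + v * b * (x ^ k - 1#)
        ≈⟨ solve 7 (λ u v a q φ b y → (u :+ v :* a :* q) :* φ :+ v :* b :* y ⊜ u :* φ :+ v :* (a :* (q :* φ) :+ b :* y))
             refl u v a q (Φ m) b (x ^ k - 1#) ⟩
      u * Φ m + v * (a * (q * Φ m) + b * (x ^ k - 1#))
        ≈⟨ +-congˡ (*-congˡ (trans (+-congʳ (*-congˡ qΦ≈)) ab≈)) ⟩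
      u * Φ m + v * (x ^ g - 1#)
        ≈⟨ Comaximal.bezout comaximal ⟩
      1# ∎)
      where
      g = ℕ.gcd m k
      instance
        g≢0 : NonZero g
        g≢0 = ℕ.≢-nonZero (ℕ.gcd[m,n]≢0 m k (inj₁ (ℕ.≢-nonZero⁻¹ m)))
      g<m : g ℕ.< m
      g<m = ℕ.≤∧≢⇒< (ℕ.∣⇒≤ (ℕ.gcd[m,n]∣m m k)) (λ g≡m → m∤k (≡.subst (ℕ._∣ k) g≡m (ℕ.gcd[m,n]∣n m k)))
      comaximal : Comaximal (Φ m) (x ^ g - 1#)
      comaximal = comaximal-proper (ℕ.gcd[m,n]∣m m k) g<m (factors g (ℕ.<⇒≤ g<m)) (factors m ℕ.≤-refl)
      u = Comaximal.λ₁ comaximal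
      v = Comaximal.λ₂ comaximal
      a = proj₁ (gcd-combination x m k)
      b = proj₁ (proj₂ (gcd-combination x m k))
      ab≈ : a * (x ^ m - 1#) + b * (x ^ k - 1#) ≈ x ^ g - 1#
      ab≈ = proj₂ (proj₂ (gcd-combination x m k))
      q = Π m (ψ m)
      qΦ≈ : q * Φ m ≈ x ^ m - 1#
      qΦ≈ = trans (*-comm _ _) (sym (factors m ℕ.≤-refl))

    comaximal-Φ : ∀ {a b} .{{_ : NonZero a}} .{{_ : NonZero b}} → b ℕ.< a →
                  (∀ j → j ℕ.≤ a → .{{_ : NonZero j}} → Factors j) → Comaximal (Φ a) (Φ b)
    comaximal-Φ {a} {b} b<a factors = Comaximal-∣ (Φ∣x^n-1 (factors b (ℕ.<⇒≤ b<a)))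
      (comaximal-^-1 (λ a∣b → contradiction (ℕ.∣⇒≤ a∣b) (ℕ.<⇒≱ b<a)) factors)

    comaximal-ψ : ∀ {n i j} .{{_ : NonZero n}} → i ℕ.< j → (∀ k → k ℕ.≤ j → .{{_ : NonZero k}} → Factors k) →
                  Comaximal (ψ n j) (ψ n i)
    comaximal-ψ {n} {i} {j} i<j factors with j ∣? n | i ∣? n
    ... | no  _   | _       = Comaximal-sym (Comaximal-1 _)
    ... | yes _   | no  _   = Comaximal-1 _
    ... | yes _   | yes i∣n = comaximal-Φ {{ℕ.>-nonZero (ℕ.≤-<-trans ℕ.z≤n i<j)}} {{i≢0}} i<j factors
      where
      i≢0 : NonZero i
      i≢0 = ℕ.≢-nonZero λ { ≡.refl → ℕ.≢-nonZero⁻¹ n (ℕ.0∣⇒≡0 i∣n) }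

    -- Uses factorisations below n only, and so proves that the division defining Φ n is exact
    -- before anything about Φ n is known.
    Πψ∣x^n-1 : ∀ n .{{_ : NonZero n}} → (∀ j → j ℕ.< n → .{{_ : NonZero j}} → Factors j) → Π n (ψ n) ∣ x ^ n - 1#
    Πψ∣x^n-1 n factors = Comaximal⇒Π-∣ n (ψ n)
      (λ i j i<j j<n → comaximal-ψ {n} i<j (λ k k≤j → factors k (ℕ.≤-<-trans k≤j j<n)))
      ψ∣
      where
      ψ∣ : ∀ k → k ℕ.< n → ψ n k ∣ x ^ n - 1#
      ψ∣ k k<n with k ∣? n
      ... | no  _   = _ , *-identityʳ _
      ... | yes k∣n = ∣-trans (Φ∣x^n-1 (factors k k<n {{k≢0}})) (x^m-1∣x^n-1 x k∣n)
        where
        k≢0 : NonZero k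
        k≢0 = ℕ.≢-nonZero λ { ≡.refl → ℕ.≢-nonZero⁻¹ n (ℕ.0∣⇒≡0 k∣n) }

-- Local rings inside a field of fractions.

record Embedding (R : CommutativeRing 0ℓ 0ℓ) (K : Field) : Set where
  private
    module R = CommutativeRing R
    module K = Field K
  field
    ι         : R.Carrier → K.Carrier
    ι-cong    : ∀ {x y} → x R.≈ y → ι x K.≈ ι y
    ι-+       : ∀ x y → ι (x R.+ y) K.≈ ι x K.+ ι y
    ι-*       : ∀ x y → ι (x R.* y) K.≈ ι x K.* ι y
    ι-neg     : ∀ x → ι (R.- x) K.≈ K.- ι x
    ι-1       : ι R.1# K.≈ K.1#
    fraction  : ∀ f → ∃₂ λ h g → f K.* ι h K.≈ ι g

module Localisation (R : CommutativeRing 0ℓ 0ℓ) (K : Field) (emb : Embedding R K) where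

  private
    module R where
      open CommutativeRing R public
      open Exp semiring public using (_^_)
      open Mult semiring public using () renaming (_×_ to _×ᴿ_)
      open RingFolds R public
    module RS = RingSolver R

  open Ideals R
  open Field K
  open FieldProperties K
  open RingSolver commutativeRing
  open Embedding emb
  open Exp semiring using (_^_; ^-congˡ)
  open Mult semiring using () renaming (_×_ to _×ᴷ_)
  open import Relation.Binary.Reasoning.Setoid setoid

  ι-- : ∀ x y → ι (x R.- y) ≈ ι x - ι y
  ι-- x y = trans (ι-+ x (R.- y)) (+-congˡ (ι-neg y))

  ι-0 : ι R.0# ≈ 0#
  ι-0 = trans (ι-cong (R.sym (R.-‿inverseʳ R.1#))) (trans (ι-- R.1# R.1#) (-‿inverseʳ _))

  ι-^ : ∀ x k → ι (x R.^ k) ≈ ι x ^ k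
  ι-^ x zero    = ι-1
  ι-^ x (suc k) = trans (ι-* _ _) (*-congˡ (ι-^ x k))

  ι-× : ∀ k → ι (k R.×ᴿ R.1#) ≈ k ×ᴷ 1#
  ι-× zero    = ι-0
  ι-× (suc k) = trans (ι-+ _ _) (+-cong ι-1 (ι-× k))

  -- With M = 1 this is integrality at P, with M = P it is the divisibility behind a congruence.
  -- Denominators are comaximal with P rather than merely coprime, since explicit Bézout
  -- coefficients multiply and combine without a gcd theory.
  record DivisibleBy (M : R.Carrier) (P : R.Carrier) (f : Carrier) : Set where
    constructor mkDivisible
    field
      h g       : R.Carrier
      comaximal : Comaximal P h
      f*h≈Mg    : f * ι h ≈ ι (M R.* g)

  Divisible : R.Carrier → Carrier → Set
  Divisible M = DivisibleBy M M

  Divisible-1 : ∀ f → Divisible R.1# f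
  Divisible-1 f = let h , g , e = fraction f in mkDivisible h g (Comaximal-sym (Comaximal-1 h)) (trans e (ι-cong (R.sym (R.*-identityˡ g))))

  Divisible-resp : ∀ {M M′ f} → M R.≈ M′ → Divisible M f → Divisible M′ f
  Divisible-resp M≈M′ (mkDivisible h g c e) = mkDivisible h g
    (Comaximal-sym (Comaximal-resp M≈M′ (Comaximal-sym c))) (trans e (ι-cong (R.*-congʳ M≈M′)))

  -- With f h = A g and f h′ = B g′, the denominator B h + A h′ is comaximal
  -- with both A and B.
  Divisible-* : ∀ {A B f} → Comaximal A B → Divisible A f → Divisible B f → Divisible (A R.* B) f
  Divisible-* {A} {B} {f} AB (mkDivisible h g c e) (mkDivisible h′ g′ c′ e′) = mkDivisible
    (B R.* h R.+ A R.* h′) (g R.+ g′)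
    (Comaximal-sym (Comaximal-*
      (Comaximal-sym (Comaximal-+ (h′ , R.*-comm h′ A) (Comaximal-* AB c)))
      (Comaximal-sym (Comaximal-resp (R.+-comm _ _) (Comaximal-+ (h , R.*-comm h B) (Comaximal-* (Comaximal-sym AB) c′))))))
    (begin
      f * ι (B R.* h R.+ A R.* h′)
        ≈⟨ *-congˡ (trans (ι-+ _ _) (+-cong (ι-* B h) (ι-* A h′))) ⟩
      f * (ι B * ι h + ι A * ι h′)
        ≈⟨ solve 5 (λ f B h A h′ → f :* (B :* h :+ A :* h′) ⊜ B :* (f :* h) :+ A :* (f :* h′)) refl f (ι B) (ι h) (ι A) (ι h′) ⟩
      ι B * (f * ι h) + ι A * (f * ι h′)
        ≈⟨ +-cong (*-congˡ e) (*-congˡ e′) ⟩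
      ι B * ι (A R.* g) + ι A * ι (B R.* g′)
        ≈⟨ trans (ι-+ _ _) (+-cong (ι-* _ _) (ι-* _ _)) ⟨
      ι (B R.* (A R.* g) R.+ A R.* (B R.* g′))
        ≈⟨ ι-cong (RS.solve 4 (λ A B g g′ → B RS.:* (A RS.:* g) RS.:+ A RS.:* (B RS.:* g′) RS.⊜ A RS.:* B RS.:* (g RS.:+ g′)) R.refl A B g g′) ⟩
      ι (A R.* B R.* (g R.+ g′)) ∎)

  Divisible-Π : ∀ {f} n (M : ℕ → R.Carrier) → (∀ i j → i ℕ.< j → j ℕ.< n → Comaximal (M j) (M i)) →
                (∀ k → k ℕ.< n → Divisible (M k) f) → Divisible (R.Π n M) f
  Divisible-Π {f} zero    M c d = Divisible-resp (R.sym (R.Π-zero M)) (Divisible-1 f)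
  Divisible-Π     (suc n) M c d = Divisible-resp (R.sym (R.Π-snoc n M)) (Divisible-*
    (Comaximal-sym (Comaximal-Π n M (λ k k<n → c k n k<n (ℕ.n<1+n n))))
    (Divisible-Π n M (λ i j i<j j<n → c i j i<j (ℕ.m<n⇒m<1+n j<n)) (λ k k<n → d k (ℕ.m<n⇒m<1+n k<n)))
    (d n (ℕ.n<1+n n)))

  module AtFactor
    (X : Exponential K) (x : R.Carrier) (E≈ : ∀ k → Exponential.E X (+ k) ≈ ι (x R.^ k))
    (×-inverse : ∀ k .{{_ : NonZero k}} → ∃ λ k⁻¹ → k R.×ᴿ R.1# R.* k⁻¹ R.≈ R.1#)
    {m : ℕ} .{{m≢0 : NonZero m}} (P : R.Carrier)
    (P∣ : P ∣ (x R.* x) R.^ m R.- R.1#)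
    (P-comaximal : ∀ k → ¬ m ℕ.∣ k → Comaximal P ((x R.* x) R.^ k R.- R.1#))
    where

    open Exponential X

    y : R.Carrier
    y = x R.* x

    Int : Carrier → Set
    Int = DivisibleBy R.1# P

    W≈ : ∀ k → W (+ k) ≈ ι (y R.^ k)
    W≈ zero    = trans E-0 (sym ι-1)
    W≈ (suc k) = begin
      E (+ 2 ℤ.* + suc k)             ≡⟨ ≡.cong E (ℤ.*-suc (+ 2) (+ k)) ⟩
      E (+ 2 ℤ.+ + 2 ℤ.* + k)         ≈⟨ E-+ (+ 2) _ ⟩
      E (+ 2) * W (+ k)               ≈⟨ *-cong (trans (E≈ 2) (ι-cong (R.*-congˡ (R.*-identityʳ x)))) (W≈ k) ⟩
      ι y * ι (y R.^ k)               ≈⟨ ι-* _ _ ⟨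
      ι (y R.^ suc k)                 ∎

    1-W≈ : ∀ k → 1# - W (+ k) ≈ ι (R.1# R.- y R.^ k)
    1-W≈ k = trans (+-cong (sym ι-1) (-‿cong (W≈ k))) (sym (ι-- _ _))

    P∣1-y^m : P ∣ R.1# R.- y R.^ m
    P∣1-y^m = let q , e = P∣ in R.- q , R.trans
      (RS.solve 2 (λ q P → (RS.:- q) RS.:* P RS.⊜ RS.:- (q RS.:* P)) R.refl q P)
      (R.trans (R.-‿cong e) (RS.solve 1 (λ y → RS.:- (y RS.:- RS.:1) RS.⊜ RS.:1 RS.:- y) R.refl (y R.^ m)))

    int : ∀ {f} h g → Comaximal P h → f * ι h ≈ ι g → Int f
    int h g c e = mkDivisible h g c (trans e (ι-cong (R.sym (R.*-identityˡ g))))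

    int-ι : ∀ {f} g → f ≈ ι g → Int f
    int-ι g f≈ιg = int R.1# g (Comaximal-1 P) (trans (*-congˡ ι-1) (trans (*-identityʳ _) f≈ιg))

    numerator : ∀ {f} (f∈ : Int f) → f * ι (DivisibleBy.h f∈) ≈ ι (DivisibleBy.g f∈)
    numerator f∈ = trans (DivisibleBy.f*h≈Mg f∈) (ι-cong (R.*-identityˡ _))

    Int-resp : ∀ {f f′} → f ≈ f′ → Int f → Int f′
    Int-resp f≈f′ (mkDivisible h g c e) = mkDivisible h g c (trans (*-congʳ (sym f≈f′)) e)

    Int-* : ∀ {f f′} → Int f → Int f′ → Int (f * f′)
    Int-* {f} {f′} f∈@(mkDivisible h g c _) f′∈@(mkDivisible h′ g′ c′ _) = int (h R.* h′) (g R.* g′) (Comaximal-* c c′) (begin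
      f * f′ * ι (h R.* h′)       ≈⟨ *-congˡ (ι-* h h′) ⟩
      f * f′ * (ι h * ι h′)       ≈⟨ solve 4 (λ f f′ h h′ → f :* f′ :* (h :* h′) ⊜ f :* h :* (f′ :* h′)) refl f f′ (ι h) (ι h′) ⟩
      f * ι h * (f′ * ι h′)       ≈⟨ *-cong (numerator f∈) (numerator f′∈) ⟩
      ι g * ι g′                  ≈⟨ ι-* g g′ ⟨
      ι (g R.* g′)                ∎)

    Int-+ : ∀ {f f′} → Int f → Int f′ → Int (f + f′)
    Int-+ {f} {f′} f∈@(mkDivisible h g c _) f′∈@(mkDivisible h′ g′ c′ _) =
      int (h R.* h′) (g R.* h′ R.+ g′ R.* h) (Comaximal-* c c′) (begin
      (f + f′) * ι (h R.* h′)               ≈⟨ *-congˡ (ι-* h h′) ⟩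
      (f + f′) * (ι h * ι h′)
        ≈⟨ solve 4 (λ f f′ h h′ → (f :+ f′) :* (h :* h′) ⊜ f :* h :* h′ :+ f′ :* h′ :* h) refl f f′ (ι h) (ι h′) ⟩
      f * ι h * ι h′ + f′ * ι h′ * ι h      ≈⟨ +-cong (*-congʳ (numerator f∈)) (*-congʳ (numerator f′∈)) ⟩
      ι g * ι h′ + ι g′ * ι h               ≈⟨ trans (ι-+ _ _) (+-cong (ι-* g h′) (ι-* g′ h)) ⟨
      ι (g R.* h′ R.+ g′ R.* h)             ∎)

    Int-neg : ∀ {f} → Int f → Int (- f)
    Int-neg {f} f∈@(mkDivisible h g c _) = int h (R.- g) c (begin
      - f * ι h     ≈⟨ solve 2 (λ f h → (:- f) :* h ⊜ :- (f :* h)) refl f (ι h) ⟩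
      - (f * ι h)   ≈⟨ -‿cong (numerator f∈) ⟩
      - ι g         ≈⟨ ι-neg g ⟨
      ι (R.- g)     ∎)

    -- For m > 0, P divides x²ᵐ - 1, so x is invertible modulo P with inverse x²ᵐ⁻¹. This makes the
    -- negative powers of q integral.
    comaximal-x : Comaximal P x
    comaximal-x = by-cases m m≢0 P∣
      where
      by-cases : ∀ m → .(NonZero m) → P ∣ y R.^ m R.- R.1# → Comaximal P x
      by-cases (suc m) _ (q , e) = mkComaximal (R.- q) (x R.* y R.^ m) (R.trans
        (RS.solve 4 (λ q P x w → (RS.:- q) RS.:* P RS.:+ x RS.:* w RS.:* x
          RS.⊜ RS.:1 RS.:+ ((x RS.:* x RS.:* w RS.:- RS.:1) RS.:- q RS.:* P)) R.refl q P x (y R.^ m))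
        (R.trans (R.+-congˡ (R.trans (R.+-congˡ (R.-‿cong e)) (R.-‿inverseʳ _))) (R.+-identityʳ _)))

    Int-E : ∀ i → Int (E i)
    Int-E (+ k)    = int-ι (x R.^ k) (E≈ k)
    Int-E -[1+ k ] = int (x R.^ suc k) R.1# (Comaximal-^ (suc k) comaximal-x) (begin
      E -[1+ k ] * ι (x R.^ suc k)     ≈⟨ *-congˡ (E≈ (suc k)) ⟨
      E -[1+ k ] * E (+ suc k)         ≈⟨ E-+ -[1+ k ] (+ suc k) ⟨
      E (-[1+ k ] ℤ.+ + suc k)         ≡⟨ ≡.cong E (ℤ.+-inverseˡ (+ suc k)) ⟩
      E (+ 0)                          ≈⟨ trans E-0 (sym ι-1) ⟩
      ι R.1#                           ∎)

    Int-W⁻¹ : ∀ {i} → ¬ (+ m Signed.∣ i) → Int ((1# - W i) ⁻¹)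
    Int-W⁻¹ {+ k} m∤k = int (R.1# R.- y R.^ k) R.1# comaximal (begin
      (1# - W (+ k)) ⁻¹ * ι (R.1# R.- y R.^ k)     ≈⟨ *-congˡ (1-W≈ k) ⟨
      (1# - W (+ k)) ⁻¹ * (1# - W (+ k))           ≈⟨ trans (*-comm _ _) (*-inverseʳ (1-W≉0 {+ k} λ { ≡.refl → m∤k (Signed.divides (+ 0) ≡.refl) })) ⟩
      1#                                           ≈⟨ ι-1 ⟨
      ι R.1#                                       ∎)
      where
      comaximal : Comaximal P (R.1# R.- y R.^ k)
      comaximal = Comaximal-∣ (R.- R.1# , RS.solve 1 (λ y → (RS.:- RS.:1) RS.:* (RS.:1 RS.:- y) RS.⊜ y RS.:- RS.:1) R.refl (y R.^ k))
        (P-comaximal k (λ m∣k → m∤k (Signed.∣ᵤ⇒∣ m∣k)))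
    Int-W⁻¹ { -[1+ k ]} m∤i = Int-resp (sym (⁻¹-unique (1-W≉0 { -[1+ k ]} λ ()) (begin
      (1# - W⁻) * (- Wₖ * (1# - Wₖ) ⁻¹)
        ≈⟨ solve 3 (λ v w i → (:1 :- v) :* ((:- w) :* i) ⊜ (v :* w :- w) :* i) refl W⁻ Wₖ ((1# - Wₖ) ⁻¹) ⟩
      (W⁻ * Wₖ - Wₖ) * (1# - Wₖ) ⁻¹
        ≈⟨ *-congʳ (+-congʳ W⁻W≈1) ⟩
      (1# - Wₖ) * (1# - Wₖ) ⁻¹
        ≈⟨ *-inverseʳ (1-W≉0 {+ suc k} λ ()) ⟩
      1# ∎)))
      (Int-* (Int-neg (Int-E _)) (Int-W⁻¹ {+ suc k} (λ m∣ → m∤i (Signed.∣m⇒∣-m m∣))))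
      where
      W⁻ = W -[1+ k ]
      Wₖ = W (+ suc k)
      W⁻W≈1 : W⁻ * Wₖ ≈ 1#
      W⁻W≈1 = trans (sym (W-+ -[1+ k ] (+ suc k))) (trans (reflexive (≡.cong W (ℤ.+-inverseˡ (+ suc k)))) E-0)

    -- If g has denominator h, then f h is congruent modulo P to (k + 1) h, because P divides 1 -
    -- yᵐ. Both factors are comaximal with P, so this numerator may become a denominator.
    Int-⁻¹ : ∀ k {f g} → Int g → f ≈ suc k ×ᴷ 1# + (1# - W (+ m)) * g → ¬ f ≈ 0# → Int (f ⁻¹)
    Int-⁻¹ k {f} {f′} f′∈@(mkDivisible h g c _) f≈ f≉0 = int h′ h
      (Comaximal-+ (∣-*ʳ g P∣1-y^m) (Comaximal-* (let k⁻¹ , e = ×-inverse (suc k) in Comaximal-unit P e) c)) (begin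
      f ⁻¹ * ι h′                    ≈⟨ *-congˡ f*h ⟨
      f ⁻¹ * (f * ι h)               ≈⟨ *-assoc _ _ _ ⟨
      f ⁻¹ * f * ι h                 ≈⟨ *-congʳ (trans (*-comm _ _) (*-inverseʳ f≉0)) ⟩
      1# * ι h                       ≈⟨ *-identityˡ _ ⟩
      ι h                            ∎)
      where
      κ = suc k R.×ᴿ R.1#
      h′ = κ R.* h R.+ (R.1# R.- y R.^ m) R.* g
      f*h : f * ι h ≈ ι h′
      f*h = begin
        f * ι h                                                ≈⟨ *-congʳ f≈ ⟩
        (suc k ×ᴷ 1# + (1# - W (+ m)) * f′) * ι h
          ≈⟨ solve 4 (λ κ z f h → (κ :+ z :* f) :* h ⊜ κ :* h :+ z :* (f :* h)) refl (suc k ×ᴷ 1#) (1# - W (+ m)) f′ (ι h) ⟩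
        suc k ×ᴷ 1# * ι h + (1# - W (+ m)) * (f′ * ι h)
          ≈⟨ +-cong (*-congʳ (sym (ι-× (suc k)))) (*-cong (1-W≈ m) (numerator f′∈)) ⟩
        ι κ * ι h + ι (R.1# R.- y R.^ m) * ι g
          ≈⟨ trans (ι-+ _ _) (+-cong (ι-* _ _) (ι-* _ _)) ⟨
        ι h′ ∎

    place : Place K X m
    place = record
      { Int      = Int
      ; Int-resp = Int-resp
      ; Int-+    = Int-+
      ; Int-*    = Int-*
      ; Int-neg  = Int-neg
      ; Int-1    = int-ι R.1# (sym ι-1)
      ; Int-E    = Int-E
      ; Int-W⁻¹  = Int-W⁻¹
      ; Int-⁻¹   = Int-⁻¹
      }

    -- P divides 1 - yᵐ, so zᵉ is a multiple of Pᵉ; the power of the cofactor joins the numerator.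
    I⇒Divisible : ∀ {f} e → PlaceProperties.I K X place e f → Divisible (P R.^ e) f
    I⇒Divisible {f} e (PlaceProperties.mkI f′ f′∈@(mkDivisible h g c _) f≈) = mkDivisible h (q R.^ e R.* g)
      (Comaximal-sym (Comaximal-^ e (Comaximal-sym c))) (begin
        f * ι h                                    ≈⟨ *-congʳ f≈ ⟩
        (1# - W (+ m)) ^ e * f′ * ι h              ≈⟨ *-assoc _ _ _ ⟩
        (1# - W (+ m)) ^ e * (f′ * ι h)            ≈⟨ *-cong (^-congˡ e (trans (1-W≈ m) (ι-cong (R.sym qP≈)))) (numerator f′∈) ⟩
        ι (q R.* P) ^ e * ι g                      ≈⟨ *-congʳ (ι-^ _ e) ⟨
        ι ((q R.* P) R.^ e) * ι g                  ≈⟨ ι-* _ _ ⟨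
        ι ((q R.* P) R.^ e R.* g)                  ≈⟨ ι-cong (R.trans (R.*-congʳ (^-distrib e)) (RS.solve 3 (λ a b g → a RS.:* b RS.:* g RS.⊜ b RS.:* (a RS.:* g)) R.refl (q R.^ e) (P R.^ e) g)) ⟩
        ι (P R.^ e R.* (q R.^ e R.* g))            ∎)
      where
      q = _∣ʳ_.quotient P∣1-y^m
      qP≈ : q R.* P R.≈ R.1# R.- y R.^ m
      qP≈ = _∣ʳ_.equality P∣1-y^m
      ^-distrib : ∀ e → (q R.* P) R.^ e R.≈ q R.^ e R.* P R.^ e
      ^-distrib zero    = R.sym (R.*-identityˡ _)
      ^-distrib (suc e) = R.trans (R.*-congˡ (^-distrib e))
        (RS.solve 4 (λ q P a b → q RS.:* P RS.:* (a RS.:* b) RS.⊜ q RS.:* a RS.:* (P RS.:* b)) R.refl q P (q R.^ e) (P R.^ e))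

-- Integer powers of an element that is neither zero nor a root of unity.

module Powers (K : Field) (x : Field.Carrier K) where

  open Field K
  open FieldProperties K
  open RingSolver commutativeRing
  open import Algebra.Properties.Semiring.Exp semiring using (_^_; ^-homo-*)
  open import Relation.Binary.Reasoning.Setoid setoid

  power : ℤ → Carrier
  power (+ n)    = x ^ n
  power -[1+ n ] = (x ^ suc n) ⁻¹

  module _ (x≉0 : ¬ x ≈ 0#) (1-x^≉0 : ∀ k → ¬ 1# - x ^ suc k ≈ 0#) where

    x^≉0 : ∀ n → ¬ x ^ n ≈ 0#
    x^≉0 zero    = 1≉0
    x^≉0 (suc n) = *-≉0 x≉0 (x^≉0 n)

    private
      reciprocal : ∀ n → (x ^ n) ⁻¹ * x ^ n ≈ 1#
      reciprocal n = trans (*-comm _ _) (*-inverseʳ (x^≉0 n))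

      reciprocal-suc : ∀ n → (x ^ suc n) ⁻¹ ≈ x ⁻¹ * (x ^ n) ⁻¹
      reciprocal-suc n = ⁻¹-unique (x^≉0 (suc n)) (begin
        x * x ^ n * (x ⁻¹ * (x ^ n) ⁻¹)       ≈⟨ solve 4 (λ x y x′ y′ → x :* y :* (x′ :* y′) ⊜ x :* x′ :* (y :* y′)) refl x (x ^ n) (x ⁻¹) ((x ^ n) ⁻¹) ⟩
        x * x ⁻¹ * (x ^ n * (x ^ n) ⁻¹)       ≈⟨ *-cong (*-inverseʳ x≉0) (*-inverseʳ (x^≉0 n)) ⟩
        1# * 1#                               ≈⟨ *-identityˡ 1# ⟩
        1#                                    ∎)

      power-⊖ : ∀ m n → power (m ℤ.⊖ n) ≈ x ^ m * (x ^ n) ⁻¹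
      power-⊖ m       zero    = sym (trans (*-congˡ (⁻¹-unique 1≉0 (*-identityˡ 1#))) (*-identityʳ _))
      power-⊖ zero    (suc n) = sym (*-identityˡ _)
      power-⊖ (suc m) (suc n) = begin
        power (suc m ℤ.⊖ suc n)                 ≡⟨ ≡.cong power (ℤ.[1+m]⊖[1+n]≡m⊖n m n) ⟩
        power (m ℤ.⊖ n)                         ≈⟨ power-⊖ m n ⟩
        x ^ m * (x ^ n) ⁻¹                      ≈⟨ *-identityˡ _ ⟨
        1# * (x ^ m * (x ^ n) ⁻¹)               ≈⟨ *-congʳ (*-inverseʳ x≉0) ⟨
        x * x ⁻¹ * (x ^ m * (x ^ n) ⁻¹)         ≈⟨ solve 4 (λ x x′ y y′ → x :* x′ :* (y :* y′) ⊜ x :* y :* (x′ :* y′)) refl x (x ⁻¹) (x ^ m) ((x ^ n) ⁻¹) ⟩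
        x * x ^ m * (x ⁻¹ * (x ^ n) ⁻¹)         ≈⟨ *-congˡ (reciprocal-suc n) ⟨
        x * x ^ m * (x ^ suc n) ⁻¹              ∎

      power-+ : ∀ i j → power (i ℤ.+ j) ≈ power i * power j
      power-+ (+ m)    (+ n)    = ^-homo-* x m n
      power-+ (+ m)    -[1+ n ] = power-⊖ m (suc n)
      power-+ -[1+ m ] (+ n)    = trans (power-⊖ n (suc m)) (*-comm _ _)
      power-+ -[1+ m ] -[1+ n ] = ⁻¹-unique (x^≉0 (suc (suc (m ℕ.+ n)))) (begin
        x ^ suc (suc (m ℕ.+ n)) * ((x ^ suc m) ⁻¹ * (x ^ suc n) ⁻¹)
          ≈⟨ *-congʳ (trans (reflexive (≡.cong (λ k → x ^ suc k) (≡.sym (ℕ.+-suc m n)))) (^-homo-* x (suc m) (suc n))) ⟩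
        x ^ suc m * x ^ suc n * ((x ^ suc m) ⁻¹ * (x ^ suc n) ⁻¹)
          ≈⟨ solve 4 (λ x y x′ y′ → x :* y :* (x′ :* y′) ⊜ x′ :* x :* (y′ :* y)) refl (x ^ suc m) (x ^ suc n) _ _ ⟩
        (x ^ suc m) ⁻¹ * x ^ suc m * ((x ^ suc n) ⁻¹ * x ^ suc n)
          ≈⟨ *-cong (reciprocal (suc m)) (reciprocal (suc n)) ⟩
        1# * 1# ≈⟨ *-identityˡ 1# ⟩
        1# ∎)

      1-power≉0 : ∀ {i} → ¬ i ≡ + 0 → ¬ 1# - power i ≈ 0#
      1-power≉0 {+ zero}   i≢0 = contradiction ≡.refl i≢0
      1-power≉0 {+ suc n}  i≢0 = 1-x^≉0 n
      1-power≉0 { -[1+ n ]} i≢0 eq = 1-x^≉0 n (begin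
        1# - x ^ suc n                                   ≈⟨ +-congʳ (reciprocal (suc n)) ⟨
        (x ^ suc n) ⁻¹ * x ^ suc n - x ^ suc n           ≈⟨ solve 2 (λ x y → x :* y :- y ⊜ (:- y) :* (:1 :- x)) refl _ (x ^ suc n) ⟩
        - (x ^ suc n) * (1# - (x ^ suc n) ⁻¹)            ≈⟨ *-congˡ eq ⟩
        - (x ^ suc n) * 0#                               ≈⟨ zeroʳ _ ⟩
        0#                                               ∎)

    exponential : Exponential K
    exponential = record { E = power ; E-0 = refl ; E-+ = power-+ ; 1-E≉0 = 1-power≉0 }

-- From the stated summands and right-hand side to `c` and `R`.

module Terms
  (K : Field) (x : Field.Carrier K)
  (X : Exponential K) (E≡^ : ∀ k → Exponential.E X (+ k) ≡ Exp._^_ (Field.semiring K) x k)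
  (n d N : ℕ) .{{_ : ℕ.NonZero d}} (t : ℤ)
  (n≡t+dN : + n ≡ t ℤ.+ + d ℤ.* + N)
  (t+dj≢0 : ∀ j → ¬ t ℤ.+ + d ℤ.* + j ≡ + 0)
  where

  open Field K
  open Exponential X
  open Exp semiring using (_^_; ^-congˡ)
  open FieldProperties K
  open RingSolver commutativeRing
  open RingFolds commutativeRing
  open import Relation.Binary.Reasoning.Setoid setoid
  open import Algebra.Definitions.RawSemiring (Semiring.rawSemiring semiring) using (product; sum)

  open Progression K X n d N t n≡t+dN t+dj≢0

  poch : Carrier → Carrier → ℕ → Carrier
  poch u v k = product {k} (λ j → 1# - u * v ^ toℕ j)

  bracket bracket² : ℤ → Carrier
  bracket i  = (1# - E i) * (1# - x) ⁻¹
  bracket² i = (1# - W i) * (1# - x ^ 2) ⁻¹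

  term : ℕ → Carrier
  term k = bracket² (+ 2 ℤ.* + d ℤ.* + k ℤ.+ t) * bracket (+ 2 ℤ.* + d ℤ.* + k ℤ.+ t) ^ 2
         * (poch (W t) (x ^ (2 ℕ.* d)) k ^ 4 * (poch (x ^ (2 ℕ.* d)) (x ^ (2 ℕ.* d)) k ^ 4) ⁻¹)
         * E (ℤ.- (+ 4 ℤ.* t ℤ.* + k))

  rhs : Carrier
  rhs = (- (1# + 1#) * bracket t ^ 2 * bracket² (+ n) * poch (E (+ 4 ℤ.* t)) (x ^ (2 ℕ.* d)) N)
      * ((1# + W t) * poch (x ^ (2 ℕ.* d)) (x ^ (2 ℕ.* d)) N) ⁻¹
      * E (t ℤ.- + 2 ℤ.* t ℤ.* + N)

  κ : Carrier
  κ = (1# - x ^ 2) ⁻¹ * ((1# - x) ⁻¹ * (1# - x) ⁻¹)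

  x^2d≈p : x ^ (2 ℕ.* d) ≈ p
  x^2d≈p = reflexive (≡.trans (≡.sym (E≡^ (2 ℕ.* d))) (≡.cong E (ℤ.pos-* 2 d)))

  ⁻¹-cong : ∀ {u v} → ¬ u ≈ 0# → u ≈ v → u ⁻¹ ≈ v ⁻¹
  ⁻¹-cong u≉0 u≈v = ⁻¹-unique u≉0 (trans (*-congʳ u≈v) (*-inverseʳ (≉0-resp u≈v u≉0)))

  poch≈Π : ∀ {u} k → poch u (x ^ (2 ℕ.* d)) k ≈ Π k (λ j → 1# - u * p ^ j)
  poch≈Π {u} k = trans (reflexive (≡.sym (Π≡product k (λ j → 1# - u * (x ^ (2 ℕ.* d)) ^ j))))
    (Π-cong k (λ j _ → +-congˡ (-‿cong (*-congˡ (^-congˡ j x^2d≈p)))))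

  poch-B≈ : ∀ k → poch (x ^ (2 ℕ.* d)) (x ^ (2 ℕ.* d)) k ≈ Π k B
  poch-B≈ k = trans (poch≈Π k) (Π-cong k (λ j _ → +-congˡ (-‿cong (*-congʳ x^2d≈p))))

  r*ΠB : ∀ k → r k * Π k B ≈ Π k A
  r*ΠB k = trans (sym (Π-* k _ B)) (Π-cong k λ j _ → begin
    A j * B j ⁻¹ * B j     ≈⟨ solve 3 (λ a b b′ → a :* b′ :* b ⊜ a :* (b :* b′)) refl (A j) (B j) (B j ⁻¹) ⟩
    A j * (B j * B j ⁻¹)   ≈⟨ trans (*-congˡ (*-inverseʳ (B≉0 j))) (*-identityʳ _) ⟩
    A j                    ∎)

  ratio≈r⁴ : ∀ k → poch a (x ^ (2 ℕ.* d)) k ^ 4 * (poch (x ^ (2 ℕ.* d)) (x ^ (2 ℕ.* d)) k ^ 4) ⁻¹ ≈ r k * r k * (r k * r k)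
  ratio≈r⁴ k = begin
    poch a (x ^ (2 ℕ.* d)) k ^ 4 * (poch (x ^ (2 ℕ.* d)) (x ^ (2 ℕ.* d)) k ^ 4) ⁻¹
      ≈⟨ *-cong (^-congˡ 4 (trans (poch≈Π k) (sym (r*ΠB k)))) (sym (⁻¹-cong b⁴≉0 (sym (^-congˡ 4 (poch-B≈ k))))) ⟩
    (r k * b) ^ 4 * (b ^ 4) ⁻¹
      ≈⟨ solve 3 (λ r b i → r :* b :* (r :* b :* (r :* b :* (r :* b :* :1))) :* i
           ⊜ r :* r :* (r :* r) :* (b :* (b :* (b :* (b :* :1))) :* i)) refl (r k) b ((b ^ 4) ⁻¹) ⟩
    r k * r k * (r k * r k) * (b ^ 4 * (b ^ 4) ⁻¹)
      ≈⟨ trans (*-congˡ (*-inverseʳ b⁴≉0)) (*-identityʳ _) ⟩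
    r k * r k * (r k * r k) ∎
    where
    b = Π k B
    b⁴≉0 : ¬ b ^ 4 ≈ 0#
    b⁴≉0 = *-≉0 (ΠB≉0 k) (*-≉0 (ΠB≉0 k) (*-≉0 (ΠB≉0 k) (*-≉0 (ΠB≉0 k) 1≉0)))

  term≈κc : ∀ k → term k ≈ κ * c k
  term≈κc k = begin
    (1# - W i) * i₂ * ((1# - E i) * i₁ * ((1# - E i) * i₁ * 1#)) * _ * E (ℤ.- (+ 4 ℤ.* t ℤ.* + k))
      ≈⟨ *-cong (*-cong (*-cong (*-congʳ (+-congˡ (-‿cong Wi≈))) (*-cong (*-congʳ 1-Ei≈) (*-congʳ (*-congʳ 1-Ei≈)))) (ratio≈r⁴ k)) (reflexive (≡.cong E (lemma₃ t (+ k)))) ⟩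
    (1# - a * P * P) * i₂ * ((1# - s * P) * i₁ * ((1# - s * P) * i₁ * 1#)) * (r k * r k * (r k * r k)) * W (ℤ.- (+ 2 ℤ.* t ℤ.* + k))
      ≈⟨ solve 6 (λ u v i₁ i₂ ρ ω → u :* i₂ :* (v :* i₁ :* (v :* i₁ :* :1)) :* ρ :* ω ⊜ i₂ :* (i₁ :* i₁) :* (u :* (v :* v) :* (ρ :* ω)))
           refl (1# - a * P * P) (1# - s * P) i₁ i₂ _ _ ⟩
    κ * c k ∎
    where
    i = + 2 ℤ.* + d ℤ.* + k ℤ.+ t
    2dk = + 2 ℤ.* (+ d ℤ.* + k)
    P = p ^ k
    i₁ = (1# - x) ⁻¹
    i₂ = (1# - x ^ 2) ⁻¹
    lemma₁ : ∀ t d k → + 2 ℤ.* (+ 2 ℤ.* d ℤ.* k ℤ.+ t) ≡ + 2 ℤ.* t ℤ.+ + 2 ℤ.* (d ℤ.* k) ℤ.+ + 2 ℤ.* (d ℤ.* k)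
    lemma₁ = ℤ-Solver.solve-∀
    lemma₂ : ∀ t d k → + 2 ℤ.* d ℤ.* k ℤ.+ t ≡ t ℤ.+ + 2 ℤ.* (d ℤ.* k)
    lemma₂ = ℤ-Solver.solve-∀
    lemma₃ : ∀ t k → ℤ.- (+ 4 ℤ.* t ℤ.* k) ≡ + 2 ℤ.* (ℤ.- (+ 2 ℤ.* t ℤ.* k))
    lemma₃ = ℤ-Solver.solve-∀
    Wi≈ : W i ≈ a * P * P
    Wi≈ = trans (reflexive (≡.cong E (lemma₁ t (+ d) (+ k)))) (trans (E-+ (+ 2 ℤ.* t ℤ.+ 2dk) 2dk) (*-cong (trans (E-+ (+ 2 ℤ.* t) 2dk) (*-congˡ (sym (p^ k)))) (sym (p^ k))))
    1-Ei≈ : 1# - E i ≈ 1# - s * P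
    1-Ei≈ = +-congˡ (-‿cong (trans (reflexive (≡.cong E (lemma₂ t (+ d) (+ k)))) (trans (E-+ t 2dk) (*-congˡ (sym (p^ k))))))

  rhs≈κR : rhs ≈ κ * R n N
  rhs≈κR = begin
    (- (1# + 1#) * ((1# - s) * i₁ * ((1# - s) * i₁ * 1#)) * ((1# - W (+ n)) * i₂) * poch (E (+ 4 ℤ.* t)) (x ^ (2 ℕ.* d)) N)
      * ((1# + a) * poch (x ^ (2 ℕ.* d)) (x ^ (2 ℕ.* d)) N) ⁻¹ * E (t ℤ.- + 2 ℤ.* t ℤ.* + N)
      ≈⟨ *-cong (*-cong (*-congˡ numerator) (sym (⁻¹-cong (*-≉0 1+a≉0 (ΠB≉0 N)) (*-congˡ (sym (poch-B≈ N)))))) exponent ⟩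
    (- (1# + 1#) * ((1# - s) * i₁ * ((1# - s) * i₁ * 1#)) * ((1# - W (+ n)) * i₂) * Π N C) * ((1# + a) * Π N B) ⁻¹ * (s * W (ℤ.- (t ℤ.* + N)))
      ≈⟨ solve 7 (λ s y i₁ i₂ c b ω → ((:- (:1 :+ :1)) :* ((:1 :- s) :* i₁ :* ((:1 :- s) :* i₁ :* :1)) :* ((:1 :- y) :* i₂) :* c) :* b :* (s :* ω)
           ⊜ i₂ :* (i₁ :* i₁) :* ((:- (:1 :+ :1)) :* s :* ((:1 :- s) :* (:1 :- s)) :* ((:1 :- y) :* ω :* (c :* b))))
           refl s (W (+ n)) i₁ i₂ (Π N C) _ _ ⟩
    κ * R n N ∎
    where
    i₁ = (1# - x) ⁻¹
    i₂ = (1# - x ^ 2) ⁻¹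
    lemma₁ : ∀ t → + 4 ℤ.* t ≡ + 2 ℤ.* t ℤ.+ + 2 ℤ.* t
    lemma₁ = ℤ-Solver.solve-∀
    lemma₂ : ∀ t N → t ℤ.- + 2 ℤ.* t ℤ.* N ≡ t ℤ.+ + 2 ℤ.* (ℤ.- (t ℤ.* N))
    lemma₂ = ℤ-Solver.solve-∀
    numerator : poch (E (+ 4 ℤ.* t)) (x ^ (2 ℕ.* d)) N ≈ Π N C
    numerator = trans (poch≈Π N) (Π-cong N (λ j _ → +-congˡ (-‿cong (*-congʳ (trans (reflexive (≡.cong E (lemma₁ t))) (E-+ (+ 2 ℤ.* t) (+ 2 ℤ.* t)))))))
    exponent : E (t ℤ.- + 2 ℤ.* t ℤ.* + N) ≈ s * W (ℤ.- (t ℤ.* + N))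
    exponent = trans (reflexive (≡.cong E (lemma₂ t (+ N)))) (E-+ t (+ 2 ℤ.* (ℤ.- (t ℤ.* + N))))

  difference : ℕ → Carrier
  difference l = sum {l} (term ∘ toℕ) - rhs

  difference≈ : ∀ l → difference l ≈ κ * (Σ l c - R n N)
  difference≈ l = begin
    sum {l} (term ∘ toℕ) - rhs           ≈⟨ +-cong (reflexive (≡.sym (Σ≡sum l term))) (-‿cong rhs≈κR) ⟩
    Σ l term - κ * R n N                 ≈⟨ +-congʳ (trans (Σ-cong l (λ k _ → term≈κc k)) (Σ-*ˡ l κ c)) ⟩
    κ * Σ l c - κ * R n N                ≈⟨ solve 3 (λ κ s r → κ :* s :- κ :* r ⊜ κ :* (s :- r)) refl κ _ _ ⟩
    κ * (Σ l c - R n N)                  ∎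

  -- The operations of a concrete field enter as variables with their defining
  -- equations, as comparing deep expressions up to unfolding is not feasible.
  module Transport
    (_⊕_ _⊖_ _⊛_ _⊘_ : Carrier → Carrier → Carrier) (⊝_ : Carrier → Carrier) (_↑_ : Carrier → ℕ → Carrier) (one two : Carrier)
    (e b b² : ℤ → Carrier) (ph : Carrier → Carrier → ℕ → Carrier) (S : ℕ → (ℕ → Carrier) → Carrier)
    (⊕≡ : ∀ u v → u ⊕ v ≡ u + v) (⊖≡ : ∀ u v → u ⊖ v ≡ u - v) (⊛≡ : ∀ u v → u ⊛ v ≡ u * v)
    (⊘≡ : ∀ u v → u ⊘ v ≡ u * v ⁻¹) (⊝≡ : ∀ u → ⊝ u ≡ - u) (↑≡ : ∀ u k → u ↑ k ≡ u ^ k) (one≡ : one ≡ 1#) (two≡ : two ≡ 1# + 1#)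
    (e≡ : ∀ i → e i ≡ E i) (b≡ : ∀ i → b i ≡ bracket i) (b²≡ : ∀ i → b² i ≡ bracket² i)
    (ph≡ : ∀ u v k → ph u v k ≡ poch u v k)
    (S≡ : ∀ l f g → (∀ k → f k ≡ g k) → S l f ≡ sum {l} (g ∘ toℕ))
    where

    difference≡ :
      let
        term′ : ℕ → Carrier
        term′ k = ((b² (+ 2 ℤ.* + d ℤ.* + k ℤ.+ t) ⊛ (b (+ 2 ℤ.* + d ℤ.* + k ℤ.+ t) ↑ 2))
          ⊛ ((ph (e (+ 2 ℤ.* t)) (x ↑ (2 ℕ.* d)) k ↑ 4) ⊘ (ph (x ↑ (2 ℕ.* d)) (x ↑ (2 ℕ.* d)) k ↑ 4)))
          ⊛ e (ℤ.- (+ 4 ℤ.* t ℤ.* + k))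
        rhs′ : Carrier
        rhs′ = ((((((⊝ two) ⊛ (b t ↑ 2)) ⊛ b² (+ n)) ⊛ ph (e (+ 4 ℤ.* t)) (x ↑ (2 ℕ.* d)) N)
          ⊘ ((one ⊕ e (+ 2 ℤ.* t)) ⊛ ph (x ↑ (2 ℕ.* d)) (x ↑ (2 ℕ.* d)) N)))
          ⊛ e (t ℤ.- + 2 ℤ.* t ℤ.* + N)
      in
      ∀ l → S l term′ ⊖ rhs′ ≡ difference l
    difference≡ l = ⊖-cong (S≡ l _ term λ k → ⊛-cong (⊛-cong (⊛-cong (b²≡ _) (↑-cong 2 (b≡ _)))
        (⊘-cong (↑-cong 4 (ph-cong k (e≡ _) (↑≡ x _))) (↑-cong 4 (ph-cong k (↑≡ x _) (↑≡ x _))))) (e≡ _))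
      (⊛-cong (⊘-cong (⊛-cong (⊛-cong (⊛-cong (≡.trans (⊝≡ two) (≡.cong -_ two≡)) (↑-cong 2 (b≡ t))) (b²≡ (+ n))) (ph-cong N (e≡ _) (↑≡ x _)))
        (⊛-cong (≡.trans (⊕≡ one _) (≡.cong₂ _+_ one≡ (e≡ _))) (ph-cong N (↑≡ x _) (↑≡ x _)))) (e≡ _))
      where
      ⊛-cong : ∀ {u u′ v v′} → u ≡ u′ → v ≡ v′ → u ⊛ v ≡ u′ * v′
      ⊛-cong ≡.refl ≡.refl = ⊛≡ _ _
      ⊖-cong : ∀ {u u′ v v′} → u ≡ u′ → v ≡ v′ → u ⊖ v ≡ u′ - v′
      ⊖-cong ≡.refl ≡.refl = ⊖≡ _ _
      ⊘-cong : ∀ {u u′ v v′} → u ≡ u′ → v ≡ v′ → u ⊘ v ≡ u′ * v′ ⁻¹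
      ⊘-cong ≡.refl ≡.refl = ⊘≡ _ _
      ↑-cong : ∀ {u u′} k → u ≡ u′ → u ↑ k ≡ u′ ^ k
      ↑-cong k ≡.refl = ↑≡ _ k
      ph-cong : ∀ {u u′ v v′} k → u ≡ u′ → v ≡ v′ → ph u v k ≡ poch u′ v′ k
      ph-cong k ≡.refl ≡.refl = ph≡ _ _ k

  module Congruence
    {m : ℕ} .{{_ : NonZero m}} (1<m : 1 ℕ.< m) (𝓛 : Place K X m) (m∣n : m ℕ.∣ n)
    (cancel-d : ∀ i → + m Signed.∣ + d ℤ.* i → + m Signed.∣ i)
    where

    open PlaceProperties K X 𝓛

    -- This is where m > 1 enters: 1 - q² = 1 - w is a unit because m does not divide 1, and 1 - q
    -- is a unit because it divides 1 - q².
    Int-κ : Int κ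
    Int-κ = Int-* i₂∈ (Int-* i₁∈ i₁∈)
      where
      1-x²≈ : 1# - x ^ 2 ≈ (1# - x) * (1# + x)
      1-x²≈ = solve 1 (λ x → :1 :- x :* (x :* :1) ⊜ (:1 :- x) :* (:1 :+ x)) refl x
      u : Unit (1# - x ^ 2)
      u = Unit-resp (reflexive (≡.cong (λ y → 1# - y) (E≡^ 2))) (Unit-W {+ 1} λ m∣1 → contradiction (ℕ.∣⇒≤ (Signed.∣⇒∣ᵤ m∣1)) (ℕ.<⇒≱ 1<m))
      x∈ : Int x
      x∈ = Int-resp (trans (reflexive (E≡^ 1)) (*-identityʳ x)) (Int-E (+ 1))
      i₂∈ = int⁻¹ u
      i₁∈ = int⁻¹ (Unit-∣ (Int-- Int-1 x∈) (Int-+ Int-1 x∈) (Unit-resp 1-x²≈ u))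

    I-mod-N : I 1 (difference (suc N))
    I-mod-N = I-resp (sym (difference≈ (suc N))) (I-*ˡ Int-κ (I-- I-Σc-N I-R))
      where open AtPlace 𝓛 m∣n cancel-d

    I-mod-n : I 1 (difference n)
    I-mod-n = I-resp (sym (difference≈ n)) (I-*ˡ Int-κ (I-- I-Σc-n I-R))
      where open AtPlace 𝓛 m∣n cancel-d

  module CubeCongruence
    .{{_ : NonZero n}} (1<n : 1 ℕ.< n) (𝓛 : Place K X n)
    (cancel-d : ∀ i → + n Signed.∣ + d ℤ.* i → + n Signed.∣ i)
    (N<n : N ℕ.< n)
    (d[1+j]≢n : ∀ j → ¬ + d ℤ.* + suc j ℤ.- + n ≡ + 0)
    where

    open PlaceProperties K X 𝓛
    open Congruence 1<n 𝓛 ℕ.∣-refl cancel-d using (Int-κ)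
    open AtTop 𝓛 cancel-d N<n d[1+j]≢n

    I-cube-N : I 3 (difference (suc N))
    I-cube-N = I-resp (sym (difference≈ (suc N))) (I-*ˡ Int-κ cube-N)

    I-cube-n : I 3 (difference n)
    I-cube-n = I-resp (sym (difference≈ n)) (I-*ˡ Int-κ cube-n)

open import Defs
open import Data.Integer.Base using (∣_∣)
open import Data.Integer.Divisibility using (_∣_)
open import Data.Integer.GCD using (gcd)

-- The ring ℚ[q] and substitution into polynomials.

coeff--ₚ : ∀ p i → coeff (-ₚ p) i ≡ ℚ.- coeff p i
coeff--ₚ []      i       = ≡.refl
coeff--ₚ (a ∷ p) zero    = ≡.refl
coeff--ₚ (a ∷ p) (suc i) = coeff--ₚ p i

∷-cong : ∀ {a b p r} → a ≡ b → p ≈ₚ r → a ∷ p ≈ₚ b ∷ r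
∷-cong a≡b p≈r = mk≈ λ { zero → a≡b ; (suc i) → coeff-≡ p≈r i }

≈ₚ-refl : ∀ {p} → p ≈ₚ p
≈ₚ-refl = mk≈ λ _ → ≡.refl

≈ₚ-sym : ∀ {p r} → p ≈ₚ r → r ≈ₚ p
≈ₚ-sym e = mk≈ λ i → ≡.sym (coeff-≡ e i)

≈ₚ-trans : ∀ {p r s} → p ≈ₚ r → r ≈ₚ s → p ≈ₚ s
≈ₚ-trans e f = mk≈ λ i → ≡.trans (coeff-≡ e i) (coeff-≡ f i)

0∷[]≈0 : 0ℚ ∷ [] ≈ₚ 0ₚ
0∷[]≈0 = mk≈ λ { zero → ≡.refl ; (suc i) → ≡.refl }

+ₚ-cong : ∀ {p p′ r r′} → p ≈ₚ p′ → r ≈ₚ r′ → p +ₚ r ≈ₚ p′ +ₚ r′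
+ₚ-cong {p} {p′} {r} {r′} e f = mk≈ λ i → ≡.trans (coeff-+ₚ p r i)
  (≡.trans (≡.cong₂ ℚ._+_ (coeff-≡ e i) (coeff-≡ f i)) (≡.sym (coeff-+ₚ p′ r′ i)))

+ₚ-assoc : ∀ p r s → (p +ₚ r) +ₚ s ≈ₚ p +ₚ (r +ₚ s)
+ₚ-assoc p r s = mk≈ λ i → begin
  coeff ((p +ₚ r) +ₚ s) i                      ≡⟨ coeff-+ₚ (p +ₚ r) s i ⟩
  coeff (p +ₚ r) i ℚ.+ coeff s i               ≡⟨ ≡.cong (ℚ._+ coeff s i) (coeff-+ₚ p r i) ⟩
  coeff p i ℚ.+ coeff r i ℚ.+ coeff s i        ≡⟨ ℚ.+-assoc (coeff p i) (coeff r i) (coeff s i) ⟩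
  coeff p i ℚ.+ (coeff r i ℚ.+ coeff s i)      ≡⟨ ≡.cong (coeff p i ℚ.+_) (coeff-+ₚ r s i) ⟨
  coeff p i ℚ.+ coeff (r +ₚ s) i               ≡⟨ coeff-+ₚ p (r +ₚ s) i ⟨
  coeff (p +ₚ (r +ₚ s)) i                      ∎
  where open ≡.≡-Reasoning

+ₚ-comm : ∀ p r → p +ₚ r ≈ₚ r +ₚ p
+ₚ-comm p r = mk≈ λ i → ≡.trans (coeff-+ₚ p r i) (≡.trans (ℚ.+-comm (coeff p i) (coeff r i)) (≡.sym (coeff-+ₚ r p i)))

+ₚ-identityʳ : ∀ p → p +ₚ 0ₚ ≈ₚ p
+ₚ-identityʳ p = +ₚ-comm p 0ₚ

+ₚ-commutativeMonoid : CommutativeMonoid 0ℓ 0ℓ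
+ₚ-commutativeMonoid = record
  { Carrier = Poly
  ; _≈_     = _≈ₚ_
  ; _∙_     = _+ₚ_
  ; ε       = 0ₚ
  ; isCommutativeMonoid = record
    { isMonoid = record
      { isSemigroup = record
        { isMagma = record
          { isEquivalence = record { refl = ≈ₚ-refl ; sym = ≈ₚ-sym ; trans = ≈ₚ-trans }
          ; ∙-cong        = +ₚ-cong
          }
        ; assoc = +ₚ-assoc
        }
      ; identity = (λ _ → ≈ₚ-refl) , +ₚ-identityʳ
      }
    ; comm = +ₚ-comm
    }
  }

open import Algebra.Properties.CommutativeSemigroup
  (CommutativeMonoid.commutativeSemigroup +ₚ-commutativeMonoid) using (interchange; x∙yz≈y∙xz)
open import Relation.Binary.Reasoning.Setoid (CommutativeMonoid.setoid +ₚ-commutativeMonoid)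

·ₚ-cong : ∀ c {p r} → p ≈ₚ r → c ·ₚ p ≈ₚ c ·ₚ r
·ₚ-cong c {p} {r} p≈r = mk≈ λ i → ≡.trans (coeff-·ₚ c p i) (≡.trans (≡.cong (c ℚ.*_) (coeff-≡ p≈r i)) (≡.sym (coeff-·ₚ c r i)))

·ₚ-+ₚ : ∀ c p r → c ·ₚ (p +ₚ r) ≈ₚ c ·ₚ p +ₚ c ·ₚ r
·ₚ-+ₚ c []      r       = ≈ₚ-refl
·ₚ-+ₚ c (a ∷ p) []      = ≈ₚ-refl
·ₚ-+ₚ c (a ∷ p) (b ∷ r) = ∷-cong (ℚ.*-distribˡ-+ c a b) (·ₚ-+ₚ c p r)

·ₚ-·ₚ : ∀ c a p → c ·ₚ (a ·ₚ p) ≈ₚ (c ℚ.* a) ·ₚ p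
·ₚ-·ₚ c a []      = ≈ₚ-refl
·ₚ-·ₚ c a (b ∷ p) = ∷-cong (≡.sym (ℚ.*-assoc c a b)) (·ₚ-·ₚ c a p)

0·ₚ : ∀ p → 0ℚ ·ₚ p ≈ₚ 0ₚ
0·ₚ p = mk≈ λ i → ≡.trans (coeff-·ₚ 0ℚ p i) (ℚ.*-zeroˡ (coeff p i))

1·ₚ : ∀ p → 1ℚ ·ₚ p ≈ₚ p
1·ₚ p = mk≈ λ i → ≡.trans (coeff-·ₚ 1ℚ p i) (ℚ.*-identityˡ (coeff p i))

*ₚ-zeroʳ : ∀ p → p *ₚ 0ₚ ≈ₚ 0ₚ
*ₚ-zeroʳ []      = ≈ₚ-refl
*ₚ-zeroʳ (a ∷ p) = ≈ₚ-trans (∷-cong ≡.refl (*ₚ-zeroʳ p)) 0∷[]≈0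

*ₚ-congˡ : ∀ p {r r′} → r ≈ₚ r′ → p *ₚ r ≈ₚ p *ₚ r′
*ₚ-congˡ []      r≈r′ = ≈ₚ-refl
*ₚ-congˡ (a ∷ p) r≈r′ = +ₚ-cong (·ₚ-cong a r≈r′) (∷-cong ≡.refl (*ₚ-congˡ p r≈r′))

*ₚ-distribˡ : ∀ p r s → p *ₚ (r +ₚ s) ≈ₚ p *ₚ r +ₚ p *ₚ s
*ₚ-distribˡ []      r s = ≈ₚ-refl
*ₚ-distribˡ (a ∷ p) r s = begin
  a ·ₚ (r +ₚ s) +ₚ (0ℚ ∷ p *ₚ (r +ₚ s))
    ≈⟨ +ₚ-cong (·ₚ-+ₚ a r s) (∷-cong ≡.refl (*ₚ-distribˡ p r s)) ⟩
  (a ·ₚ r +ₚ a ·ₚ s) +ₚ ((0ℚ ∷ p *ₚ r) +ₚ (0ℚ ∷ p *ₚ s))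
    ≈⟨ interchange (a ·ₚ r) (a ·ₚ s) (0ℚ ∷ p *ₚ r) (0ℚ ∷ p *ₚ s) ⟩
  (a ∷ p) *ₚ r +ₚ (a ∷ p) *ₚ s ∎

*ₚ-∷ : ∀ p b r → p *ₚ (b ∷ r) ≈ₚ b ·ₚ p +ₚ (0ℚ ∷ p *ₚ r)
*ₚ-∷ []      b r = ≈ₚ-sym 0∷[]≈0
*ₚ-∷ (a ∷ p) b r = ∷-cong (≡.cong (ℚ._+ 0ℚ) (ℚ.*-comm a b)) (begin
  a ·ₚ r +ₚ p *ₚ (b ∷ r)                     ≈⟨ +ₚ-cong {a ·ₚ r} ≈ₚ-refl (*ₚ-∷ p b r) ⟩
  a ·ₚ r +ₚ (b ·ₚ p +ₚ (0ℚ ∷ p *ₚ r))        ≈⟨ x∙yz≈y∙xz (a ·ₚ r) (b ·ₚ p) (0ℚ ∷ p *ₚ r) ⟩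
  b ·ₚ p +ₚ (a ∷ p) *ₚ r                     ∎)

*ₚ-comm : ∀ p r → p *ₚ r ≈ₚ r *ₚ p
*ₚ-comm []      r = ≈ₚ-sym (*ₚ-zeroʳ r)
*ₚ-comm (a ∷ p) r = ≈ₚ-trans (+ₚ-cong {a ·ₚ r} ≈ₚ-refl (∷-cong ≡.refl (*ₚ-comm p r))) (≈ₚ-sym (*ₚ-∷ r a p))

*ₚ-cong : ∀ {p p′ r r′} → p ≈ₚ p′ → r ≈ₚ r′ → p *ₚ r ≈ₚ p′ *ₚ r′
*ₚ-cong {p} {p′} {r} {r′} e f = begin
  p *ₚ r     ≈⟨ *ₚ-congˡ p f ⟩
  p *ₚ r′    ≈⟨ *ₚ-comm p r′ ⟩
  r′ *ₚ p    ≈⟨ *ₚ-congˡ r′ e ⟩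
  r′ *ₚ p′   ≈⟨ *ₚ-comm r′ p′ ⟩
  p′ *ₚ r′   ∎

*ₚ-distribʳ : ∀ s p r → (p +ₚ r) *ₚ s ≈ₚ p *ₚ s +ₚ r *ₚ s
*ₚ-distribʳ s p r = begin
  (p +ₚ r) *ₚ s       ≈⟨ *ₚ-comm (p +ₚ r) s ⟩
  s *ₚ (p +ₚ r)       ≈⟨ *ₚ-distribˡ s p r ⟩
  s *ₚ p +ₚ s *ₚ r    ≈⟨ +ₚ-cong (*ₚ-comm s p) (*ₚ-comm s r) ⟩
  p *ₚ s +ₚ r *ₚ s    ∎

·ₚ-*ₚ : ∀ c p r → (c ·ₚ p) *ₚ r ≈ₚ c ·ₚ (p *ₚ r)
·ₚ-*ₚ c []      r = ≈ₚ-refl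
·ₚ-*ₚ c (a ∷ p) r = begin
  (c ℚ.* a) ·ₚ r +ₚ (0ℚ ∷ (c ·ₚ p) *ₚ r)
    ≈⟨ +ₚ-cong (≈ₚ-sym (·ₚ-·ₚ c a r)) (∷-cong (≡.sym (ℚ.*-zeroʳ c)) (·ₚ-*ₚ c p r)) ⟩
  c ·ₚ (a ·ₚ r) +ₚ c ·ₚ (0ℚ ∷ p *ₚ r)
    ≈⟨ ·ₚ-+ₚ c (a ·ₚ r) (0ℚ ∷ p *ₚ r) ⟨
  c ·ₚ ((a ∷ p) *ₚ r) ∎

0∷-*ₚ : ∀ p r → (0ℚ ∷ p) *ₚ r ≈ₚ 0ℚ ∷ p *ₚ r
0∷-*ₚ p r = +ₚ-cong (0·ₚ r) ≈ₚ-refl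

*ₚ-assoc : ∀ p r s → (p *ₚ r) *ₚ s ≈ₚ p *ₚ (r *ₚ s)
*ₚ-assoc []      r s = ≈ₚ-refl
*ₚ-assoc (a ∷ p) r s = begin
  (a ·ₚ r +ₚ (0ℚ ∷ p *ₚ r)) *ₚ s
    ≈⟨ *ₚ-distribʳ s (a ·ₚ r) (0ℚ ∷ p *ₚ r) ⟩
  (a ·ₚ r) *ₚ s +ₚ (0ℚ ∷ p *ₚ r) *ₚ s
    ≈⟨ +ₚ-cong (·ₚ-*ₚ a r s) (≈ₚ-trans (0∷-*ₚ (p *ₚ r) s) (∷-cong ≡.refl (*ₚ-assoc p r s))) ⟩
  a ·ₚ (r *ₚ s) +ₚ (0ℚ ∷ p *ₚ (r *ₚ s)) ∎

*ₚ-identityˡ : ∀ p → 1ₚ *ₚ p ≈ₚ p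
*ₚ-identityˡ p = ≈ₚ-trans (+ₚ-cong (1·ₚ p) 0∷[]≈0) (+ₚ-identityʳ p)

-ₚ-cong : ∀ {p r} → p ≈ₚ r → -ₚ p ≈ₚ -ₚ r
-ₚ-cong {p} {r} p≈r = mk≈ λ i → ≡.trans (coeff--ₚ p i) (≡.trans (≡.cong ℚ.-_ (coeff-≡ p≈r i)) (≡.sym (coeff--ₚ r i)))

-ₚ-inverseʳ : ∀ p → p +ₚ -ₚ p ≈ₚ 0ₚ
-ₚ-inverseʳ p = mk≈ λ i → ≡.trans (coeff-+ₚ p (-ₚ p) i)
  (≡.trans (≡.cong (coeff p i ℚ.+_) (coeff--ₚ p i)) (ℚ.+-inverseʳ (coeff p i)))

polyRing : CommutativeRing 0ℓ 0ℓ
polyRing = record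
  { Carrier = Poly
  ; _≈_     = _≈ₚ_
  ; _+_     = _+ₚ_
  ; _*_     = _*ₚ_
  ; -_      = -ₚ_
  ; 0#      = 0ₚ
  ; 1#      = 1ₚ
  ; isCommutativeRing = record
    { isRing = record
      { +-isAbelianGroup = record
        { isGroup = record
          { isMonoid = CommutativeMonoid.isMonoid +ₚ-commutativeMonoid
          ; inverse  = (λ p → ≈ₚ-trans (+ₚ-comm (-ₚ p) p) (-ₚ-inverseʳ p)) , -ₚ-inverseʳ
          ; ⁻¹-cong  = -ₚ-cong
          }
        ; comm = +ₚ-comm
        }
      ; *-cong     = *ₚ-cong
      ; *-assoc    = *ₚ-assoc
      ; *-identity = *ₚ-identityˡ , λ p → ≈ₚ-trans (*ₚ-comm p 1ₚ) (*ₚ-identityˡ p)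
      ; distrib    = *ₚ-distribˡ , *ₚ-distribʳ
      }
    ; *-comm = *ₚ-comm
    }
  }

*ₚ-cancelˡ : ∀ p {r s} → ¬ p ≈ₚ 0ₚ → p *ₚ r ≈ₚ p *ₚ s → r ≈ₚ s
*ₚ-cancelˡ p {r} {s} p≉0 pr≈ps = begin
  r                    ≈⟨ +ₚ-identityʳ r ⟨
  r +ₚ 0ₚ              ≈⟨ +ₚ-cong {r} ≈ₚ-refl (≈ₚ-trans (+ₚ-comm (-ₚ s) s) (-ₚ-inverseʳ s)) ⟨
  r +ₚ (-ₚ s +ₚ s)     ≈⟨ +ₚ-assoc r (-ₚ s) s ⟨
  (r -ₚ s) +ₚ s        ≈⟨ +ₚ-cong r-s≈0 ≈ₚ-refl ⟩
  s                    ∎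
  where
  r-s≈0 : r -ₚ s ≈ₚ 0ₚ
  r-s≈0 = *ₚ-cancel-0 p (r -ₚ s) p≉0 (begin
    p *ₚ (r -ₚ s)              ≈⟨ *ₚ-distribˡ p r (-ₚ s) ⟩
    p *ₚ r +ₚ p *ₚ -ₚ s        ≈⟨ +ₚ-cong pr≈ps ≈ₚ-refl ⟩
    p *ₚ s +ₚ p *ₚ -ₚ s        ≈⟨ *ₚ-distribˡ p s (-ₚ s) ⟨
    p *ₚ (s -ₚ s)              ≈⟨ *ₚ-congˡ p (-ₚ-inverseʳ s) ⟩
    p *ₚ 0ₚ                    ≈⟨ *ₚ-zeroʳ p ⟩
    0ₚ                         ∎)

constₚ : ℚ → Poly
constₚ c = c ∷ []

constₚ-* : ∀ c p → constₚ c *ₚ p ≈ₚ c ·ₚ p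
constₚ-* c p = ≈ₚ-trans (+ₚ-cong {c ·ₚ p} ≈ₚ-refl 0∷[]≈0) (+ₚ-identityʳ (c ·ₚ p))

∘ₚ-≈0 : ∀ {p} g → p ≈ₚ 0ₚ → p ∘ₚ g ≈ₚ 0ₚ
∘ₚ-≈0 {[]}    g p≈0 = ≈ₚ-refl
∘ₚ-≈0 {a ∷ p} g p≈0 = begin
  constₚ a +ₚ g *ₚ (p ∘ₚ g)
    ≈⟨ +ₚ-cong (≈ₚ-trans (∷-cong (coeff-≡ p≈0 0) ≈ₚ-refl) 0∷[]≈0)
         (≈ₚ-trans (*ₚ-congˡ g (∘ₚ-≈0 {p} g (mk≈ λ i → coeff-≡ p≈0 (suc i)))) (*ₚ-zeroʳ g)) ⟩
  0ₚ ∎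

∘ₚ-cong : ∀ {p r} g → p ≈ₚ r → p ∘ₚ g ≈ₚ r ∘ₚ g
∘ₚ-cong {[]}    {r}     g p≈r = ≈ₚ-sym (∘ₚ-≈0 {r} g (≈ₚ-sym p≈r))
∘ₚ-cong {a ∷ p} {[]}    g p≈r = ∘ₚ-≈0 {a ∷ p} g p≈r
∘ₚ-cong {a ∷ p} {b ∷ r} g p≈r = +ₚ-cong (∷-cong (coeff-≡ p≈r 0) ≈ₚ-refl)
  (*ₚ-congˡ g (∘ₚ-cong {p} {r} g (mk≈ λ i → coeff-≡ p≈r (suc i))))

∘ₚ-+ₚ : ∀ g p r → (p +ₚ r) ∘ₚ g ≈ₚ p ∘ₚ g +ₚ r ∘ₚ g
∘ₚ-+ₚ g []      r       = ≈ₚ-refl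
∘ₚ-+ₚ g (a ∷ p) []      = ≈ₚ-sym (+ₚ-identityʳ _)
∘ₚ-+ₚ g (a ∷ p) (b ∷ r) = begin
  (constₚ a +ₚ constₚ b) +ₚ g *ₚ ((p +ₚ r) ∘ₚ g)
    ≈⟨ +ₚ-cong {constₚ a +ₚ constₚ b} ≈ₚ-refl (≈ₚ-trans (*ₚ-congˡ g (∘ₚ-+ₚ g p r)) (*ₚ-distribˡ g (p ∘ₚ g) (r ∘ₚ g))) ⟩
  (constₚ a +ₚ constₚ b) +ₚ (g *ₚ (p ∘ₚ g) +ₚ g *ₚ (r ∘ₚ g))
    ≈⟨ interchange (constₚ a) (constₚ b) (g *ₚ (p ∘ₚ g)) (g *ₚ (r ∘ₚ g)) ⟩
  (a ∷ p) ∘ₚ g +ₚ (b ∷ r) ∘ₚ g ∎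

∘ₚ-·ₚ : ∀ g c p → (c ·ₚ p) ∘ₚ g ≈ₚ c ·ₚ (p ∘ₚ g)
∘ₚ-·ₚ g c []      = ≈ₚ-refl
∘ₚ-·ₚ g c (a ∷ p) = begin
  constₚ (c ℚ.* a) +ₚ g *ₚ ((c ·ₚ p) ∘ₚ g)
    ≈⟨ +ₚ-cong {constₚ (c ℚ.* a)} ≈ₚ-refl (begin
         g *ₚ ((c ·ₚ p) ∘ₚ g)     ≈⟨ *ₚ-congˡ g (∘ₚ-·ₚ g c p) ⟩
         g *ₚ (c ·ₚ (p ∘ₚ g))     ≈⟨ *ₚ-comm g _ ⟩
         (c ·ₚ (p ∘ₚ g)) *ₚ g     ≈⟨ ·ₚ-*ₚ c (p ∘ₚ g) g ⟩
         c ·ₚ ((p ∘ₚ g) *ₚ g)     ≈⟨ ·ₚ-cong c (*ₚ-comm (p ∘ₚ g) g) ⟩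
         c ·ₚ (g *ₚ (p ∘ₚ g))     ∎) ⟩
  c ·ₚ constₚ a +ₚ c ·ₚ (g *ₚ (p ∘ₚ g))
    ≈⟨ ·ₚ-+ₚ c (constₚ a) (g *ₚ (p ∘ₚ g)) ⟨
  c ·ₚ ((a ∷ p) ∘ₚ g) ∎

∘ₚ-*ₚ : ∀ g p r → (p *ₚ r) ∘ₚ g ≈ₚ (p ∘ₚ g) *ₚ (r ∘ₚ g)
∘ₚ-*ₚ g []      r = ≈ₚ-refl
∘ₚ-*ₚ g (a ∷ p) r = begin
  (a ·ₚ r +ₚ (0ℚ ∷ p *ₚ r)) ∘ₚ g
    ≈⟨ ∘ₚ-+ₚ g (a ·ₚ r) (0ℚ ∷ p *ₚ r) ⟩
  (a ·ₚ r) ∘ₚ g +ₚ (constₚ 0ℚ +ₚ g *ₚ ((p *ₚ r) ∘ₚ g))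
    ≈⟨ +ₚ-cong (∘ₚ-·ₚ g a r) (≈ₚ-trans (+ₚ-cong 0∷[]≈0 ≈ₚ-refl) (*ₚ-congˡ g (∘ₚ-*ₚ g p r))) ⟩
  a ·ₚ (r ∘ₚ g) +ₚ g *ₚ ((p ∘ₚ g) *ₚ (r ∘ₚ g))
    ≈⟨ +ₚ-cong (constₚ-* a (r ∘ₚ g)) (*ₚ-assoc g (p ∘ₚ g) (r ∘ₚ g)) ⟨
  constₚ a *ₚ (r ∘ₚ g) +ₚ g *ₚ (p ∘ₚ g) *ₚ (r ∘ₚ g)
    ≈⟨ *ₚ-distribʳ (r ∘ₚ g) (constₚ a) (g *ₚ (p ∘ₚ g)) ⟨
  ((a ∷ p) ∘ₚ g) *ₚ (r ∘ₚ g) ∎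

∘ₚ-1 : ∀ g → 1ₚ ∘ₚ g ≈ₚ 1ₚ
∘ₚ-1 g = ≈ₚ-trans (+ₚ-cong {1ₚ} ≈ₚ-refl (*ₚ-zeroʳ g)) (+ₚ-identityʳ 1ₚ)

∘ₚ-X : ∀ g → X ∘ₚ g ≈ₚ g
∘ₚ-X g = ≈ₚ-trans (+ₚ-cong 0∷[]≈0 (≈ₚ-trans (*ₚ-congˡ g (∘ₚ-1 g)) (≈ₚ-trans (*ₚ-comm g 1ₚ) (*ₚ-identityˡ g)))) ≈ₚ-refl

∘ₚ-^ₚ : ∀ g p n → (p ^ₚ n) ∘ₚ g ≈ₚ (p ∘ₚ g) ^ₚ n
∘ₚ-^ₚ g p zero    = ∘ₚ-1 g
∘ₚ-^ₚ g p (suc n) = ≈ₚ-trans (∘ₚ-*ₚ g p (p ^ₚ n)) (*ₚ-congˡ (p ∘ₚ g) (∘ₚ-^ₚ g p n))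

∘ₚ--ₚ : ∀ g p → (-ₚ p) ∘ₚ g ≈ₚ -ₚ (p ∘ₚ g)
∘ₚ--ₚ g p = begin
  (-ₚ p) ∘ₚ g                                   ≈⟨ +ₚ-identityʳ _ ⟨
  (-ₚ p) ∘ₚ g +ₚ 0ₚ                             ≈⟨ +ₚ-cong {(-ₚ p) ∘ₚ g} ≈ₚ-refl (-ₚ-inverseʳ (p ∘ₚ g)) ⟨
  (-ₚ p) ∘ₚ g +ₚ (p ∘ₚ g -ₚ p ∘ₚ g)             ≈⟨ +ₚ-assoc ((-ₚ p) ∘ₚ g) (p ∘ₚ g) _ ⟨
  ((-ₚ p) ∘ₚ g +ₚ p ∘ₚ g) -ₚ p ∘ₚ g             ≈⟨ +ₚ-cong (∘ₚ-+ₚ g (-ₚ p) p) ≈ₚ-refl ⟨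
  ((-ₚ p) +ₚ p) ∘ₚ g -ₚ p ∘ₚ g                  ≈⟨ +ₚ-cong (∘ₚ-≈0 {(-ₚ p) +ₚ p} g (≈ₚ-trans (+ₚ-comm (-ₚ p) p) (-ₚ-inverseʳ p))) ≈ₚ-refl ⟩
  -ₚ (p ∘ₚ g)                                   ∎

-- Leading coefficients and exact division by monic polynomials.

record Lead (c : ℚ) (d : ℕ) (p : Poly) : Set where
  constructor mkLead
  field
    lead   : coeff p d ≡ c
    beyond : ∀ i → d ℕ.< i → coeff p i ≡ 0ℚ

open Lead public

Lead-resp : ∀ {c d p r} → p ≈ₚ r → Lead c d p → Lead c d r
Lead-resp p≈r (mkLead l b) = mkLead (≡.trans (≡.sym (coeff-≡ p≈r _)) l) (λ i d<i → ≡.trans (≡.sym (coeff-≡ p≈r i)) (b i d<i))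

private
  a*x+y : ∀ a {x y v} → x ≡ 0ℚ → y ≡ v → a ℚ.* x ℚ.+ y ≡ v
  a*x+y a {v = v} ≡.refl ≡.refl = ≡.trans (≡.cong (ℚ._+ v) (ℚ.*-zeroʳ a)) (ℚ.+-identityˡ v)

-- The recorded coefficients may be zero, so the product rule is a plain induction on the first
-- factor; nonvanishing is demanded only where a degree is to be identified.
Lead-* : ∀ {c c′ d e p r} → Lead c d p → Lead c′ e r → Lead (c ℚ.* c′) (d ℕ.+ e) (p *ₚ r)
Lead-* {c′ = c′} {p = []} (mkLead ≡.refl _) _ = mkLead (≡.sym (ℚ.*-zeroˡ c′)) (λ _ _ → ≡.refl)
Lead-* {c} {c′} {zero} {e} {a ∷ p} {r} (mkLead ≡.refl b) (mkLead l′ b′) = Lead-resp (≈ₚ-sym ar) (mkLead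
  (≡.trans (coeff-·ₚ a r e) (≡.cong (a ℚ.*_) l′))
  (λ i e<i → ≡.trans (coeff-·ₚ a r i) (≡.trans (≡.cong (a ℚ.*_) (b′ i e<i)) (ℚ.*-zeroʳ a))))
  where
  ar : (a ∷ p) *ₚ r ≈ₚ a ·ₚ r
  ar = ≈ₚ-trans (+ₚ-cong {a ·ₚ r} ≈ₚ-refl (≈ₚ-trans (∷-cong ≡.refl (*ₚ-cong {p} {0ₚ} (mk≈ λ i → b (suc i) (ℕ.s≤s ℕ.z≤n)) ≈ₚ-refl)) 0∷[]≈0))
    (+ₚ-identityʳ (a ·ₚ r))
Lead-* {c} {c′} {suc d} {e} {a ∷ p} {r} (mkLead l b) (mkLead l′ b′) = mkLead
  (≡.trans (coeff-∷-*ₚ a p r (suc d ℕ.+ e)) (a*x+y a (b′ _ (ℕ.s≤s (ℕ.m≤n+m e d))) (lead pr)))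
  λ { (suc i) (ℕ.s≤s d+e<i) → ≡.trans (coeff-∷-*ₚ a p r (suc i))
        (a*x+y a (b′ _ (ℕ.m<n⇒m<1+n (ℕ.≤-<-trans (ℕ.m≤n+m e d) d+e<i))) (beyond pr i d+e<i)) }
  where
  pr : Lead (c ℚ.* c′) (d ℕ.+ e) (p *ₚ r)
  pr = Lead-* {p = p} {r} (mkLead l (λ i d<i → b (suc i) (ℕ.s≤s d<i))) (mkLead l′ b′)

Lead-degree : ∀ {c d} p → c ≢ 0ℚ → Lead c d p → degree p ≡ d
Lead-degree []      c≢0 (mkLead 0≡c _) = contradiction (≡.sym 0≡c) c≢0
Lead-degree (a ∷ p) c≢0 l with ≈0? p
Lead-degree {d = zero}  (a ∷ p) c≢0 (mkLead l b) | yes p≈0 = ≡.refl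
Lead-degree {d = suc d} (a ∷ p) c≢0 (mkLead l b) | yes p≈0 = contradiction (≡.trans (≡.sym l) (coeff-≡ p≈0 d)) c≢0
Lead-degree {d = zero}  (a ∷ p) c≢0 (mkLead l b) | no  p≉0 = contradiction (mk≈ λ i → b (suc i) (ℕ.s≤s ℕ.z≤n)) p≉0
Lead-degree {d = suc d} (a ∷ p) c≢0 (mkLead l b) | no  p≉0 =
  ≡.cong suc (Lead-degree p c≢0 (mkLead l (λ i d<i → b (suc i) (ℕ.s≤s d<i))))

Lead-exists : ∀ p → ¬ p ≈ₚ 0ₚ → ∃ λ c → ∃ λ d → c ≢ 0ℚ × Lead c d p
Lead-exists []      p≉0 = contradiction ≈ₚ-refl p≉0
Lead-exists (a ∷ p) p≉0 with ≈0? p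
... | no  p′≉0 with Lead-exists p p′≉0
...   | c , d , c≢0 , mkLead l b = c , suc d , c≢0 , mkLead l λ { (suc i) (ℕ.s≤s d<i) → b i d<i }
Lead-exists (a ∷ p) p≉0 | yes p′≈0 = a , 0 , (λ a≡0 → p≉0 (≈ₚ-trans (∷-cong a≡0 p′≈0) 0∷[]≈0)) , mkLead ≡.refl
  λ { (suc i) _ → coeff-≡ p′≈0 i }

Lead-unique : ∀ {c c′ d d′ p} → c ≢ 0ℚ → c′ ≢ 0ℚ → Lead c d p → Lead c′ d′ p → c ≡ c′
Lead-unique {d = d} {d′} c≢0 c′≢0 (mkLead l b) (mkLead l′ b′) with ℕ.<-cmp d d′
... | tri< d<d′ _ _    = contradiction (≡.trans (≡.sym l′) (b d′ d<d′)) c′≢0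
... | tri≈ _ ≡.refl _  = ≡.trans (≡.sym l) l′
... | tri> _ _ d>d′    = contradiction (≡.trans (≡.sym l) (b′ d d>d′)) c≢0

1≢0 : 1ℚ ≢ 0ℚ
1≢0 ()

Monic : Poly → Set
Monic p = ∃ λ d → Lead 1ℚ d p

Monic-1 : Monic 1ₚ
Monic-1 = 0 , mkLead ≡.refl λ { (suc i) _ → ≡.refl }

Monic-* : ∀ {p r} → Monic p → Monic r → Monic (p *ₚ r)
Monic-* {p} {r} (d , l) (e , l′) = d ℕ.+ e , Lead-* {p = p} {r} l l′

Monic-cancelʳ : ∀ p r → Monic (p *ₚ r) → Monic r → Monic p
Monic-cancelʳ p r (D , l) (e , l′) with ≈0? p
... | yes p≈0 = contradiction (≡.trans (≡.sym (lead l)) (coeff-≡ (*ₚ-cong {p} {0ₚ} p≈0 (≈ₚ-refl {r})) D)) 1≢0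
... | no  p≉0 with Lead-exists p p≉0
...   | c , d , c≢0 , m = d , ≡.subst (λ x → Lead x d p) c≡1 m
  where
  c*1≡c : c ℚ.* 1ℚ ≡ c
  c*1≡c = ℚ.*-identityʳ c
  c≡1 : c ≡ 1ℚ
  c≡1 = Lead-unique {p = p *ₚ r} c≢0 1≢0 (≡.subst (λ x → Lead x (d ℕ.+ e) (p *ₚ r)) c*1≡c (Lead-* {p = p} {r} m l′)) l

X^-Lead : ∀ n → Lead 1ℚ n (X ^ₚ n)
X^-Lead zero    = proj₂ Monic-1
X^-Lead (suc n) = Lead-* {d = 1} {p = X} {X ^ₚ n} (mkLead ≡.refl λ { (suc (suc i)) _ → ≡.refl ; (suc zero) (ℕ.s≤s ()) }) (X^-Lead n)

X^-1-Monic : ∀ n → Monic (X ^ₚ suc n -ₚ 1ₚ)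
X^-1-Monic n = suc n , mkLead
  (≡.trans (coeff-+ₚ (X ^ₚ suc n) (-ₚ 1ₚ) (suc n)) (≡.cong (ℚ._+ 0ℚ) (lead (X^-Lead (suc n)))))
  λ { (suc i) n<i → ≡.trans (coeff-+ₚ (X ^ₚ suc n) (-ₚ 1ₚ) (suc i)) (≡.cong (ℚ._+ 0ℚ) (beyond (X^-Lead (suc n)) (suc i) n<i)) }

divMod-spec : ∀ p g {m} → degree g ≡ m → Lead 1ℚ m g →
  let s , r = divMod p g in (p ≈ₚ s *ₚ g +ₚ r) × (∀ i → m ℕ.≤ i → coeff r i ≡ 0ℚ)
divMod-spec []      g _      _ = ≈ₚ-refl , λ _ _ → ≡.refl
divMod-spec (a ∷ p) g ≡.refl l with divMod p g | divMod-spec p g ≡.refl l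
... | s , r | p≈ , r-small = eq , small
  where
  m = degree g
  c = coeff (a ∷ r) m
  eq : a ∷ p ≈ₚ (c ·ₚ g +ₚ (0ℚ ∷ s *ₚ g)) +ₚ ((a ∷ r) -ₚ (c ·ₚ g))
  eq = begin
    a ∷ p
      ≈⟨ ∷-cong (≡.sym (ℚ.+-identityˡ a)) p≈ ⟩
    (0ℚ ∷ s *ₚ g) +ₚ (a ∷ r)
      ≈⟨ +ₚ-cong (-ₚ-inverseʳ (c ·ₚ g)) ≈ₚ-refl ⟨
    (c ·ₚ g -ₚ c ·ₚ g) +ₚ ((0ℚ ∷ s *ₚ g) +ₚ (a ∷ r))
      ≈⟨ interchange (c ·ₚ g) (-ₚ (c ·ₚ g)) (0ℚ ∷ s *ₚ g) (a ∷ r) ⟩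
    (c ·ₚ g +ₚ (0ℚ ∷ s *ₚ g)) +ₚ (-ₚ (c ·ₚ g) +ₚ (a ∷ r))
      ≈⟨ +ₚ-cong {c ·ₚ g +ₚ (0ℚ ∷ s *ₚ g)} ≈ₚ-refl (+ₚ-comm (-ₚ (c ·ₚ g)) (a ∷ r)) ⟩
    (c ·ₚ g +ₚ (0ℚ ∷ s *ₚ g)) +ₚ ((a ∷ r) -ₚ (c ·ₚ g)) ∎
  coeff-rem : ∀ i → coeff ((a ∷ r) -ₚ (c ·ₚ g)) i ≡ coeff (a ∷ r) i ℚ.- c ℚ.* coeff g i
  coeff-rem i = ≡.trans (coeff-+ₚ (a ∷ r) (-ₚ (c ·ₚ g)) i) (≡.cong (coeff (a ∷ r) i ℚ.+_)
    (≡.trans (coeff--ₚ (c ·ₚ g) i) (≡.cong ℚ.-_ (coeff-·ₚ c g i))))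
  a∷r-small : ∀ i → m ℕ.< i → coeff (a ∷ r) i ≡ 0ℚ
  a∷r-small (suc i) (ℕ.s≤s m≤i) = r-small i m≤i
  small : ∀ i → m ℕ.≤ i → coeff ((a ∷ r) -ₚ (c ·ₚ g)) i ≡ 0ℚ
  small i m≤i with ℕ.<-cmp m i
  ... | tri< m<i _ _   = ≡.trans (coeff-rem i) (≡.trans (≡.cong₂ (λ x y → x ℚ.- c ℚ.* y) (a∷r-small i m<i) (beyond l i m<i))
                           (≡.cong (λ x → 0ℚ ℚ.- x) (ℚ.*-zeroʳ c)))
  ... | tri≈ _ ≡.refl _ = ≡.trans (coeff-rem m) (≡.trans (≡.cong (λ y → c ℚ.- c ℚ.* y) (lead l))
                           (≡.trans (≡.cong (λ x → c ℚ.- x) (ℚ.*-identityʳ c)) (ℚ.+-inverseʳ c)))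
  ... | tri> _ _ m>i   = contradiction m≤i (ℕ.<⇒≱ m>i)

-- If the computed quotient s′ differed from s, the remainder would be (s - s′) g, with a nonzero
-- coefficient at an index at least the degree of g.
quo-exact : ∀ p s g → Monic g → p ≈ₚ s *ₚ g → p quo g ≈ₚ s
quo-exact p s g (m , l) p≈sg with divMod p g | divMod-spec p g (Lead-degree g 1≢0 l) l
... | s′ , r | p≈ , r-small with ≈0? (s -ₚ s′)
...   | yes s-s′≈0 = ≈ₚ-sym (begin
    s                      ≈⟨ +ₚ-identityʳ s ⟨
    s +ₚ 0ₚ                ≈⟨ +ₚ-cong {s} ≈ₚ-refl (≈ₚ-trans (+ₚ-comm (-ₚ s′) s′) (-ₚ-inverseʳ s′)) ⟨
    s +ₚ (-ₚ s′ +ₚ s′)     ≈⟨ +ₚ-assoc s (-ₚ s′) s′ ⟨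
    (s -ₚ s′) +ₚ s′        ≈⟨ +ₚ-cong s-s′≈0 ≈ₚ-refl ⟩
    s′                     ∎)
...   | no s-s′≉0 with Lead-exists (s -ₚ s′) s-s′≉0
...     | c , d , c≢0 , l′ = contradiction
  (≡.trans (≡.sym (≡.trans (lead (Lead-resp r≈ (Lead-* {p = s -ₚ s′} {g} l′ l))) (ℚ.*-identityʳ c))) (r-small (d ℕ.+ m) (ℕ.m≤n+m m d))) c≢0
  where
  r≈ : (s -ₚ s′) *ₚ g ≈ₚ r
  r≈ = begin
    (s -ₚ s′) *ₚ g                          ≈⟨ *ₚ-distribʳ g s (-ₚ s′) ⟩
    s *ₚ g +ₚ -ₚ s′ *ₚ g                    ≈⟨ +ₚ-cong (≈ₚ-trans (≈ₚ-sym p≈sg) p≈) ≈ₚ-refl ⟩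
    (s′ *ₚ g +ₚ r) +ₚ -ₚ s′ *ₚ g            ≈⟨ +ₚ-cong (+ₚ-comm (s′ *ₚ g) r) ≈ₚ-refl ⟩
    (r +ₚ s′ *ₚ g) +ₚ -ₚ s′ *ₚ g            ≈⟨ +ₚ-assoc r (s′ *ₚ g) _ ⟩
    r +ₚ (s′ *ₚ g +ₚ -ₚ s′ *ₚ g)            ≈⟨ +ₚ-cong {r} ≈ₚ-refl (*ₚ-distribʳ g s′ (-ₚ s′)) ⟨
    r +ₚ (s′ -ₚ s′) *ₚ g                    ≈⟨ +ₚ-cong {r} ≈ₚ-refl (*ₚ-cong (-ₚ-inverseʳ s′) (≈ₚ-refl {g})) ⟩
    r +ₚ 0ₚ                                 ≈⟨ +ₚ-identityʳ r ⟩
    r                                       ∎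

-- The field ℚ(q).

module 𝓟 = CommutativeRing polyRing
open RingSolver polyRing

≃-trans : ∀ {f g h} → f ≃ g → g ≃ h → f ≃ h
≃-trans {f} {g} {h} f≃g g≃h = *ₚ-cancelˡ (den g) (den≉0 g) (begin
  den g *ₚ (num f *ₚ den h)   ≈⟨ solve 3 (λ a b c → a :* (b :* c) ⊜ b :* a :* c) ≈ₚ-refl (den g) (num f) (den h) ⟩
  num f *ₚ den g *ₚ den h     ≈⟨ *ₚ-cong f≃g (≈ₚ-refl {den h}) ⟩
  num g *ₚ den f *ₚ den h     ≈⟨ solve 3 (λ a b c → a :* b :* c ⊜ a :* c :* b) ≈ₚ-refl (num g) (den f) (den h) ⟩
  num g *ₚ den h *ₚ den f     ≈⟨ *ₚ-cong g≃h (≈ₚ-refl {den f}) ⟩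
  num h *ₚ den g *ₚ den f     ≈⟨ solve 3 (λ a b c → a :* b :* c ⊜ b :* (a :* c)) ≈ₚ-refl (num h) (den g) (den f) ⟩
  den g *ₚ (num h *ₚ den f)   ∎)

+-cong : ∀ {f f′ g g′} → f ≃ f′ → g ≃ g′ → f + g ≃ f′ + g′
+-cong {mkRatFun a b _} {mkRatFun a′ b′ _} {mkRatFun c d _} {mkRatFun c′ d′ _} e e′ = begin
  (a *ₚ d +ₚ c *ₚ b) *ₚ (b′ *ₚ d′)
    ≈⟨ solve 6 (λ a b c d b′ d′ → (a :* d :+ c :* b) :* (b′ :* d′) ⊜ a :* b′ :* (d :* d′) :+ c :* d′ :* (b :* b′)) ≈ₚ-refl a b c d b′ d′ ⟩
  a *ₚ b′ *ₚ (d *ₚ d′) +ₚ c *ₚ d′ *ₚ (b *ₚ b′)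
    ≈⟨ +ₚ-cong (*ₚ-cong e (≈ₚ-refl {d *ₚ d′})) (*ₚ-cong e′ (≈ₚ-refl {b *ₚ b′})) ⟩
  a′ *ₚ b *ₚ (d *ₚ d′) +ₚ c′ *ₚ d *ₚ (b *ₚ b′)
    ≈⟨ solve 6 (λ a′ b c′ d b′ d′ → a′ :* b :* (d :* d′) :+ c′ :* d :* (b :* b′) ⊜ (a′ :* d′ :+ c′ :* b′) :* (b :* d)) ≈ₚ-refl a′ b c′ d b′ d′ ⟩
  (a′ *ₚ d′ +ₚ c′ *ₚ b′) *ₚ (b *ₚ d) ∎

*-cong : ∀ {f f′ g g′} → f ≃ f′ → g ≃ g′ → f * g ≃ f′ * g′
*-cong {mkRatFun a b _} {mkRatFun a′ b′ _} {mkRatFun c d _} {mkRatFun c′ d′ _} e e′ = begin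
  a *ₚ c *ₚ (b′ *ₚ d′)     ≈⟨ solve 4 (λ a c b d → a :* c :* (b :* d) ⊜ a :* b :* (c :* d)) ≈ₚ-refl a c b′ d′ ⟩
  a *ₚ b′ *ₚ (c *ₚ d′)     ≈⟨ *ₚ-cong e e′ ⟩
  a′ *ₚ b *ₚ (c′ *ₚ d)     ≈⟨ solve 4 (λ a c b d → a :* b :* (c :* d) ⊜ a :* c :* (b :* d)) ≈ₚ-refl a′ c′ b d ⟩
  a′ *ₚ c′ *ₚ (b *ₚ d)     ∎

neg-cong : ∀ {f g} → f ≃ g → - f ≃ - g
neg-cong {mkRatFun a b _} {mkRatFun c d _} e = begin
  (-ₚ a) *ₚ d     ≈⟨ solve 2 (λ a d → (:- a) :* d ⊜ :- (a :* d)) ≈ₚ-refl a d ⟩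
  -ₚ (a *ₚ d)     ≈⟨ -ₚ-cong e ⟩
  -ₚ (c *ₚ b)     ≈⟨ solve 2 (λ a d → (:- a) :* d ⊜ :- (a :* d)) ≈ₚ-refl c b ⟨
  (-ₚ c) *ₚ b     ∎

ratFunRing : CommutativeRing 0ℓ 0ℓ
ratFunRing = record
  { Carrier = RatFun
  ; _≈_     = _≃_
  ; _+_     = _+_
  ; _*_     = _*_
  ; -_      = -_
  ; 0#      = 0#
  ; 1#      = 1#
  ; isCommutativeRing = record
    { isRing = record
      { +-isAbelianGroup = record
        { isGroup = record
          { isMonoid = record
            { isSemigroup = record
              { isMagma = record
                { isEquivalence = record { refl = ≈ₚ-refl ; sym = ≈ₚ-sym ; trans = λ {f} {g} {h} → ≃-trans {f} {g} {h} }
                ; ∙-cong        = λ {f} {f′} {g} {g′} → +-cong {f} {f′} {g} {g′}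
                }
              ; assoc = λ (mkRatFun a b _) (mkRatFun c d _) (mkRatFun e f _) →
                  solve 6 (λ a b c d e f → ((a :* d :+ c :* b) :* f :+ e :* (b :* d)) :* (b :* (d :* f))
                    ⊜ (a :* (d :* f) :+ (c :* f :+ e :* d) :* b) :* (b :* d :* f)) ≈ₚ-refl a b c d e f
              }
            ; identity = (λ (mkRatFun a b _) → solve 2 (λ a b → (:0 :* b :+ a :* :1) :* b ⊜ a :* (:1 :* b)) ≈ₚ-refl a b)
                       , (λ (mkRatFun a b _) → solve 2 (λ a b → (a :* :1 :+ :0 :* b) :* b ⊜ a :* (b :* :1)) ≈ₚ-refl a b)
            }
          ; inverse = (λ (mkRatFun a b _) → solve 2 (λ a b → ((:- a) :* b :+ a :* b) :* :1 ⊜ :0 :* (b :* b)) ≈ₚ-refl a b)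
                    , (λ (mkRatFun a b _) → solve 2 (λ a b → (a :* b :+ (:- a) :* b) :* :1 ⊜ :0 :* (b :* b)) ≈ₚ-refl a b)
          ; ⁻¹-cong = λ {f} {g} → neg-cong {f} {g}
          }
        ; comm = λ (mkRatFun a b _) (mkRatFun c d _) →
            solve 4 (λ a b c d → (a :* d :+ c :* b) :* (d :* b) ⊜ (c :* b :+ a :* d) :* (b :* d)) ≈ₚ-refl a b c d
        }
      ; *-cong     = λ {f} {f′} {g} {g′} → *-cong {f} {f′} {g} {g′}
      ; *-assoc    = λ (mkRatFun a b _) (mkRatFun c d _) (mkRatFun e f _) →
          solve 6 (λ a b c d e f → a :* c :* e :* (b :* (d :* f)) ⊜ a :* (c :* e) :* (b :* d :* f)) ≈ₚ-refl a b c d e f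
      ; *-identity = (λ (mkRatFun a b _) → solve 2 (λ a b → :1 :* a :* b ⊜ a :* (:1 :* b)) ≈ₚ-refl a b)
                   , (λ (mkRatFun a b _) → solve 2 (λ a b → a :* :1 :* b ⊜ a :* (b :* :1)) ≈ₚ-refl a b)
      ; distrib    = (λ (mkRatFun a b _) (mkRatFun c d _) (mkRatFun e f _) →
          solve 6 (λ a b c d e f → a :* (c :* f :+ e :* d) :* (b :* d :* (b :* f))
            ⊜ (a :* c :* (b :* f) :+ a :* e :* (b :* d)) :* (b :* (d :* f))) ≈ₚ-refl a b c d e f)
        , (λ (mkRatFun a b _) (mkRatFun c d _) (mkRatFun e f _) →
          solve 6 (λ a b c d e f → (c :* f :+ e :* d) :* a :* (d :* b :* (f :* b))
            ⊜ (c :* a :* (f :* b) :+ e :* a :* (d :* b)) :* (d :* f :* b)) ≈ₚ-refl a b c d e f)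
      }
    ; *-comm = λ (mkRatFun a b _) (mkRatFun c d _) → solve 4 (λ a b c d → a :* c :* (d :* b) ⊜ c :* a :* (b :* d)) ≈ₚ-refl a b c d
    }
  }

*1≈0⇒≈0 : ∀ {p} → p *ₚ 1ₚ ≈ₚ 0ₚ → p ≈ₚ 0ₚ
*1≈0⇒≈0 {p} p1≈0 = ≈ₚ-trans (≈ₚ-sym (𝓟.*-identityʳ p)) p1≈0

inverseʳ : ∀ {f} → ¬ f ≃ 0# → f * f ⁻¹ ≃ 1#
inverseʳ {f@(mkRatFun a b _)} f≄0 with ≈0? a
... | yes a≈0 = contradiction (≈ₚ-trans (*ₚ-cong {a} {0ₚ} a≈0 (≈ₚ-refl {1ₚ})) ≈ₚ-refl) f≄0
... | no  _   = solve 2 (λ a b → a :* b :* :1 ⊜ :1 :* (b :* a)) ≈ₚ-refl a b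

ratFunField : Field
ratFunField = record
  { commutativeRing = ratFunRing
  ; _⁻¹             = _⁻¹
  ; *-inverseʳ      = λ {f} → inverseʳ {f}
  ; 1≉0             = λ e → contradiction (coeff-≡ e 0) λ ()
  ; 1+1≉0           = λ e → contradiction (coeff-≡ e 0) λ ()
  }

embedding : Embedding polyRing ratFunField
embedding = record
  { ι        = fromPoly
  ; ι-cong   = λ e → *ₚ-cong e (≈ₚ-refl {1ₚ})
  ; ι-+      = λ p r → solve 2 (λ p r → (p :+ r) :* (:1 :* :1) ⊜ (p :* :1 :+ r :* :1) :* :1) ≈ₚ-refl p r
  ; ι-*      = λ p r → solve 2 (λ p r → (p :* r) :* (:1 :* :1) ⊜ (p :* r) :* :1) ≈ₚ-refl p r
  ; ι-neg    = λ _ → ≈ₚ-refl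
  ; ι-1      = ≈ₚ-refl
  ; fraction = λ (mkRatFun a b _) → b , a , solve 2 (λ a b → a :* b :* :1 ⊜ a :* (b :* :1)) ≈ₚ-refl a b
  }

-- Cyclotomic polynomials over ℚ and their values at q².

open RingFolds polyRing
open Ideals polyRing hiding (_∣_)
open Mult 𝓟.semiring using () renaming (_×_ to _×ₚ_)
open Exp 𝓟.semiring using (^-assocʳ; ^-congˡ)

Monic-≉0 : ∀ {p} → Monic p → ¬ p ≈ₚ 0ₚ
Monic-≉0 (d , l) p≈0 = 1≢0 (≡.trans (≡.sym (lead l)) (coeff-≡ p≈0 d))

fromℕ : ℕ → ℚ
fromℕ zero    = 0ℚ
fromℕ (suc k) = 1ℚ ℚ.+ fromℕ k

0≤fromℕ : ∀ k → 0ℚ ℚ.≤ fromℕ k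
0≤fromℕ zero    = ℚ.≤-refl
0≤fromℕ (suc k) = ℚ.+-mono-≤ (ℚ.nonNegative⁻¹ 1ℚ) (0≤fromℕ k)

fromℕ≢0 : ∀ k → fromℕ (suc k) ≢ 0ℚ
fromℕ≢0 k eq = ℚ.<⇒≢ (ℚ.+-mono-<-≤ (ℚ.positive⁻¹ 1ℚ) (0≤fromℕ k)) (≡.trans (ℚ.+-identityˡ 0ℚ) (≡.sym eq))

×ₚ≈const : ∀ k → k ×ₚ 1ₚ ≈ₚ constₚ (fromℕ k)
×ₚ≈const zero    = ≈ₚ-sym 0∷[]≈0
×ₚ≈const (suc k) = +ₚ-cong {1ₚ} ≈ₚ-refl (×ₚ≈const k)

×ₚ-inverse : ∀ k .{{_ : NonZero k}} → ∃ λ k⁻¹ → k ×ₚ 1ₚ *ₚ k⁻¹ ≈ₚ 1ₚ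
×ₚ-inverse (suc k) = constₚ (ℚ.1/ c) , (begin
  suc k ×ₚ 1ₚ *ₚ constₚ (ℚ.1/ c)     ≈⟨ *ₚ-cong (×ₚ≈const (suc k)) ≈ₚ-refl ⟩
  constₚ c *ₚ constₚ (ℚ.1/ c)        ≈⟨ constₚ-* c (constₚ (ℚ.1/ c)) ⟩
  c ·ₚ constₚ (ℚ.1/ c)               ≈⟨ ∷-cong (ℚ.*-inverseʳ c) ≈ₚ-refl ⟩
  1ₚ                                 ∎)
  where
  c = fromℕ (suc k)
  instance
    c≢0 : ℚ.NonZero c
    c≢0 = ℚ.≢-nonZero (fromℕ≢0 k)

cancel-X^-1 : ∀ n {p r} .{{_ : NonZero n}} → (X ^ₚ n -ₚ 1ₚ) *ₚ p ≈ₚ (X ^ₚ n -ₚ 1ₚ) *ₚ r → p ≈ₚ r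
cancel-X^-1 (suc n) = *ₚ-cancelˡ (X ^ₚ suc n -ₚ 1ₚ) (Monic-≉0 (X^-1-Monic n))

module Φ₁ = Cyclotomic X Φ cancel-X^-1 ×ₚ-inverse

Monic-Π : ∀ n (f : ℕ → Poly) → (∀ k → k ℕ.< n → Monic (f k)) → Monic (Π n f)
Monic-Π zero    f m = proj₁ Monic-1 , Lead-resp (≈ₚ-sym (Π-zero f)) (proj₂ Monic-1)
Monic-Π (suc n) f m = let d , l = Monic-* (Monic-Π n f (λ k k<n → m k (ℕ.m<n⇒m<1+n k<n))) (m n (ℕ.n<1+n n)) in
  d , Lead-resp (≈ₚ-sym (Π-snoc n f)) l

-- Monicity is proved along with the factorisation, since the long division that defines Φ n is
-- meaningful only when the product of the earlier factors is monic.
Φ-factors×monic : ∀ n → .(NonZero n) → Φ₁.Factors n × Monic (Φ n)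
Φ-factors×monic = <-rec (λ n → .(NonZero n) → Φ₁.Factors n × Monic (Φ n)) step
  where
  step : ∀ n → (∀ {m} → m ℕ.< n → .(NonZero m) → Φ₁.Factors m × Monic (Φ m)) → .(NonZero n) → Φ₁.Factors n × Monic (Φ n)
  step (suc n′) rec _ = factors , (proj₁ monic-s , Lead-resp (≈ₚ-sym Φ≈s) (proj₂ monic-s))
    where
    n = suc n′
    D = Π n (Φ₁.ψ n)
    D∣ : D ∣ₚ X ^ₚ n -ₚ 1ₚ
    D∣ = Φ₁.Πψ∣x^n-1 n (λ j j<n {{j≢0}} → proj₁ (rec j<n j≢0))
    s = _∣ʳ_.quotient D∣
    s*D≈ : s *ₚ D ≈ₚ X ^ₚ n -ₚ 1ₚ
    s*D≈ = _∣ʳ_.equality D∣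
    monic-ψ : ∀ k → k ℕ.< n → Monic (Φ₁.ψ n k)
    monic-ψ k k<n with k ∣? n
    ... | no  _   = Monic-1
    ... | yes k∣n = proj₂ (rec k<n (ℕ.≢-nonZero λ { ≡.refl → contradiction (ℕ.0∣⇒≡0 k∣n) λ () }))
    monic-D : Monic D
    monic-D = Monic-Π n (Φ₁.ψ n) monic-ψ
    Φ≈s : Φ n ≈ₚ s
    Φ≈s = ≡.subst (_≈ₚ s) (≡.trans (≡.cong ((X ^ₚ n -ₚ 1ₚ) quo_) (Π≡product n (Φ₁.ψ n))) (≡.sym (Φ-unfold n)))
      (quo-exact (X ^ₚ n -ₚ 1ₚ) s D monic-D (≈ₚ-sym s*D≈))
    factors : Φ₁.Factors n
    factors = ≈ₚ-trans (≈ₚ-sym s*D≈) (*ₚ-cong (≈ₚ-sym Φ≈s) ≈ₚ-refl)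
    monic-s : Monic s
    monic-s = let d , l = X^-1-Monic n′ in Monic-cancelʳ s D (d , Lead-resp (≈ₚ-sym s*D≈) l) monic-D

X² : Poly
X² = X ^ₚ 2

opaque

  Φ[X²] : ℕ → Poly
  Φ[X²] m = Φ m ∘ₚ X²

  Φ[X²]≡ : ∀ m → Φ[X²] m ≡ Φ m ∘ₚ X²
  Φ[X²]≡ m = ≡.refl

cancel-X²^-1 : ∀ n {p r} .{{_ : NonZero n}} → (X² ^ₚ n -ₚ 1ₚ) *ₚ p ≈ₚ (X² ^ₚ n -ₚ 1ₚ) *ₚ r → p ≈ₚ r
cancel-X²^-1 (suc n) = *ₚ-cancelˡ (X² ^ₚ suc n -ₚ 1ₚ) (λ e → Monic-≉0 (X^-1-Monic (n ℕ.+ 1 ℕ.* suc n))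
  (≈ₚ-trans (+ₚ-cong (≈ₚ-sym (^-assocʳ X 2 (suc n))) (≈ₚ-refl { -ₚ 1ₚ})) e))

module Φ₂ = Cyclotomic X² Φ[X²] cancel-X²^-1 ×ₚ-inverse

∘ₚ-Π : ∀ g n (f : ℕ → Poly) → Π n f ∘ₚ g ≈ₚ Π n (λ k → f k ∘ₚ g)
∘ₚ-Π g zero    f = ≈ₚ-trans (∘ₚ-cong g (Π-zero f)) (≈ₚ-trans (∘ₚ-1 g) (≈ₚ-sym (Π-zero _)))
∘ₚ-Π g (suc n) f = begin
  Π (suc n) f ∘ₚ g                             ≈⟨ ∘ₚ-cong g (Π-snoc n f) ⟩
  (Π n f *ₚ f n) ∘ₚ g                          ≈⟨ ∘ₚ-*ₚ g (Π n f) (f n) ⟩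
  (Π n f ∘ₚ g) *ₚ (f n ∘ₚ g)                   ≈⟨ *ₚ-cong (∘ₚ-Π g n f) ≈ₚ-refl ⟩
  Π n (λ k → f k ∘ₚ g) *ₚ (f n ∘ₚ g)           ≈⟨ Π-snoc n _ ⟨
  Π (suc n) (λ k → f k ∘ₚ g)                   ∎

-- The factorisation for x = q, with q² substituted; substitution is a ring homomorphism and fixes
-- 1.
factors : ∀ n .{{_ : NonZero n}} → Φ₂.Factors n
factors n {{n≢0}} = begin
  X² ^ₚ n -ₚ 1ₚ
    ≈⟨ +ₚ-cong (^-congˡ n (∘ₚ-X X²)) (-ₚ-cong (∘ₚ-1 X²)) ⟨
  (X ∘ₚ X²) ^ₚ n -ₚ 1ₚ ∘ₚ X²
    ≈⟨ +ₚ-cong (∘ₚ-^ₚ X² X n) (∘ₚ--ₚ X² 1ₚ) ⟨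
  (X ^ₚ n) ∘ₚ X² +ₚ (-ₚ 1ₚ) ∘ₚ X²
    ≈⟨ ∘ₚ-+ₚ X² (X ^ₚ n) (-ₚ 1ₚ) ⟨
  (X ^ₚ n -ₚ 1ₚ) ∘ₚ X²
    ≈⟨ ∘ₚ-cong X² (proj₁ (Φ-factors×monic n n≢0)) ⟩
  (Φ n *ₚ Π n (Φ₁.ψ n)) ∘ₚ X²
    ≈⟨ ∘ₚ-*ₚ X² (Φ n) (Π n (Φ₁.ψ n)) ⟩
  (Φ n ∘ₚ X²) *ₚ (Π n (Φ₁.ψ n) ∘ₚ X²)
    ≡⟨ ≡.cong (_*ₚ (Π n (Φ₁.ψ n) ∘ₚ X²)) (Φ[X²]≡ n) ⟨
  Φ[X²] n *ₚ (Π n (Φ₁.ψ n) ∘ₚ X²)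
    ≈⟨ *ₚ-congˡ (Φ[X²] n) (≈ₚ-trans (∘ₚ-Π X² n (Φ₁.ψ n)) (Π-cong n λ k _ → ψ∘ k)) ⟩
  Φ[X²] n *ₚ Π n (Φ₂.ψ n) ∎
  where
  ψ∘ : ∀ k → Φ₁.ψ n k ∘ₚ X² ≈ₚ Φ₂.ψ n k
  ψ∘ k with k ∣? n
  ... | yes _ = 𝓟.reflexive (≡.sym (Φ[X²]≡ k))
  ... | no  _ = ∘ₚ-1 X²

-- The factors with index 0 and 1 in X²ⁿ - 1 cancel against X² - 1.
[n]≈Φ*Π : ∀ n → [ 2 ℕ.+ n ]q²ₚ ≈ₚ Φ[X²] (2 ℕ.+ n) *ₚ Π n (λ k → Φ₂.ψ (2 ℕ.+ n) (2 ℕ.+ k))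
[n]≈Φ*Π n = cancel-X²^-1 1 (begin
  (X² ^ₚ 1 -ₚ 1ₚ) *ₚ [ m ]q²ₚ
    ≈⟨ *ₚ-cong (+ₚ-cong (𝓟.*-identityʳ X²) (≈ₚ-refl { -ₚ 1ₚ})) (𝓟.reflexive (≡.sym (Σ≡sum m (X² ^ₚ_)))) ⟩
  (X² -ₚ 1ₚ) *ₚ Σ m (X² ^ₚ_)
    ≈⟨ *ₚ-comm (X² -ₚ 1ₚ) _ ⟩
  Σ m (X² ^ₚ_) *ₚ (X² -ₚ 1ₚ)
    ≈⟨ Σ-geometric X² m ⟩
  X² ^ₚ m -ₚ 1ₚ
    ≈⟨ factors m ⟩
  Φ[X²] m *ₚ Π m ψ
    ≈⟨ *ₚ-congˡ (Φ[X²] m) (≈ₚ-trans (Π-suc (suc n) ψ) (*ₚ-cong ψ₀ (≈ₚ-trans (Π-suc n _) (*ₚ-cong ψ₁ ≈ₚ-refl)))) ⟩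
  Φ[X²] m *ₚ (1ₚ *ₚ ((X² ^ₚ 1 -ₚ 1ₚ) *ₚ rest))
    ≈⟨ *ₚ-congˡ (Φ[X²] m) (*ₚ-identityˡ ((X² ^ₚ 1 -ₚ 1ₚ) *ₚ rest)) ⟩
  Φ[X²] m *ₚ ((X² ^ₚ 1 -ₚ 1ₚ) *ₚ rest)
    ≈⟨ solve 3 (λ a b c → a :* (b :* c) ⊜ b :* (a :* c)) ≈ₚ-refl (Φ[X²] m) (X² ^ₚ 1 -ₚ 1ₚ) rest ⟩
  (X² ^ₚ 1 -ₚ 1ₚ) *ₚ (Φ[X²] m *ₚ rest) ∎)
  where
  m = 2 ℕ.+ n
  ψ = Φ₂.ψ m
  rest = Π n (λ k → ψ (2 ℕ.+ k))
  ψ₀ : ψ 0 ≈ₚ 1ₚ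
  ψ₀ = Φ₂.ψ-∤ {0} {m} λ 0∣m → contradiction (ℕ.0∣⇒≡0 0∣m) λ ()
  ψ₁ : ψ 1 ≈ₚ X² ^ₚ 1 -ₚ 1ₚ
  ψ₁ = begin
    ψ 1                            ≈⟨ Φ₂.ψ-∣ (ℕ.1∣ m) ⟩
    Φ[X²] 1                        ≈⟨ 𝓟.*-identityʳ (Φ[X²] 1) ⟨
    Φ[X²] 1 *ₚ 1ₚ                  ≈⟨ *ₚ-congˡ (Φ[X²] 1) (≈ₚ-trans (Π-snoc 0 (Φ₂.ψ 1)) (*ₚ-cong (Π-zero (Φ₂.ψ 1)) (Φ₂.ψ-∤ {0} {1} λ 0∣1 → contradiction (ℕ.0∣⇒≡0 0∣1) λ ()))) ⟨
    Φ[X²] 1 *ₚ Π 1 (Φ₂.ψ 1)        ≈⟨ factors 1 ⟨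
    X² ^ₚ 1 -ₚ 1ₚ                  ∎

-- Specialisation to ℚ(q) and assembly of the modulus.

module 𝓚 = Field ratFunField
module 𝓛 = Localisation polyRing ratFunField embedding

Divisible⇒≡mod : ∀ {A B M} → 𝓛.Divisible M (A - B) → A ≡ B [mod M ]
Divisible⇒≡mod {A} {B} {M} (𝓛.mkDivisible h g c@(mkComaximal λ₁ λ₂ e) f*h≈Mg) with ≈0? h
... | no h≉0 = record
  { quotient    = mkRatFun (M *ₚ g) h h≉0
  ; quotient≃   = begin
      num f *ₚ h                    ≈⟨ 𝓟.*-identityʳ _ ⟨
      num f *ₚ h *ₚ 1ₚ              ≈⟨ f*h≈Mg ⟩
      M *ₚ g *ₚ (den f *ₚ 1ₚ)       ≈⟨ *ₚ-congˡ (M *ₚ g) (𝓟.*-identityʳ (den f)) ⟩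
      M *ₚ g *ₚ den f               ∎
  ; den-coprime = λ z∣h z∣M → ∣-respʳ e (∣-+ (∣-*ˡ λ₁ z∣M) (∣-*ˡ λ₂ z∣h))
  ; mod∣num     = g , *ₚ-comm g M
  }
  where
  f = A - B
  ∣-*ˡ : ∀ {z x} y → z ∣ₚ x → z ∣ₚ y *ₚ x
  ∣-*ˡ {z} y (q , e) = y *ₚ q , ≈ₚ-trans (*ₚ-assoc y q z) (*ₚ-congˡ y e)
  ∣-+ : ∀ {z x y} → z ∣ₚ x → z ∣ₚ y → z ∣ₚ x +ₚ y
  ∣-+ {z} (q , e) (q′ , e′) = q +ₚ q′ , ≈ₚ-trans (*ₚ-distribʳ z q q′) (+ₚ-cong e e′)
-- A zero denominator is comaximal with M only if M is a unit; then every numerator is divisible by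
-- M, and the difference serves as its own quotient.
... | yes h≈0 = record
  { quotient    = f
  ; quotient≃   = ≈ₚ-refl
  ; den-coprime = λ _ z∣M → ∣-trans z∣M (λ₁ , λ₁M≈1)
  ; mod∣num     = num f *ₚ λ₁ , (begin
      num f *ₚ λ₁ *ₚ M       ≈⟨ *ₚ-assoc (num f) λ₁ M ⟩
      num f *ₚ (λ₁ *ₚ M)     ≈⟨ *ₚ-congˡ (num f) λ₁M≈1 ⟩
      num f *ₚ 1ₚ            ≈⟨ 𝓟.*-identityʳ (num f) ⟩
      num f                  ∎)
  }
  where
  f = A - B
  λ₁M≈1 : λ₁ *ₚ M ≈ₚ 1ₚ
  λ₁M≈1 = begin
    λ₁ *ₚ M                  ≈⟨ +ₚ-identityʳ (λ₁ *ₚ M) ⟨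
    λ₁ *ₚ M +ₚ 0ₚ            ≈⟨ +ₚ-cong {λ₁ *ₚ M} ≈ₚ-refl (≈ₚ-trans (*ₚ-congˡ λ₂ h≈0) (*ₚ-zeroʳ λ₂)) ⟨
    λ₁ *ₚ M +ₚ λ₂ *ₚ h       ≈⟨ e ⟩
    1ₚ                       ∎

q≄0 : ¬ q ≃ 0#
q≄0 e = contradiction (coeff-≡ e 1) λ ()

1-q^≄0 : ∀ k → ¬ 1# - q ^ suc k ≃ 0#
1-q^≄0 k 1-q^≃0 = Monic-≉0 (X^-1-Monic k) (begin
  X ^ₚ suc k -ₚ 1ₚ                     ≈⟨ swap ⟨
  -ₚ (1ₚ -ₚ X ^ₚ suc k)                ≈⟨ -ₚ-cong (*1≈0⇒≈0 1-X^≈0) ⟩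
  0ₚ                                   ∎)
  where
  1-X^≈0 : (1ₚ -ₚ X ^ₚ suc k) *ₚ 1ₚ ≈ₚ 0ₚ
  1-X^≈0 = 𝓚.trans {fromPoly (1ₚ -ₚ X ^ₚ suc k)} {1# - q ^ suc k} {0#}
    (𝓚.trans {fromPoly (1ₚ -ₚ X ^ₚ suc k)} {1# - fromPoly (X ^ₚ suc k)} {1# - q ^ suc k}
      (𝓛.ι-- 1ₚ (X ^ₚ suc k))
      (𝓚.+-congˡ {1#} { - fromPoly (X ^ₚ suc k)} { - (q ^ suc k)} (𝓚.-‿cong {fromPoly (X ^ₚ suc k)} {q ^ suc k} (𝓛.ι-^ X (suc k)))))
    1-q^≃0
  swap : -ₚ (1ₚ -ₚ X ^ₚ suc k) ≈ₚ X ^ₚ suc k -ₚ 1ₚ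
  swap = solve 1 (λ x → :- (:1 :- x) ⊜ x :- :1) ≈ₚ-refl (X ^ₚ suc k)

exponential : Exponential ratFunField
exponential = record
  { E     = q ^ℤ_
  ; E-0   = 𝓚.refl {1#}
  ; E-+   = λ i j → ≡.subst₂ _≃_ (power≡ (i ℤ.+ j)) (≡.cong₂ _*_ (power≡ i) (power≡ j)) (Exponential.E-+ powers i j)
  ; 1-E≉0 = λ {i} i≢0 → ≡.subst (λ e → ¬ 1# - e ≃ 0#) (power≡ i) (Exponential.1-E≉0 powers i≢0)
  }
  where
  powers = Powers.exponential ratFunField q q≄0 1-q^≄0
  power≡ : ∀ i → Powers.power ratFunField q i ≡ q ^ℤ i
  power≡ (+ n)    = ≡.refl
  power≡ -[1+ n ] = ≡.refl

module AtΦ (m : ℕ) {{m≢0 : NonZero m}} where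

  X*X^≈ : ∀ k → (X *ₚ X) ^ₚ k -ₚ 1ₚ ≈ₚ X² ^ₚ k -ₚ 1ₚ
  X*X^≈ k = +ₚ-cong (^-congˡ k (*ₚ-congˡ X (≈ₚ-sym (𝓟.*-identityʳ X)))) (≈ₚ-refl { -ₚ 1ₚ})

  Φ∣X*X^-1 : Φ[X²] m ∣ₚ (X *ₚ X) ^ₚ m -ₚ 1ₚ
  Φ∣X*X^-1 = ∣-respʳ (≈ₚ-sym (X*X^≈ m)) (Φ₂.Φ∣x^n-1 {m} (factors m))

  Φ-comaximal : ∀ k → ¬ m ℕ.∣ k → Comaximal (Φ[X²] m) ((X *ₚ X) ^ₚ k -ₚ 1ₚ)
  Φ-comaximal k m∤k = Comaximal-resp (≈ₚ-sym (X*X^≈ k)) (Φ₂.comaximal-^-1 {m} {k} m∤k (λ j _ → factors j))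

  q^≃ : ∀ k → q ^ k ≃ fromPoly (X ^ₚ k)
  q^≃ k = 𝓚.sym {fromPoly (X ^ₚ k)} {q ^ k} (𝓛.ι-^ X k)

  private
    module 𝓕 = 𝓛.AtFactor exponential X q^≃ ×ₚ-inverse {m} {{m≢0}} (Φ[X²] m) Φ∣X*X^-1 Φ-comaximal

  opaque

    place : Place ratFunField exponential m
    place = 𝓕.place

    I⇒Divisible : ∀ {f} e → PlaceProperties.I ratFunField exponential place e f → 𝓛.Divisible (Φ[X²] m ^ₚ e) f
    I⇒Divisible = 𝓕.I⇒Divisible

modulus : ℕ → Poly
modulus n = [ n ]q²ₚ *ₚ Φ[X²] n ^ₚ 2

modulus≡ : ∀ n → modulus n ≡ [ n ]q²ₚ *ₚ (Φ n ∘ₚ (X ^ₚ 2)) ^ₚ 2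
modulus≡ n = ≡.cong (λ φ → [ n ]q²ₚ *ₚ φ ^ₚ 2) (Φ[X²]≡ n)

-- The polynomial [n] at q² already contains Φ_n(q²) once, so the modulus is the cube of Φ_n(q²)
-- times the Φ_m(q²) for the proper divisors m > 1. Indices that do not divide n contribute the
-- factor 1.
Divisible-modulus : ∀ n {f} → 1 ℕ.< n →
  (∀ m → 1 ℕ.< m → m ℕ.< n → m ℕ.∣ n → 𝓛.Divisible (Φ[X²] m) f) →
  𝓛.Divisible (Φ[X²] n ^ₚ 3) f → 𝓛.Divisible (modulus n) f
Divisible-modulus (suc (suc n)) {f} (s≤s (s≤s z≤n)) proper top = 𝓛.Divisible-resp (begin
    φ ^ₚ 3 *ₚ rest
      ≈⟨ solve 2 (λ φ r → φ :* (φ :* (φ :* :1)) :* r ⊜ φ :* r :* (φ :* (φ :* :1))) ≈ₚ-refl φ rest ⟩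
    φ *ₚ rest *ₚ φ ^ₚ 2
      ≈⟨ *ₚ-cong ([n]≈Φ*Π n) ≈ₚ-refl ⟨
    [ m ]q²ₚ *ₚ φ ^ₚ 2 ∎)
  (𝓛.Divisible-* (Comaximal-sym (Comaximal-^ 3 (Comaximal-sym (Comaximal-Π n _ λ k k<n → top-comaximal k k<n))))
    top (𝓛.Divisible-Π n _
      (λ i j i<j _ → Φ₂.comaximal-ψ {m} (s≤s (s≤s i<j)) (λ k _ → factors k)) divisible))
  where
  m = 2 ℕ.+ n
  φ = Φ[X²] m
  rest = Π n (λ k → Φ₂.ψ m (2 ℕ.+ k))
  top-comaximal : ∀ k → k ℕ.< n → Comaximal φ (Φ₂.ψ m (2 ℕ.+ k))
  top-comaximal k k<n = Φ₂.ψ-elim (Comaximal φ) m (2 ℕ.+ k)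
    (λ _ → Φ₂.comaximal-Φ {m} {2 ℕ.+ k} (s≤s (s≤s k<n)) (λ j _ → factors j)) (Comaximal-1 φ)
  divisible : ∀ k → k ℕ.< n → 𝓛.Divisible (Φ₂.ψ m (2 ℕ.+ k)) f
  divisible k k<n = Φ₂.ψ-elim (λ P → 𝓛.Divisible P f) m (2 ℕ.+ k)
    (proper (2 ℕ.+ k) (s≤s (s≤s z≤n)) (s≤s (s≤s k<n))) (𝓛.Divisible-1 f)

Σ<-cong : ∀ l {f g : ℕ → RatFun} → (∀ k → f k ≡ g k) → Σ< l f ≡ Σ< l g
Σ<-cong zero    f≡g = ≡.refl
Σ<-cong (suc l) f≡g = ≡.cong₂ _+_ (f≡g 0) (Σ<-cong l (f≡g ∘ suc))

-- Consequences of the hypotheses on n, d and t.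

module Arithmetic
  (n d : ℕ) (t : ℤ) .{{_ : ℕ.NonZero d}} (1<n : 1 ℕ.< n) (2≤d : 2 ℕ.≤ d) (gcd≡1 : gcd t (+ d) ≡ + 1)
  (d∣n-t : (+ d) ∣ (+ n ℤ.- t)) (lower : + n ℤ.+ + d ℤ.- + n ℤ.* + d ℤ.≤ t) (t≤n : t ℤ.≤ + n)
  where

  N : ℕ
  N = ∣ + n ℤ.- t ∣ ℕ./ d

  n-t≡Nd : + n ℤ.- t ≡ + N ℤ.* + d
  n-t≡Nd = ≡.trans (≡.sym (ℤ.0≤i⇒+∣i∣≡i (ℤ.i≤j⇒0≤j-i t≤n))) (≡.trans (≡.cong +_ (≡.sym (ℕ.m/n*n≡m d∣n-t))) (ℤ.pos-* N d))

  n≡t+dN : + n ≡ t ℤ.+ + d ℤ.* + N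
  n≡t+dN = ≡.trans (lemma (+ n) t) (≡.cong (λ x → t ℤ.+ x) (≡.trans n-t≡Nd (ℤ.*-comm (+ N) (+ d))))
    where
    lemma : ∀ n t → n ≡ t ℤ.+ (n ℤ.- t)
    lemma = ℤ-Solver.solve-∀

  -- The lower bound on t is exactly n - t ≤ (n - 1) d. It ensures that the series terminates before
  -- a factor of (p;p)_k becomes divisible by Φ_n(w).
  N<n : N ℕ.< n
  N<n = ℤ.drop‿+<+ (ℤ.≤-<-trans N≤n-1 (ℤ.suc[i]≤j⇒i<j (ℤ.≤-reflexive (lemma (+ n)))))
    where
    lemma : ∀ n → + 1 ℤ.+ (n ℤ.- + 1) ≡ n
    lemma = ℤ-Solver.solve-∀
    lemma₁ : ∀ n d → (n ℤ.- (n ℤ.+ d ℤ.- n ℤ.* d)) ≡ (n ℤ.- + 1) ℤ.* d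
    lemma₁ = ℤ-Solver.solve-∀
    N≤n-1 : + N ℤ.≤ + n ℤ.- + 1
    N≤n-1 = ℤ.*-cancelʳ-≤-pos (+ N) (+ n ℤ.- + 1) (+ d) {{ℤ.positive (ℤ.+<+ (ℕ.≤-trans (s≤s z≤n) 2≤d))}}
      (≡.subst₂ ℤ._≤_ n-t≡Nd (lemma₁ (+ n) (+ d)) (ℤ.+-monoʳ-≤ (+ n) (ℤ.neg-mono-≤ lower)))

  ∣t∧∣d⇒≡1 : ∀ e → + e Signed.∣ t → e ℕ.∣ d → e ≡ 1
  ∣t∧∣d⇒≡1 e e∣t e∣d = ℕ.∣1⇒≡1 (≡.subst (e ℕ.∣_) (ℤ.+-injective gcd≡1) (ℕ.gcd-greatest (Signed.∣⇒∣ᵤ e∣t) e∣d))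

  +d∣+d* : ∀ i → + d Signed.∣ + d ℤ.* i
  +d∣+d* i = Signed.divides i (ℤ.*-comm (+ d) i)

  d∤t : ¬ + d Signed.∣ t
  d∤t d∣t = contradiction (∣t∧∣d⇒≡1 d d∣t ℕ.∣-refl) (λ d≡1 → ℕ.<⇒≢ 2≤d (≡.sym d≡1))

  -- Otherwise d would divide t, against coprimality and d ≥ 2. This keeps all 1 - a pʲ nonzero, and
  -- 1 + a as well.
  t+dj≢0 : ∀ j → ¬ t ℤ.+ + d ℤ.* + j ≡ + 0
  t+dj≢0 j eq = d∤t (Signed.∣m+n∣n⇒∣m {m = t} (≡.subst (+ d Signed.∣_) (≡.sym eq) (Signed.divides (+ 0) ≡.refl)) (+d∣+d* (+ j)))

  -- As n ≡ t modulo d, d does not divide n either. The perturbed denominators 1 - pʲ⁺¹ / y are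
  -- therefore nonzero.
  d[1+j]≢n : ∀ j → ¬ + d ℤ.* + suc j ℤ.- + n ≡ + 0
  d[1+j]≢n j eq = d∤t (Signed.∣m+n∣n⇒∣m {m = t} (≡.subst (+ d Signed.∣_)
    (≡.trans (ℤ.i-j≡0⇒i≡j _ (+ n) eq) n≡t+dN) (+d∣+d* (+ suc j))) (+d∣+d* (+ N)))

  -- A common divisor of m and d divides n and d N, hence also t = n - d N.
  coprime : ∀ {m} → m ℕ.∣ n → ℕ.Coprime m d
  coprime m∣n {e} (e∣m , e∣d) = ∣t∧∣d⇒≡1 e
    (Signed.∣m+n∣n⇒∣m {m = t} (≡.subst (+ e Signed.∣_) n≡t+dN (Signed.∣ᵤ⇒∣ (ℕ.∣-trans e∣m m∣n)))
      (Signed.∣m⇒∣m*n (+ N) (Signed.∣ᵤ⇒∣ {+ e} {+ d} e∣d))) e∣d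

  cancel-d : ∀ {m} → m ℕ.∣ n → ∀ i → + m Signed.∣ + d ℤ.* i → + m Signed.∣ i
  cancel-d {m} m∣n i m∣di = Signed.∣ᵤ⇒∣ (ℕ.coprime-divisor (coprime m∣n)
    (≡.subst (m ℕ.∣_) (ℤ.abs-* (+ d) i) (Signed.∣⇒∣ᵤ m∣di)))

  module 𝓣 = Terms ratFunField q exponential (λ _ → ≡.refl) n d N t n≡t+dN t+dj≢0

  1<⇒NonZero : ∀ {m} → 1 ℕ.< m → NonZero m
  1<⇒NonZero 1<m = ℕ.>-nonZero (ℕ.<-trans (s≤s z≤n) 1<m)

  module _ {m : ℕ} (1<m : 1 ℕ.< m) (m∣n : m ℕ.∣ n) where
    private
      instance
        m≢0 : NonZero m
        m≢0 = 1<⇒NonZero 1<m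
      module 𝓐 = AtΦ m
      module 𝓒 = 𝓣.Congruence 1<m 𝓐.place m∣n (cancel-d m∣n)

    Divisible-N : 𝓛.Divisible (Φ[X²] m) (𝓣.difference (suc N))
    Divisible-N = 𝓛.Divisible-resp (𝓟.*-identityʳ (Φ[X²] m)) (𝓐.I⇒Divisible 1 𝓒.I-mod-N)

    Divisible-n : 𝓛.Divisible (Φ[X²] m) (𝓣.difference n)
    Divisible-n = 𝓛.Divisible-resp (𝓟.*-identityʳ (Φ[X²] m)) (𝓐.I⇒Divisible 1 𝓒.I-mod-n)

  private
    instance
      n≢0 : NonZero n
      n≢0 = 1<⇒NonZero 1<n
    module 𝓐 = AtΦ n
    module 𝓒³ = 𝓣.CubeCongruence 1<n 𝓐.place (cancel-d ℕ.∣-refl) N<n d[1+j]≢n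

  Divisible-difference-N : 𝓛.Divisible (modulus n) (𝓣.difference (suc N))
  Divisible-difference-N = Divisible-modulus n 1<n (λ m 1<m _ m∣n → Divisible-N 1<m m∣n) (𝓐.I⇒Divisible 3 𝓒³.I-cube-N)

  Divisible-difference-n : 𝓛.Divisible (modulus n) (𝓣.difference n)
  Divisible-difference-n = Divisible-modulus n 1<n (λ m 1<m _ m∣n → Divisible-n 1<m m∣n) (𝓐.I⇒Divisible 3 𝓒³.I-cube-n)

  open 𝓣.Transport _+_ _-_ _*_ _/_ -_ _^_ 1# 2# (q ^ℤ_) [_] [_]q² poch Σ<
    (λ _ _ → ≡.refl) (λ _ _ → ≡.refl) (λ _ _ → ≡.refl) (λ _ _ → ≡.refl) (λ _ → ≡.refl) (λ _ _ → ≡.refl) ≡.refl ≡.refl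
    (λ _ → ≡.refl) (λ _ → ≡.refl) (λ _ → ≡.refl) (λ _ _ _ → ≡.refl) (λ l f g f≡g → Σ<-cong l f≡g)
    public

theorem6 :
    (n d : ℕ) (t : ℤ) .{{_ : ℕ.NonZero d}} →
    1 ℕ.< n →
    2 ℕ.≤ d →
    gcd t (+ d) ≡ + 1 →
    (+ d) ∣ (+ n ℤ.- t) →
    + n ℤ.+ + d ℤ.- + n ℤ.* + d ℤ.≤ t →
    t ℤ.≤ + n →
    let
      N : ℕ
      N = ∣ + n ℤ.- t ∣ ℕ./ d

      term : ℕ → RatFun
      term k =
        [ + 2 ℤ.* + d ℤ.* + k ℤ.+ t ]q² * [ + 2 ℤ.* + d ℤ.* + k ℤ.+ t ] ^ 2
        * (poch (q ^ℤ (+ 2 ℤ.* t)) (q ^ (2 ℕ.* d)) k ^ 4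
           / poch (q ^ (2 ℕ.* d)) (q ^ (2 ℕ.* d)) k ^ 4)
        * q ^ℤ (ℤ.- (+ 4 ℤ.* t ℤ.* + k))

      rhs : RatFun
      rhs =
        ((- 2#) * [ t ] ^ 2 * [ + n ]q² * poch (q ^ℤ (+ 4 ℤ.* t)) (q ^ (2 ℕ.* d)) N)
        / ((1# + q ^ℤ (+ 2 ℤ.* t)) * poch (q ^ (2 ℕ.* d)) (q ^ (2 ℕ.* d)) N)
        * q ^ℤ (t ℤ.- + 2 ℤ.* t ℤ.* + N)

      modulus : Poly
      modulus = [ n ]q²ₚ *ₚ (Φ n ∘ₚ (X ^ₚ 2)) ^ₚ 2
    in
    (Σ< (suc N) term ≡ rhs [mod modulus ]) × (Σ< n term ≡ rhs [mod modulus ])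
theorem6 n d t 1<n 2≤d gcd≡1 d∣n-t lower t≤n =
  Divisible⇒≡mod (≡.subst₂ 𝓛.Divisible (modulus≡ n) (≡.sym (difference≡ (suc N))) Divisible-difference-N) ,
  Divisible⇒≡mod (≡.subst₂ 𝓛.Divisible (modulus≡ n) (≡.sym (difference≡ n)) Divisible-difference-n)
  where open Arithmetic n d t 1<n 2≤d gcd≡1 d∣n-t lower t≤n
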